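{- For every integer $n\ge 1$, the third factorial moment of the area statistic on parking functions of length $n$ is $$\mathbb{E}\big[\mathrm{Area}(\mathrm{Area}-1)(\mathrm{Area}-2)\big]=-\frac{175}{192}n^{4}-\frac{283}{192}n^{3}+\frac{199}{192}n^{2}+\frac{259}{192}n+\left(\frac{15}{32}n^{3}+\frac{521}{96}n^{2}+\frac{1219}{96}n+\frac{743}{96}\right)E_1(n),$$ and asymptotically it equals $\frac{15}{128}\sqrt{2\pi}\, n^{9/2}+O(n^{4})$ as $n\to\infty$.
   Context: A parking function of length $n$ is a vector $(p_1,\dots,p_n)$ of positive integers such that its weakly increasing rearrangement $p_{(1)}\le p_{(2)}\le\dots\le p_{(n)}$ satisfies $p_{(i)}\le i$ for all $1\le i\le n$. There are $(n+1)^{n-1}$ of them. The area statistic is $\mathrm{Area}(p)=\frac{n(n+1)}{2}-\sum_{i=1}^n p_i$. Expectations are taken with respect to the uniform distribution on the set of parking functions of length $n$; the $k$-th factorial moment is $\mathbb{E}[\mathrm{Area}(\mathrm{Area}-1)\cdots(\mathrm{Area}-k+1)]$. Here $E_1(n)$ denotes $$E_1(n)= -\frac{n}{2}+\frac{1}{2}\,\frac{(n+1)!}{(n+1)^{n}}\sum_{k=0}^{n-1}\frac{(n+1)^k}{k!},$$ which is the expectation of the area statistic on parking functions of length $n$. -}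

module Defs where

open import Data.Bool using (Bool; true; false; _∧_)
open import Data.Nat as ℕ using (ℕ; zero; suc; _≤ᵇ_; _!)
open import Data.Nat.Properties using (≤-decTotalOrder; m^n≢0; _!≢0)
open import Data.List using (List; []; _∷_; [_]; map; concatMap; upTo; filterᵇ; length; foldr)
open import Data.List.Sort.InsertionSort.Base ≤-decTotalOrder using (sort)
open import Data.Integer using (+_)
open import Data.Rational using (ℚ; _/_; _+_; _-_; _*_; -_; _≤_; 0ℚ; 1ℚ)
open import Data.Product using (_×_)
open import Data.Sum using (_⊎_)

candidates : ℕ → ℕ → List (List ℕ)
candidates m zero      = [ [] ]
candidates m (suc len) =
  concatMap (λ x → map (x ∷_) (candidates m len)) (map suc (upTo m))

boundedFrom : ℕ → List ℕ → Bool
boundedFrom i []       = true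
boundedFrom i (x ∷ xs) = (x ≤ᵇ i) ∧ boundedFrom (suc i) xs

isParkingᵇ : List ℕ → Bool
isParkingᵇ p = boundedFrom 1 (sort p)

-- The parking functions of length n. Every parking function of length n
-- has entries in {1,…,n} (since p_(i) ≤ i ≤ n), so enumerating
-- candidates n n and filtering gives exactly all parking functions.
ParkingFunctions : ℕ → List (List ℕ)
ParkingFunctions n = filterᵇ isParkingᵇ (candidates n n)

sumℕ : List ℕ → ℕ
sumℕ = foldr ℕ._+_ 0

Area : ℕ → List ℕ → ℚ
Area n p = ((+ (n ℕ.* suc n)) / 2) - ((+ sumℕ p) / 1)

falling : ℚ → ℕ → ℚ
falling x zero    = 1ℚ
falling x (suc k) = falling x k * (x - ((+ k) / 1))

sumℚ : List ℚ → ℚ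
sumℚ = foldr _+_ 0ℚ

-- 1/m for m ≠ 0 (the 0 case never arises: ParkingFunctions n is nonempty)
inv : ℕ → ℚ
inv zero    = 0ℚ
inv (suc m) = (+ 1) / suc m

Expect : ℕ → (List ℕ → ℚ) → ℚ
Expect n f = sumℚ (map f (ParkingFunctions n)) * inv (length (ParkingFunctions n))

M3 : ℕ → ℚ
M3 n = Expect n (λ p → falling (Area n p) 3)

E1 : ℕ → ℚ
E1 n = - ((+ n) / 2)
     + ((+ 1) / 2) * (_/_ (+ (suc n !)) (suc n ℕ.^ n) {{m^n≢0 (suc n) n}})
       * sumℚ (map (λ k → _/_ (+ (suc n ℕ.^ k)) (k !) {{k !≢0}}) (upTo n))

-- π via the Leibniz series: S k = 4 Σ_{j<k} (-1)^j/(2j+1), and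
-- |π - S k| ≤ 4/(2k+1) for all k, so π is the unique real number with
-- S k - err k ≤ π ≤ S k + err k for every k.

leibnizTerm : ℕ → ℚ
leibnizTerm j with j ℕ.% 2
... | zero = (+ 4) / (suc (2 ℕ.* j))
... | suc _ = - ((+ 4) / (suc (2 ℕ.* j)))

S : ℕ → ℚ
S k = sumℚ (map leibnizTerm (upTo k))

err : ℕ → ℚ
err k = (+ 4) / suc (2 ℕ.* k)

-- For a rational u ≥ 0 and rational q:
-- "q ≤ √(2πu)"   (q ≤ 0, or q² ≤ 2πu)
_≤√2π·_ : ℚ → ℚ → Set
q ≤√2π· u = (q ≤ 0ℚ) ⊎ (∀ k → q * q ≤ ((+ 2) / 1) * u * (S k + err k))

-- "√(2πu) ≤ q"   (q ≥ 0 and 2πu ≤ q²)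
√2π·_≤_ : ℚ → ℚ → Set
√2π· u ≤ q = (0ℚ ≤ q) × (∀ k → ((+ 2) / 1) * u * (S k - err k) ≤ q * q)

{-# OPTIONS --safe #-}
module Submission where

{-
Consider the words of length n whose sorted rearrangement is dominated by x, x + 1, …  Deleting the
letters 1 and lowering the other letters by one gives a recurrence in x for their area enumerators
A(x), and by induction A(x + 1; t) = A(x; q t) A(1; t) and Kreweras' equation P' = P · [1 + θ]_q P for
the exponential generating function P = A(1), where θ = t d/dt.

For q = 1 + ε the coefficients of ε are the factorial moments.  Order by order they have the form
E · g(v) with E = exp τ, v = 1 / (1 - τ), τ the tree function and g a polynomial: the polynomials are
verified on coefficient lists, and linear differential equations have unique solutions.  The relation
θ (E vᵏ) = E (k vᵏ⁺² - (k - 1) vᵏ⁺¹ - vᵏ) then reduces everything to the coefficients (n + 1)ⁿ⁻¹ of E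
and n! Σ_{k ≤ n} (n + 1)ᵏ / k! of E v²; the latter is also what the first moment E1 contains.

For the asymptotics, E1 is (n + 1) Q / 2 up to O(n), where Q = Σ_j Π_{1 ≤ i ≤ j} (1 - i / (n + 1)).
Let b_k = C(2m+1, m-k) / C(2m+1, m) with m = 2n + 2.  Comparing ratios of consecutive terms shows
Q ≤ σ ≤ Q + 1 for σ = Σ_k b_k.  Moreover 4 σ² = (m + 1) T for the damped Leibniz series
T = 4 Σ_k (-1)ᵏ b_k / (2k + 1).  As m grows, T decreases and 8 σ² / (2m + 3) increases, both to π, so
the partial sums of the Leibniz series bracket σ².
-}

open import Algebra.Bundles using (CommutativeRing)
import Algebra.Solver.Ring
import Algebra.Solver.Ring.AlmostCommutativeRing as ACR
open import Data.Bool using (Bool; true; false; if_then_else_; _∧_)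
open import Data.Empty using (⊥; ⊥-elim)
open import Data.List using (List; []; _∷_; map; _++_; replicate; upTo; applyUpTo; concatMap; foldr; length; filterᵇ)
open import Data.List.Properties using (map-applyUpTo; upTo-∷ʳ)
open import Data.List.Relation.Binary.Permutation.Propositional using (↭-sym)
open import Data.List.Relation.Binary.Permutation.Propositional.Properties using (All-resp-↭; ↭-length)
open import Data.List.Relation.Unary.All as All using (All; []; _∷_)
import Data.List.Relation.Unary.All.Properties as AllP
import Data.Maybe as Maybe
open import Data.Nat as ℕ using (ℕ; zero; suc; z≤n; s≤s; _≤ᵇ_; _∸_; _!)
open import Data.Nat.ListAction.Properties using (sum-↭)
import Data.Nat.Properties as ℕP
import Data.Nat.Solver
open import Data.List.Sort.InsertionSort.Base ℕP.≤-decTotalOrder using (insert; sort)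
open import Data.List.Sort.InsertionSort.Properties ℕP.≤-decTotalOrder using (sort-↭)
open import Data.Product using (_,_; _×_; proj₁; proj₂; ∃-syntax)
open import Data.Sum using (_⊎_; inj₁; inj₂)
open import Function using (_∘_; id)
open import Relation.Binary.PropositionalEquality as ≡ using (_≡_)
open import Relation.Nullary.Decidable using (True; toWitness; from-no; dec⇒maybe)
open import Defs

-- Hurwitz series

-- No recurrence closes on x = 1: deleting k letters 1 raises the bound from x to x + k, so all
-- bounds are treated together. Exponential generating functions fit because the positions of the
-- deleted letters are free, and the construction is iterated (series in t over series in ε), so
-- that one recurrence yields every moment.
--
-- The weights b_k come from Fourier analysis: (2 cos φ)^(2m+1) = 2 Σ C(2m+1, m-k) cos((2k+1) φ).
-- Integration over [0, π/2] turns the right side into a Leibniz series damped by b_k and the left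
-- side into a Wallis integral, whence 4 σ² = (m + 1) T. Since π is given only by rational brackets,
-- recurrences in m replace the integral and an Archimedean argument replaces the limit.
--
-- The choice m = 2n + 2 matches two rates of decay: consecutive terms have ratio 1 - (j+1)/(n+1) in
-- Q and 1 - (j+1)/(n+2+j/2) in σ.

module Hurwitz {c ℓ} (R : CommutativeRing c ℓ) where
  open CommutativeRing R
  open import Relation.Binary.Reasoning.Setoid setoid
  open import Algebra.Properties.CommutativeSemigroup +-commutativeSemigroup using (interchange)

  -- Binomial convolution, the sum of C(n,k) f k j over k + j = n. Written through Pascal's rule it
  -- needs no binomial coefficients, and the Leibniz rule `D-⋆` holds by definition.
  Φ : (ℕ → ℕ → Carrier) → ℕ → Carrier
  Φ f zero    = f 0 0
  Φ f (suc n) = Φ (λ k j → f (suc k) j) n + Φ (λ k j → f k (suc j)) n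

  Φ-cong : ∀ n {f g} → (∀ k j → k ℕ.+ j ≡ n → f k j ≈ g k j) → Φ f n ≈ Φ g n
  Φ-cong zero    e = e 0 0 ≡.refl
  Φ-cong (suc n) e = +-cong
    (Φ-cong n λ k j p → e (suc k) j (≡.cong suc p))
    (Φ-cong n λ k j p → e k (suc j) (≡.trans (ℕP.+-suc k j) (≡.cong suc p)))

  Φ-+ : ∀ n f g → Φ (λ k j → f k j + g k j) n ≈ Φ f n + Φ g n
  Φ-+ zero    f g = refl
  Φ-+ (suc n) f g = trans (+-cong (Φ-+ n _ _) (Φ-+ n _ _)) (interchange _ _ _ _)

  Φ-0 : ∀ n → Φ (λ _ _ → 0#) n ≈ 0#
  Φ-0 zero    = refl
  Φ-0 (suc n) = trans (+-cong (Φ-0 n) (Φ-0 n)) (+-identityˡ 0#)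

  Φ-*ˡ : ∀ n a f → Φ (λ k j → a * f k j) n ≈ a * Φ f n
  Φ-*ˡ zero    a f = refl
  Φ-*ˡ (suc n) a f = trans (+-cong (Φ-*ˡ n a _) (Φ-*ˡ n a _)) (sym (distribˡ a _ _))

  Φ-*ʳ : ∀ n a f → Φ (λ k j → f k j * a) n ≈ Φ f n * a
  Φ-*ʳ n a f = trans (Φ-cong n λ k j _ → *-comm (f k j) a) (trans (Φ-*ˡ n a f) (*-comm a _))

  Φ-flip : ∀ n f → Φ f n ≈ Φ (λ k j → f j k) n
  Φ-flip zero    f = refl
  Φ-flip (suc n) f = trans (+-cong (Φ-flip n _) (Φ-flip n _)) (+-comm _ _)

  -- Both sides are the trinomial convolution over k + i + l = n. The three summands of the step
  -- record which of the three indices grows.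
  Φ-assoc : ∀ n (f : ℕ → ℕ → ℕ → Carrier) →
    Φ (λ m l → Φ (λ k i → f k i l) m) n ≈ Φ (λ k j → Φ (λ i l → f k i l) j) n
  Φ-assoc zero    f = refl
  Φ-assoc (suc n) f = begin
    Φ (λ m l → Φ (λ k i → f (suc k) i l) m + Φ (λ k i → f k (suc i) l) m) n
      + Φ (λ m l → Φ (λ k i → f k i (suc l)) m) n
      ≈⟨ +-congʳ (Φ-+ n _ _) ⟩
    (Φ (λ m l → Φ (λ k i → f (suc k) i l) m) n + Φ (λ m l → Φ (λ k i → f k (suc i) l) m) n)
      + Φ (λ m l → Φ (λ k i → f k i (suc l)) m) n
      ≈⟨ +-cong (+-cong (Φ-assoc n _) (Φ-assoc n _)) (Φ-assoc n _) ⟩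
    (Φ (λ k j → Φ (λ i l → f (suc k) i l) j) n + Φ (λ k j → Φ (λ i l → f k (suc i) l) j) n)
      + Φ (λ k j → Φ (λ i l → f k i (suc l)) j) n
      ≈⟨ +-assoc _ _ _ ⟩
    Φ (λ k j → Φ (λ i l → f (suc k) i l) j) n
      + (Φ (λ k j → Φ (λ i l → f k (suc i) l) j) n + Φ (λ k j → Φ (λ i l → f k i (suc l)) j) n)
      ≈⟨ +-congˡ (Φ-+ n _ _) ⟨
    Φ (λ k j → Φ (λ i l → f (suc k) i l) j) n
      + Φ (λ k j → Φ (λ i l → f k (suc i) l) j + Φ (λ i l → f k i (suc l)) j) n ∎

  Series : Set c
  Series = ℕ → Carrier

  infix  4 _≋_
  infixr 6 _⊕_
  infixl 7 _⋆_

  _≋_ : Series → Series → Set ℓ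
  f ≋ g = ∀ n → f n ≈ g n

  _⊕_ _⋆_ : Series → Series → Series
  (f ⊕ g) n = f n + g n
  (f ⋆ g) n = Φ (λ k j → f k * g j) n

  ⊖_ D : Series → Series
  (⊖ f) n = - f n
  D f n = f (suc n)

  C : Carrier → Series
  C a zero    = a
  C a (suc n) = 0#

  𝟘 𝟙 : Series
  𝟘 _ = 0#
  𝟙   = C 1#

  D-⋆ : ∀ f g → D (f ⋆ g) ≋ (D f ⋆ g) ⊕ (f ⋆ D g)
  D-⋆ f g n = refl

  ⋆-cong : ∀ {f f' g g'} → f ≋ f' → g ≋ g' → f ⋆ g ≋ f' ⋆ g'
  ⋆-cong p q n = Φ-cong n λ k j _ → *-cong (p k) (q j)

  ⋆-comm : ∀ f g → f ⋆ g ≋ g ⋆ f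
  ⋆-comm f g n = trans (Φ-flip n _) (Φ-cong n λ k j _ → *-comm _ _)

  ⋆-assoc : ∀ f g h → (f ⋆ g) ⋆ h ≋ f ⋆ (g ⋆ h)
  ⋆-assoc f g h n = begin
    Φ (λ m l → Φ (λ k i → f k * g i) m * h l) n
      ≈⟨ Φ-cong n (λ m l _ → Φ-*ʳ m (h l) _) ⟨
    Φ (λ m l → Φ (λ k i → f k * g i * h l) m) n
      ≈⟨ Φ-assoc n (λ k i l → f k * g i * h l) ⟩
    Φ (λ k j → Φ (λ i l → f k * g i * h l) j) n
      ≈⟨ Φ-cong n (λ k j _ → trans (Φ-cong j λ i l _ → *-assoc _ _ _) (Φ-*ˡ j (f k) _)) ⟩
    Φ (λ k j → f k * Φ (λ i l → g i * h l) j) n ∎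

  ⋆-distribˡ : ∀ f g h → f ⋆ (g ⊕ h) ≋ (f ⋆ g) ⊕ (f ⋆ h)
  ⋆-distribˡ f g h n = trans (Φ-cong n λ k j _ → distribˡ _ _ _) (Φ-+ n _ _)

  ⋆-distribʳ : ∀ f g h → (g ⊕ h) ⋆ f ≋ (g ⋆ f) ⊕ (h ⋆ f)
  ⋆-distribʳ f g h n = trans (Φ-cong n λ k j _ → distribʳ _ _ _) (Φ-+ n _ _)

  C-⋆ : ∀ a f n → (C a ⋆ f) n ≈ a * f n
  C-⋆ a f zero    = refl
  C-⋆ a f (suc n) = begin
    (𝟘 ⋆ f) n + (C a ⋆ D f) n ≈⟨ +-cong (trans (Φ-cong n λ k j _ → zeroˡ _) (Φ-0 n)) (C-⋆ a (D f) n) ⟩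
    0# + a * f (suc n)        ≈⟨ +-identityˡ _ ⟩
    a * f (suc n)             ∎

  ⋆-identityˡ : ∀ f → 𝟙 ⋆ f ≋ f
  ⋆-identityˡ f n = trans (C-⋆ 1# f n) (*-identityˡ _)

  -- The bundle allows Hurwitz series to be coefficients of Hurwitz series again, and the ring
  -- solver to work on series.
  hurwitzRing : CommutativeRing c ℓ
  hurwitzRing = record
    { Carrier = Series ; _≈_ = _≋_ ; _+_ = _⊕_ ; _*_ = _⋆_ ; -_ = ⊖_ ; 0# = 𝟘 ; 1# = 𝟙
    ; isCommutativeRing = record
      { isRing = record
        { +-isAbelianGroup = record
          { isGroup = record
            { isMonoid = record
              { isSemigroup = record
                { isMagma = record
                  { isEquivalence = record
                    { refl = λ n → refl ; sym = λ p n → sym (p n) ; trans = λ p q n → trans (p n) (q n) }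
                  ; ∙-cong = λ p q n → +-cong (p n) (q n) }
                ; assoc = λ f g h n → +-assoc _ _ _ }
              ; identity = (λ f n → +-identityˡ _) , (λ f n → +-identityʳ _) }
            ; inverse = (λ f n → -‿inverseˡ _) , (λ f n → -‿inverseʳ _)
            ; ⁻¹-cong = λ p n → -‿cong (p n) }
          ; comm = λ f g n → +-comm _ _ }
        ; *-cong = ⋆-cong
        ; *-assoc = ⋆-assoc
        ; *-identity = ⋆-identityˡ , (λ f n → trans (⋆-comm f 𝟙 n) (⋆-identityˡ f n))
        ; distrib = ⋆-distribˡ , ⋆-distribʳ }
      ; *-comm = ⋆-comm } }

-- Kreweras' recurrence

-- In the recurrence for A (suc x) n the parameter x grows only when n shrinks.
module _ {p} (P : ℕ → ℕ → Set p) (base : ∀ n → P 0 n)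
  (step : ∀ x n → (∀ k j → k ℕ.+ j ≡ n → P (x ℕ.+ k) j) → P (suc x) n) where

  private
    bounded : ∀ N x n → n ℕ.≤ N → P x n
    premise : ∀ N x n → n ℕ.≤ N → ∀ k j → k ℕ.+ j ≡ n → P (x ℕ.+ k) j

    bounded N zero    n n≤N = base n
    bounded N (suc x) n n≤N = step x n (premise N x n n≤N)

    premise N x n n≤N zero j ≡.refl = ≡.subst (λ y → P y j) (≡.sym (ℕP.+-identityʳ x)) (bounded N x n n≤N)
    premise (suc N) x n (s≤s n≤N) (suc k) j ≡.refl = bounded N (x ℕ.+ suc k) j (ℕP.≤-trans (ℕP.m≤n+m j k) n≤N)

  exchange-induction : ∀ x n → P x n
  exchange-induction x n = bounded n x n ℕP.≤-refl

module Kreweras {c ℓ} (R : CommutativeRing c ℓ) (q : CommutativeRing.Carrier R) where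
  open CommutativeRing R
  open Hurwitz R
  open import Relation.Binary.Reasoning.Setoid setoid
  open import Algebra.Properties.CommutativeSemigroup *-commutativeSemigroup
    using (x∙yz≈y∙xz) renaming (interchange to *-interchange)

  pow : ℕ → Carrier
  pow zero    = 1#
  pow (suc a) = q * pow a

  pow-+ : ∀ a b → pow (a ℕ.+ b) ≈ pow a * pow b
  pow-+ zero    b = sym (*-identityˡ _)
  pow-+ (suc a) b = trans (*-congˡ (pow-+ a b)) (sym (*-assoc _ _ _))

  -- The weight of k letters 1 at the head of a sorted word whose bounds are x + 1, x + 2, ...: q to
  -- the power x + (x + 1) + ... + (x + k - 1).
  run : ℕ → ℕ → Carrier
  run x zero    = 1#
  run x (suc k) = pow x * run (suc x) k

  run-snoc : ∀ x k → run x (suc k) ≈ run x k * pow (x ℕ.+ k)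
  run-snoc x zero    = trans (*-comm _ _) (*-congˡ (reflexive (≡.cong pow (≡.sym (ℕP.+-identityʳ x)))))
  run-snoc x (suc k) = begin
    pow x * run (suc x) (suc k)                ≈⟨ *-congˡ (run-snoc (suc x) k) ⟩
    pow x * (run (suc x) k * pow (suc x ℕ.+ k)) ≈⟨ *-assoc _ _ _ ⟨
    run x (suc k) * pow (suc x ℕ.+ k)           ≈⟨ *-congˡ (reflexive (≡.cong pow (≡.sym (ℕP.+-suc x k)))) ⟩
    run x (suc k) * pow (x ℕ.+ suc k)           ∎

  run-suc : ∀ x k → run (suc x) k ≈ pow k * run x k
  run-suc x zero    = sym (*-identityˡ _)
  run-suc x (suc k) = begin
    pow (suc x) * run (suc (suc x)) k       ≈⟨ *-congˡ (run-suc (suc x) k) ⟩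
    (q * pow x) * (pow k * run (suc x) k)   ≈⟨ *-interchange q (pow x) (pow k) _ ⟩
    pow (suc k) * run x (suc k)             ∎

  qnum : ℕ → Carrier
  qnum zero    = 0#
  qnum (suc a) = qnum a + pow a

  module Solution (A : ℕ → ℕ → Carrier)
    (A-zero-zero : A 0 0 ≈ 1#)
    (A-zero-suc : ∀ n → A 0 (suc n) ≈ 0#)
    (A-suc : ∀ x n → A (suc x) n ≈ Φ (λ k j → run x k * A (x ℕ.+ k) j) n)
    where

    Factors : ℕ → ℕ → Set ℓ
    Factors x n = A (suc x) n ≈ Φ (λ i l → pow i * A x i * A 1 l) n

    -- Kreweras' recurrence with [x + i] in place of [1 + i]. The general x is what makes the
    -- induction possible, because the recurrence for `A` passes to the bounds x + k.
    Differentiates : ℕ → ℕ → Set ℓ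
    Differentiates x n = A x (suc n) ≈ Φ (λ i l → qnum (x ℕ.+ i) * A x i * A 1 l) n

    private
      A-zero-⋆ : ∀ f n → Φ (λ i l → pow i * A 0 i * f l) n ≈ f n
      A-zero-⋆ f n = begin
        Φ (λ i l → pow i * A 0 i * f l) n ≈⟨ ⋆-cong unit (λ _ → refl) n ⟩
        (𝟙 ⋆ f) n                        ≈⟨ ⋆-identityˡ f n ⟩
        f n                              ∎
        where
        unit : (λ i → pow i * A 0 i) ≋ 𝟙
        unit zero    = trans (*-identityˡ _) A-zero-zero
        unit (suc i) = trans (*-congˡ (A-zero-suc i)) (zeroʳ _)

      -- By `run-suc` the factor `run (suc x) k` is q^k times `run x k`. With the q^i of the
      -- induction hypothesis this is q^m for m = k + i, so summing over k for fixed m restores the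
      -- recurrence for `A (suc x) m`.
      factors-step : ∀ x n → (∀ k j → k ℕ.+ j ≡ n → Factors (x ℕ.+ k) j) → Factors (suc x) n
      factors-step x n ih = begin
        A (suc (suc x)) n
          ≈⟨ A-suc (suc x) n ⟩
        Φ (λ k j → run (suc x) k * A (suc x ℕ.+ k) j) n
          ≈⟨ Φ-cong n (λ k j p → trans (*-cong (run-suc x k) (ih k j p)) (sym (Φ-*ˡ j _ _))) ⟩
        Φ (λ k j → Φ (λ i l → pow k * run x k * (pow i * A (x ℕ.+ k) i * A 1 l)) j) n
          ≈⟨ Φ-assoc n _ ⟨
        Φ (λ m l → Φ (λ k i → pow k * run x k * (pow i * A (x ℕ.+ k) i * A 1 l)) m) n
          ≈⟨ Φ-cong n (λ m l _ → trans (Φ-cong m λ k i p → regroup k i m l p)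
               (trans (Φ-*ʳ m _ _) (*-congʳ (trans (Φ-*ˡ m _ _) (*-congˡ (sym (A-suc x m))))))) ⟩
        Φ (λ m l → pow m * A (suc x) m * A 1 l) n ∎
        where
        regroup : ∀ k i m l → k ℕ.+ i ≡ m →
          pow k * run x k * (pow i * A (x ℕ.+ k) i * A 1 l) ≈ pow m * (run x k * A (x ℕ.+ k) i) * A 1 l
        regroup k i m l p = begin
          pow k * run x k * (pow i * A (x ℕ.+ k) i * A 1 l)   ≈⟨ *-assoc _ _ _ ⟨
          pow k * run x k * (pow i * A (x ℕ.+ k) i) * A 1 l   ≈⟨ *-congʳ (*-interchange _ _ _ _) ⟩
          pow k * pow i * (run x k * A (x ℕ.+ k) i) * A 1 l   ≈⟨ *-congʳ (*-congʳ (trans (sym (pow-+ k i)) (reflexive (≡.cong pow p)))) ⟩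
          pow m * (run x k * A (x ℕ.+ k) i) * A 1 l           ∎

    factors : ∀ x n → Factors x n
    factors = exchange-induction Factors (λ n → sym (A-zero-⋆ (A 1) n)) factors-step

    private
      -- Pascal's rule splits the derivative according to whether the extra letter is a 1. If it is,
      -- the bound rises and `factors` yields the coefficient q^(x+k+i); otherwise the hypothesis
      -- yields [x + k + i]. The two add up to [x + k + i + 1].
      differentiates-step : ∀ x n → (∀ k j → k ℕ.+ j ≡ n → Differentiates (x ℕ.+ k) j) → Differentiates (suc x) n
      differentiates-step x n ih = begin
        A (suc x) (suc n)
          ≈⟨ A-suc x (suc n) ⟩
        Φ (λ k j → run x (suc k) * A (x ℕ.+ suc k) j) n + Φ (λ k j → run x k * A (x ℕ.+ k) (suc j)) n
          ≈⟨ Φ-+ n _ _ ⟨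
        Φ (λ k j → run x (suc k) * A (x ℕ.+ suc k) j + run x k * A (x ℕ.+ k) (suc j)) n
          ≈⟨ Φ-cong n expand ⟩
        Φ (λ k j → Φ (λ i l → run x k * (qnum (suc x ℕ.+ (k ℕ.+ i)) * A (x ℕ.+ k) i * A 1 l)) j) n
          ≈⟨ Φ-assoc n _ ⟨
        Φ (λ m l → Φ (λ k i → run x k * (qnum (suc x ℕ.+ (k ℕ.+ i)) * A (x ℕ.+ k) i * A 1 l)) m) n
          ≈⟨ Φ-cong n (λ m l _ → trans (Φ-cong m λ k i p → regroup k i m l p)
               (trans (Φ-*ʳ m _ _) (*-congʳ (trans (Φ-*ˡ m _ _) (*-congˡ (sym (A-suc x m))))))) ⟩
        Φ (λ m l → qnum (suc x ℕ.+ m) * A (suc x) m * A 1 l) n ∎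
        where
        regroup : ∀ k i m l → k ℕ.+ i ≡ m →
          run x k * (qnum (suc x ℕ.+ (k ℕ.+ i)) * A (x ℕ.+ k) i * A 1 l)
            ≈ qnum (suc x ℕ.+ m) * (run x k * A (x ℕ.+ k) i) * A 1 l
        regroup k i m l ≡.refl = begin
          run x k * (qnum (suc x ℕ.+ m) * A (x ℕ.+ k) i * A 1 l) ≈⟨ *-assoc _ _ _ ⟨
          run x k * (qnum (suc x ℕ.+ m) * A (x ℕ.+ k) i) * A 1 l ≈⟨ *-congʳ (x∙yz≈y∙xz _ _ _) ⟩
          qnum (suc x ℕ.+ m) * (run x k * A (x ℕ.+ k) i) * A 1 l ∎
        expand : ∀ k j → k ℕ.+ j ≡ n →
          run x (suc k) * A (x ℕ.+ suc k) j + run x k * A (x ℕ.+ k) (suc j)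
            ≈ Φ (λ i l → run x k * (qnum (suc x ℕ.+ (k ℕ.+ i)) * A (x ℕ.+ k) i * A 1 l)) j
        expand k j p = begin
          run x (suc k) * A (x ℕ.+ suc k) j + run x k * A (x ℕ.+ k) (suc j)
            ≈⟨ +-cong (*-cong (run-snoc x k) (trans (reflexive (≡.cong (λ y → A y j) (ℕP.+-suc x k))) (factors (x ℕ.+ k) j)))
                      (*-congˡ (ih k j p)) ⟩
          run x k * pow (x ℕ.+ k) * Φ (λ i l → pow i * A (x ℕ.+ k) i * A 1 l) j
            + run x k * Φ (λ i l → qnum (x ℕ.+ k ℕ.+ i) * A (x ℕ.+ k) i * A 1 l) j
            ≈⟨ +-congʳ (trans (*-assoc _ _ _) (*-congˡ (sym (Φ-*ˡ j _ _)))) ⟩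
          run x k * Φ (λ i l → pow (x ℕ.+ k) * (pow i * A (x ℕ.+ k) i * A 1 l)) j
            + run x k * Φ (λ i l → qnum (x ℕ.+ k ℕ.+ i) * A (x ℕ.+ k) i * A 1 l) j
            ≈⟨ distribˡ _ _ _ ⟨
          run x k * (Φ (λ i l → pow (x ℕ.+ k) * (pow i * A (x ℕ.+ k) i * A 1 l)) j
            + Φ (λ i l → qnum (x ℕ.+ k ℕ.+ i) * A (x ℕ.+ k) i * A 1 l) j)
            ≈⟨ *-congˡ (Φ-+ j _ _) ⟨
          run x k * Φ (λ i l → pow (x ℕ.+ k) * (pow i * A (x ℕ.+ k) i * A 1 l)
                              + qnum (x ℕ.+ k ℕ.+ i) * A (x ℕ.+ k) i * A 1 l) j
            ≈⟨ *-congˡ (Φ-cong j λ i l _ → merge i l) ⟩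
          run x k * Φ (λ i l → qnum (suc x ℕ.+ (k ℕ.+ i)) * A (x ℕ.+ k) i * A 1 l) j
            ≈⟨ Φ-*ˡ j _ _ ⟨
          Φ (λ i l → run x k * (qnum (suc x ℕ.+ (k ℕ.+ i)) * A (x ℕ.+ k) i * A 1 l)) j ∎
          where
          merge : ∀ i l →
            pow (x ℕ.+ k) * (pow i * A (x ℕ.+ k) i * A 1 l) + qnum (x ℕ.+ k ℕ.+ i) * A (x ℕ.+ k) i * A 1 l
              ≈ qnum (suc x ℕ.+ (k ℕ.+ i)) * A (x ℕ.+ k) i * A 1 l
          merge i l = begin
            pow (x ℕ.+ k) * (pow i * A (x ℕ.+ k) i * A 1 l) + qnum (x ℕ.+ k ℕ.+ i) * A (x ℕ.+ k) i * A 1 l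
              ≈⟨ +-congʳ (trans (sym (*-assoc _ _ _)) (*-congʳ (trans (sym (*-assoc _ _ _)) (*-congʳ (sym (pow-+ (x ℕ.+ k) i)))))) ⟩
            pow (x ℕ.+ k ℕ.+ i) * A (x ℕ.+ k) i * A 1 l + qnum (x ℕ.+ k ℕ.+ i) * A (x ℕ.+ k) i * A 1 l
              ≈⟨ trans (*-congʳ (distribʳ _ _ _)) (distribʳ _ _ _) ⟨
            (pow (x ℕ.+ k ℕ.+ i) + qnum (x ℕ.+ k ℕ.+ i)) * A (x ℕ.+ k) i * A 1 l
              ≈⟨ *-congʳ (*-congʳ (+-comm _ _)) ⟩
            qnum (suc (x ℕ.+ k ℕ.+ i)) * A (x ℕ.+ k) i * A 1 l
              ≈⟨ *-congʳ (*-congʳ (reflexive (≡.cong (λ y → qnum (suc y)) (ℕP.+-assoc x k i)))) ⟩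
            qnum (suc x ℕ.+ (k ℕ.+ i)) * A (x ℕ.+ k) i * A 1 l ∎

    differentiates : ∀ x n → Differentiates x n
    differentiates = exchange-induction Differentiates base differentiates-step
      where
      base : ∀ n → Differentiates 0 n
      base n = begin
        A 0 (suc n)                            ≈⟨ A-zero-suc n ⟩
        0#                                     ≈⟨ Φ-0 n ⟨
        Φ (λ _ _ → 0#) n                       ≈⟨ Φ-cong n vanish ⟨
        Φ (λ i l → qnum i * A 0 i * A 1 l) n   ∎
        where
        vanish : ∀ i l → i ℕ.+ l ≡ n → qnum i * A 0 i * A 1 l ≈ 0#
        vanish zero    l _ = trans (*-congʳ (zeroˡ _)) (zeroˡ _)
        vanish (suc i) l _ = trans (*-congʳ (trans (*-congˡ (A-zero-suc i)) (zeroʳ _))) (zeroˡ _)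

    kreweras : ∀ n → A 1 (suc n) ≈ Φ (λ i l → qnum (suc i) * A 1 i * A 1 l) n
    kreweras = differentiates 1

-- Words and their area enumerators

Positive : List ℕ → Set
Positive = All (1 ℕ.≤_)

letters-positive : ∀ m → Positive (map suc (upTo m))
letters-positive m = AllP.map⁺ (All.universal (λ _ → s≤s z≤n) (upTo m))

candidates-spec : ∀ m n → All (λ p → length p ≡ n × Positive p) (candidates m n)
candidates-spec m zero    = (≡.refl , []) ∷ []
candidates-spec m (suc n) = AllP.concat⁺ (AllP.map⁺ (All.map
  (λ 1≤x → AllP.map⁺ (All.map (λ (len , pos) → ≡.cong suc len , 1≤x ∷ pos) (candidates-spec m n)))
  (letters-positive m)))

ones : List ℕ → ℕ
ones []              = 0
ones (suc zero ∷ p)  = suc (ones p)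
ones (_ ∷ p)         = ones p

strip : List ℕ → List ℕ
strip []                = []
strip (suc (suc y) ∷ p) = suc y ∷ strip p
strip (_ ∷ p)           = strip p

insert-one : ∀ {s} → Positive s → insert 1 s ≡ 1 ∷ s
insert-one []            = ≡.refl
insert-one (s≤s z≤n ∷ _) = ≡.refl

≤ᵇ-suc : ∀ x y → (suc x ≤ᵇ suc y) ≡ (x ≤ᵇ y)
≤ᵇ-suc zero    y = ≡.refl
≤ᵇ-suc (suc x) y = ≡.refl

insert-map-suc : ∀ x s → insert (suc x) (map suc s) ≡ map suc (insert x s)
insert-map-suc x []       = ≡.refl
insert-map-suc x (y ∷ ys) rewrite ≤ᵇ-suc x y with x ≤ᵇ y
... | true  = ≡.refl
... | false = ≡.cong (suc y ∷_) (insert-map-suc x ys)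

insert-replicate : ∀ x k s → insert (suc (suc x)) (replicate k 1 ++ s) ≡ replicate k 1 ++ insert (suc (suc x)) s
insert-replicate x zero    s = ≡.refl
insert-replicate x (suc k) s = ≡.cong (1 ∷_) (insert-replicate x k s)

sort-positive : ∀ {p} → Positive p → Positive (sort p)
sort-positive {p} pos = All-resp-↭ (↭-sym (sort-↭ p)) pos

-- Inserting a letter above 1 passes the whole block of ones, and beyond that block it commutes with
-- lowering all letters.
sort-split : ∀ {p} → Positive p → sort p ≡ replicate (ones p) 1 ++ map suc (sort (strip p))
sort-split [] = ≡.refl
sort-split {suc zero ∷ p} (_ ∷ pos) =
  ≡.trans (insert-one (sort-positive pos)) (≡.cong (1 ∷_) (sort-split pos))
sort-split {suc (suc y) ∷ p} (_ ∷ pos) = begin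
  insert (suc (suc y)) (sort p)
    ≡⟨ ≡.cong (insert (suc (suc y))) (sort-split pos) ⟩
  insert (suc (suc y)) (replicate (ones p) 1 ++ map suc (sort (strip p)))
    ≡⟨ insert-replicate y (ones p) _ ⟩
  replicate (ones p) 1 ++ insert (suc (suc y)) (map suc (sort (strip p)))
    ≡⟨ ≡.cong (replicate (ones p) 1 ++_) (insert-map-suc (suc y) (sort (strip p))) ⟩
  replicate (ones p) 1 ++ map suc (insert (suc y) (sort (strip p))) ∎
  where open ≡.≡-Reasoning

module WordSums {c ℓ} (R : CommutativeRing c ℓ) where
  open CommutativeRing R
  open Hurwitz R
  open import Relation.Binary.Reasoning.Setoid setoid

  sum : List Carrier → Carrier
  sum = foldr _+_ 0#

  module _ {a} {A : Set a} where
    sum-cong : ∀ {f g : A → Carrier} {xs} → All (λ x → f x ≈ g x) xs → sum (map f xs) ≈ sum (map g xs)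
    sum-cong []       = refl
    sum-cong (e ∷ es) = +-cong e (sum-cong es)

    sum-0 : ∀ (xs : List A) → sum (map (λ _ → 0#) xs) ≈ 0#
    sum-0 []       = refl
    sum-0 (x ∷ xs) = trans (+-identityˡ _) (sum-0 xs)

    sum-++ : ∀ (f : A → Carrier) xs ys → sum (map f (xs ++ ys)) ≈ sum (map f xs) + sum (map f ys)
    sum-++ f []       ys = sym (+-identityˡ _)
    sum-++ f (x ∷ xs) ys = trans (+-congˡ (sum-++ f xs ys)) (sym (+-assoc _ _ _))

    sum-map : ∀ {b} {B : Set b} (f : A → Carrier) (g : B → A) xs → sum (map f (map g xs)) ≡ sum (map (f ∘ g) xs)
    sum-map f g []       = ≡.refl
    sum-map f g (x ∷ xs) = ≡.cong (f (g x) +_) (sum-map f g xs)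

    sum-concatMap : ∀ {b} {B : Set b} (f : A → Carrier) (g : B → List A) xs →
      sum (map f (concatMap g xs)) ≈ sum (map (λ x → sum (map f (g x))) xs)
    sum-concatMap f g []       = refl
    sum-concatMap f g (x ∷ xs) = trans (sum-++ f (g x) _) (+-congˡ (sum-concatMap f g xs))

    sum-Φ : ∀ n (f : A → ℕ → ℕ → Carrier) xs →
      sum (map (λ x → Φ (f x) n) xs) ≈ Φ (λ k j → sum (map (λ x → f x k j) xs)) n
    sum-Φ n f []       = sym (Φ-0 n)
    sum-Φ n f (x ∷ xs) = trans (+-congˡ (sum-Φ n f xs)) (sym (Φ-+ n _ _))

  total : (List ℕ → Carrier) → ℕ → ℕ → Carrier
  total F m n = sum (map F (candidates m n))

  total-suc : ∀ F m n → total F m (suc n) ≈ sum (map (λ x → total (F ∘ (x ∷_)) m n) (map suc (upTo m)))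
  total-suc F m n = trans (sum-concatMap F _ (map suc (upTo m)))
    (sum-cong (All.universal (λ x → reflexive (sum-map F (x ∷_) (candidates m n))) (map suc (upTo m))))

  total-split : ∀ m n F (G : ℕ → List ℕ → Carrier) → (∀ {p} → Positive p → F p ≈ G (ones p) (strip p)) →
    total F (suc m) n ≈ Φ (λ k j → total (G k) m j) n
  total-split m zero    F G e = +-congʳ (e [])
  total-split m (suc n) F G e = begin
    total F (suc m) (suc n)
      ≈⟨ total-suc F (suc m) n ⟩
    total (F ∘ (1 ∷_)) (suc m) n + sum (map (λ x → total (F ∘ (x ∷_)) (suc m) n) (map suc (applyUpTo suc m)))
      ≈⟨ +-cong (total-split m n _ (G ∘ suc) (λ pos → e (s≤s z≤n ∷ pos))) others ⟩
    Φ (λ k j → total (G (suc k)) m j) n + Φ (λ k j → total (G k) m (suc j)) n ∎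
    where
    -- These are the letters 2, ..., m + 1: `upTo (suc m)` unfolds to `0 ∷ applyUpTo suc m`, and its
    -- head gave the letter 1.
    others : sum (map (λ x → total (F ∘ (x ∷_)) (suc m) n) (map suc (applyUpTo suc m)))
               ≈ Φ (λ k j → total (G k) m (suc j)) n
    others = begin
      sum (map (λ x → total (F ∘ (x ∷_)) (suc m) n) (map suc (applyUpTo suc m)))
        ≡⟨ ≡.cong (λ xs → sum (map (λ x → total (F ∘ (x ∷_)) (suc m) n) (map suc xs))) (map-applyUpTo id suc m) ⟨
      sum (map (λ x → total (F ∘ (x ∷_)) (suc m) n) (map suc (map suc (upTo m))))
        ≡⟨ ≡.trans (sum-map _ suc (map suc (upTo m))) (sum-map _ suc (upTo m)) ⟩
      sum (map (λ y → total (F ∘ (suc (suc y) ∷_)) (suc m) n) (upTo m))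
        ≈⟨ sum-cong (All.universal (λ y → total-split m n _ (λ k p → G k (suc y ∷ p))
                                             (λ pos → e (s≤s z≤n ∷ pos))) (upTo m)) ⟩
      sum (map (λ y → Φ (λ k j → total (G k ∘ (suc y ∷_)) m j) n) (upTo m))
        ≈⟨ sum-Φ n _ (upTo m) ⟩
      Φ (λ k j → sum (map (λ y → total (G k ∘ (suc y ∷_)) m j) (upTo m))) n
        ≈⟨ Φ-cong n (λ k j _ → trans (total-suc (G k) m j) (reflexive (sum-map _ suc (upTo m)))) ⟨
      Φ (λ k j → total (G k) m (suc j)) n ∎

module AreaEnumerator {c ℓ} (R : CommutativeRing c ℓ) (q : CommutativeRing.Carrier R) where
  open CommutativeRing R
  open Hurwitz R
  open Kreweras R q
  open WordSums R
  open import Relation.Binary.Reasoning.Setoid setoid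

  -- For a sorted list s, q raised to the area of s if s is dominated by i, i+1, …, and 0 otherwise.
  weight : ℕ → List ℕ → Carrier
  weight i []       = 1#
  weight i (y ∷ ys) = if y ≤ᵇ i then pow (i ∸ y) * weight (suc i) ys else 0#

  weight-map-suc : ∀ i s → weight (suc i) (map suc s) ≡ weight i s
  weight-map-suc i []       = ≡.refl
  weight-map-suc i (y ∷ ys) rewrite ≤ᵇ-suc y i | weight-map-suc (suc i) ys = ≡.refl

  weight-ones : ∀ x k s → weight (suc x) (replicate k 1 ++ map suc s) ≈ run x k * weight (x ℕ.+ k) s
  weight-ones x zero    s = begin
    weight (suc x) (map suc s) ≡⟨ weight-map-suc x s ⟩
    weight x s                 ≡⟨ ≡.cong (λ y → weight y s) (ℕP.+-identityʳ x) ⟨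
    weight (x ℕ.+ 0) s         ≈⟨ *-identityˡ _ ⟨
    1# * weight (x ℕ.+ 0) s    ∎
  weight-ones x (suc k) s = begin
    pow x * weight (suc (suc x)) (replicate k 1 ++ map suc s) ≈⟨ *-congˡ (weight-ones (suc x) k s) ⟩
    pow x * (run (suc x) k * weight (suc x ℕ.+ k) s)         ≈⟨ *-assoc _ _ _ ⟨
    run x (suc k) * weight (suc x ℕ.+ k) s
      ≡⟨ ≡.cong (λ y → run x (suc k) * weight y s) (≡.sym (ℕP.+-suc x k)) ⟩
    run x (suc k) * weight (x ℕ.+ suc k) s                   ∎

  weight-zero-insert : ∀ y {s} → Positive s → weight 0 (insert (suc y) s) ≡ 0#
  weight-zero-insert y []                        = ≡.refl
  weight-zero-insert y {suc z ∷ zs} (s≤s z≤n ∷ _) with suc y ≤ᵇ suc z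
  ... | true  = ≡.refl
  ... | false = ≡.refl

  enum : ℕ → ℕ → ℕ → Carrier
  enum m x n = total (weight x ∘ sort) m n

  enum-zero-zero : ∀ m → enum m 0 0 ≈ 1#
  enum-zero-zero m = +-identityʳ 1#

  enum-zero-suc : ∀ m n → enum m 0 (suc n) ≈ 0#
  enum-zero-suc m n = trans
    (sum-cong {g = λ _ → 0#} (All.map (λ { (len , s≤s z≤n ∷ pos) → reflexive (weight-zero-insert _ (sort-positive pos)) })
      (candidates-spec m (suc n))))
    (sum-0 (candidates m (suc n)))

  enum-suc : ∀ m x n → enum (suc m) (suc x) n ≈ Φ (λ k j → run x k * enum m (x ℕ.+ k) j) n
  enum-suc m x n = trans
    (total-split m n (weight (suc x) ∘ sort) (λ k p → run x k * weight (x ℕ.+ k) (sort p))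
      (λ {p} pos → trans (reflexive (≡.cong (weight (suc x)) (sort-split pos))) (weight-ones x (ones p) _)))
    (Φ-cong n λ k j _ → sum-*ˡ (run x k) _ (candidates m j))
    where
    sum-*ˡ : ∀ a (f : List ℕ → Carrier) xs → sum (map (λ p → a * f p) xs) ≈ a * sum (map f xs)
    sum-*ˡ a f []       = sym (zeroʳ a)
    sum-*ˡ a f (x ∷ xs) = trans (+-congˡ (sum-*ˡ a f xs)) (sym (distribˡ a _ _))

  -- Letters above x + n - 1 cannot occur, so this alphabet is large enough.
  A : ℕ → ℕ → Carrier
  A x n = enum (x ℕ.+ n ∸ 1) x n

  A-suc : ∀ x n → A (suc x) n ≈ Φ (λ k j → run x k * A (x ℕ.+ k) j) n
  -- Here the alphabet is empty and has no letter 1 to split off, so `enum-suc` does not apply; only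
  -- the empty word contributes.
  A-suc zero    zero    = sym (*-identityˡ _)
  A-suc zero    (suc n) = trans (enum-suc n 0 (suc n)) (Φ-cong (suc n) λ k j p →
    *-congˡ {x = run 0 k} (reflexive (≡.cong (λ y → enum (y ∸ 1) k j) (≡.sym p))))
  A-suc (suc x) n       = trans (enum-suc (x ℕ.+ n) (suc x) n) (Φ-cong n λ k j p →
    *-congˡ {x = run (suc x) k} (reflexive (≡.cong (λ y → enum y (suc x ℕ.+ k) j) (≡.trans (≡.cong (x ℕ.+_) (≡.sym p)) (≡.sym (ℕP.+-assoc x k j))))))

  open Solution A (enum-zero-zero 0) (λ n → enum-zero-suc n n) A-suc public
open import Data.Integer as ℤ using (+_; -[1+_])
import Data.Integer.Properties as ℤP
import Data.Nat.Coprimality as Coprimality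
open import Data.Rational as ℚ using (ℚ; mkℚ; 0ℚ; 1ℚ; _/_; _+_; _-_; _*_; -_; _≤_)
import Data.Rational.Properties as ℚP
import Data.Rational.Solver
import Data.Rational.Unnormalised as ℚᵘ
import Data.Rational.Unnormalised.Properties as ℚᵘP
open import Relation.Binary.PropositionalEquality using (refl; sym; trans; cong; cong₂; subst; subst₂)

open Data.Rational.Solver.+-*-Solver using (solve; con; _:+_; _:*_; _:-_; :-_; _:=_)

-- Factorial moments

/1-mkℚ : ∀ i → i / 1 ≡ mkℚ i 0 (Coprimality.sym (Coprimality.1-coprimeTo ℤ.∣ i ∣))
/1-mkℚ i = ℚP.↥p/↧p≡p (mkℚ i 0 (Coprimality.sym (Coprimality.1-coprimeTo ℤ.∣ i ∣)))

/1-+ : ∀ i j → (i ℤ.+ j) / 1 ≡ i / 1 + j / 1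
/1-+ i j rewrite /1-mkℚ i | /1-mkℚ j =
  cong (_/ 1) (sym (cong₂ ℤ._+_ (ℤP.*-identityʳ i) (ℤP.*-identityʳ j)))

/1-* : ∀ i j → (i ℤ.* j) / 1 ≡ (i / 1) * (j / 1)
/1-* i j rewrite /1-mkℚ i | /1-mkℚ j = refl

-- Opaque, because unfolding the normalisation in _/_ makes conversion checking explode.
opaque
  ι : ℕ → ℚ
  ι n = + n / 1

  ι-/1 : ∀ n → ι n ≡ + n / 1
  ι-/1 n = refl

  ι-+ : ∀ m n → ι (m ℕ.+ n) ≡ ι m + ι n
  ι-+ m n = /1-+ (+ m) (+ n)

  ι-* : ∀ m n → ι (m ℕ.* n) ≡ ι m * ι n
  ι-* m n = trans (cong (_/ 1) (ℤP.pos-* m n)) (/1-* (+ m) (+ n))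

  ι-zero : ι 0 ≡ 0ℚ
  ι-zero = refl

  ι-suc : ∀ n → ι (suc n) ≡ 1ℚ + ι n
  ι-suc = ι-+ 1

module QS = Hurwitz ℚP.+-*-commutativeRing

-- Powers of q = 1 + ε are expanded as Hurwitz series in ε, so the j-th
-- coefficient of q ^ a is the j-th falling factorial of a.
1+ε : QS.Series
1+ε 0             = 1ℚ
1+ε 1             = 1ℚ
1+ε (suc (suc _)) = 0ℚ

module EQ = Hurwitz QS.hurwitzRing
module AE = AreaEnumerator QS.hurwitzRing 1+ε
module KR = Kreweras QS.hurwitzRing 1+ε

Φ-coefficient : ∀ f n j → EQ.Φ f n j ≡ QS.Φ (λ k l → f k l j) n
Φ-coefficient f zero    j = refl
Φ-coefficient f (suc n) j = cong₂ _+_ (Φ-coefficient _ n j) (Φ-coefficient _ n j)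

-- In a Hurwitz series, multiplication by ε puts j times the preceding coefficient at place j. Hence
-- multiplying by 1 + ε is the recurrence that takes the falling factorials of x to those of 1 + x.
mul₁ : ∀ f → (1+ε QS.⋆ f) 1 ≡ f 0 + f 1
mul₁ f = solve 2 (λ a b → con 1ℚ :* a :+ con 1ℚ :* b := a :+ b) refl (f 0) (f 1)

mul₂ : ∀ f → (1+ε QS.⋆ f) 2 ≡ + 2 / 1 * f 1 + f 2
mul₂ f = solve 3 (λ a b c → con 0ℚ :* a :+ con 1ℚ :* b :+ (con 1ℚ :* b :+ con 1ℚ :* c)
  := con (+ 2 / 1) :* b :+ c) refl (f 0) (f 1) (f 2)

mul₃ : ∀ f → (1+ε QS.⋆ f) 3 ≡ + 3 / 1 * f 2 + f 3
mul₃ f = solve 4 (λ a b c d →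
  (con 0ℚ :* a :+ con 0ℚ :* b :+ (con 0ℚ :* b :+ con 1ℚ :* c))
    :+ (con 0ℚ :* b :+ con 1ℚ :* c :+ (con 1ℚ :* c :+ con 1ℚ :* d))
  := con (+ 3 / 1) :* c :+ d) refl (f 0) (f 1) (f 2) (f 3)

pow-0 : ∀ a → KR.pow a 0 ≡ falling (ι a) 0
pow-0 zero    = refl
pow-0 (suc a) = trans (ℚP.*-identityˡ _) (pow-0 a)

falling-suc-1 : ∀ x → falling x 0 + falling x 1 ≡ falling (1ℚ + x) 1
falling-suc-1 = solve 1 (λ x → con 1ℚ :+ con 1ℚ :* (x :- con 0ℚ)
  := con 1ℚ :* (con 1ℚ :+ x :- con 0ℚ)) refl

pow-1 : ∀ a → KR.pow a 1 ≡ falling (ι a) 1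
pow-1 zero    = cong (λ x → falling x 1) (sym ι-zero)
pow-1 (suc a) = begin
  KR.pow (suc a) 1                       ≡⟨ mul₁ (KR.pow a) ⟩
  KR.pow a 0 + KR.pow a 1      ≡⟨ cong₂ _+_ (pow-0 a) (pow-1 a) ⟩
  falling (ι a) 0 + falling (ι a) 1 ≡⟨ falling-suc-1 (ι a) ⟩
  falling (1ℚ + ι a) 1                   ≡⟨ cong (λ x → falling x 1) (ι-suc a) ⟨
  falling (ι (suc a)) 1                  ∎
  where open ≡.≡-Reasoning

falling-suc-2 : ∀ x → + 2 / 1 * falling x 1 + falling x 2 ≡ falling (1ℚ + x) 2
falling-suc-2 = solve 1 (λ x → con (+ 2 / 1) :* (con 1ℚ :* (x :- con 0ℚ)) :+ con 1ℚ :* (x :- con 0ℚ) :* (x :- con 1ℚ)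
  := con 1ℚ :* (con 1ℚ :+ x :- con 0ℚ) :* (con 1ℚ :+ x :- con 1ℚ)) refl

pow-2 : ∀ a → KR.pow a 2 ≡ falling (ι a) 2
pow-2 zero    = cong (λ x → falling x 2) (sym ι-zero)
pow-2 (suc a) = begin
  KR.pow (suc a) 2                       ≡⟨ mul₂ (KR.pow a) ⟩
  + 2 / 1 * KR.pow a 1 + KR.pow a 2      ≡⟨ cong₂ (λ x y → + 2 / 1 * x + y) (pow-1 a) (pow-2 a) ⟩
  + 2 / 1 * falling (ι a) 1 + falling (ι a) 2 ≡⟨ falling-suc-2 (ι a) ⟩
  falling (1ℚ + ι a) 2                   ≡⟨ cong (λ x → falling x 2) (ι-suc a) ⟨
  falling (ι (suc a)) 2                  ∎
  where open ≡.≡-Reasoning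

falling-suc-3 : ∀ x → + 3 / 1 * falling x 2 + falling x 3 ≡ falling (1ℚ + x) 3
falling-suc-3 = solve 1 (λ x → con (+ 3 / 1) :* (con 1ℚ :* (x :- con 0ℚ) :* (x :- con 1ℚ)) :+ con 1ℚ :* (x :- con 0ℚ) :* (x :- con 1ℚ) :* (x :- con (+ 2 / 1))
  := con 1ℚ :* (con 1ℚ :+ x :- con 0ℚ) :* (con 1ℚ :+ x :- con 1ℚ) :* (con 1ℚ :+ x :- con (+ 2 / 1))) refl

pow-3 : ∀ a → KR.pow a 3 ≡ falling (ι a) 3
pow-3 zero    = cong (λ x → falling x 3) (sym ι-zero)
pow-3 (suc a) = begin
  KR.pow (suc a) 3                       ≡⟨ mul₃ (KR.pow a) ⟩
  + 3 / 1 * KR.pow a 2 + KR.pow a 3      ≡⟨ cong₂ (λ x y → + 3 / 1 * x + y) (pow-2 a) (pow-3 a) ⟩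
  + 3 / 1 * falling (ι a) 2 + falling (ι a) 3 ≡⟨ falling-suc-3 (ι a) ⟩
  falling (1ℚ + ι a) 3                   ≡⟨ cong (λ x → falling x 3) (ι-suc a) ⟨
  falling (ι (suc a)) 3                  ∎
  where open ≡.≡-Reasoning

-- The falling factorial of x of order b + 1, divided by b + 1: the sum of the falling factorials of
-- order b of 0, ..., x - 1. The recursive form lets x be replaced later by the operator θ, one
-- factor at a time.
qnum-poly : ℕ → ℚ → ℚ
qnum-poly zero    x = x
qnum-poly (suc b) x = ((+ suc b) / suc (suc b)) * ((x - ((+ suc b) / 1)) * qnum-poly b x)

qnum-poly-suc-0 : ∀ x → qnum-poly 0 x + falling x 0 ≡ qnum-poly 0 (1ℚ + x)
qnum-poly-suc-0 = solve 1 (λ x → x :+ con 1ℚ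
  := (con 1ℚ :+ x)) refl

qnum-0 : ∀ a → KR.qnum a 0 ≡ qnum-poly 0 (ι a)
qnum-0 zero    = cong (qnum-poly 0) (sym ι-zero)
qnum-0 (suc a) = begin
  KR.qnum a 0 + KR.pow a 0                ≡⟨ cong₂ _+_ (qnum-0 a) (pow-0 a) ⟩
  qnum-poly 0 (ι a) + falling (ι a) 0     ≡⟨ qnum-poly-suc-0 (ι a) ⟩
  qnum-poly 0 (1ℚ + ι a)                  ≡⟨ cong (qnum-poly 0) (ι-suc a) ⟨
  qnum-poly 0 (ι (suc a))                 ∎
  where open ≡.≡-Reasoning

qnum-poly-suc-1 : ∀ x → qnum-poly 1 x + falling x 1 ≡ qnum-poly 1 (1ℚ + x)
qnum-poly-suc-1 = solve 1 (λ x → con (+ 1 / 2) :* ((x :- con (+ 1 / 1)) :* x) :+ con 1ℚ :* (x :- con 0ℚ)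
  := con (+ 1 / 2) :* (((con 1ℚ :+ x) :- con (+ 1 / 1)) :* (con 1ℚ :+ x))) refl

qnum-1 : ∀ a → KR.qnum a 1 ≡ qnum-poly 1 (ι a)
qnum-1 zero    = cong (qnum-poly 1) (sym ι-zero)
qnum-1 (suc a) = begin
  KR.qnum a 1 + KR.pow a 1                ≡⟨ cong₂ _+_ (qnum-1 a) (pow-1 a) ⟩
  qnum-poly 1 (ι a) + falling (ι a) 1     ≡⟨ qnum-poly-suc-1 (ι a) ⟩
  qnum-poly 1 (1ℚ + ι a)                  ≡⟨ cong (qnum-poly 1) (ι-suc a) ⟨
  qnum-poly 1 (ι (suc a))                 ∎
  where open ≡.≡-Reasoning

qnum-poly-suc-2 : ∀ x → qnum-poly 2 x + falling x 2 ≡ qnum-poly 2 (1ℚ + x)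
qnum-poly-suc-2 = solve 1 (λ x → con (+ 2 / 3) :* ((x :- con (+ 2 / 1)) :* (con (+ 1 / 2) :* ((x :- con (+ 1 / 1)) :* x))) :+ con 1ℚ :* (x :- con 0ℚ) :* (x :- con 1ℚ)
  := con (+ 2 / 3) :* (((con 1ℚ :+ x) :- con (+ 2 / 1)) :* (con (+ 1 / 2) :* (((con 1ℚ :+ x) :- con (+ 1 / 1)) :* (con 1ℚ :+ x))))) refl

qnum-2 : ∀ a → KR.qnum a 2 ≡ qnum-poly 2 (ι a)
qnum-2 zero    = cong (qnum-poly 2) (sym ι-zero)
qnum-2 (suc a) = begin
  KR.qnum a 2 + KR.pow a 2                ≡⟨ cong₂ _+_ (qnum-2 a) (pow-2 a) ⟩
  qnum-poly 2 (ι a) + falling (ι a) 2     ≡⟨ qnum-poly-suc-2 (ι a) ⟩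
  qnum-poly 2 (1ℚ + ι a)                  ≡⟨ cong (qnum-poly 2) (ι-suc a) ⟨
  qnum-poly 2 (ι (suc a))                 ∎
  where open ≡.≡-Reasoning

qnum-poly-suc-3 : ∀ x → qnum-poly 3 x + falling x 3 ≡ qnum-poly 3 (1ℚ + x)
qnum-poly-suc-3 = solve 1 (λ x → con (+ 3 / 4) :* ((x :- con (+ 3 / 1)) :* (con (+ 2 / 3) :* ((x :- con (+ 2 / 1)) :* (con (+ 1 / 2) :* ((x :- con (+ 1 / 1)) :* x))))) :+ con 1ℚ :* (x :- con 0ℚ) :* (x :- con 1ℚ) :* (x :- con (+ 2 / 1))
  := con (+ 3 / 4) :* (((con 1ℚ :+ x) :- con (+ 3 / 1)) :* (con (+ 2 / 3) :* (((con 1ℚ :+ x) :- con (+ 2 / 1)) :* (con (+ 1 / 2) :* (((con 1ℚ :+ x) :- con (+ 1 / 1)) :* (con 1ℚ :+ x))))))) refl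

qnum-3 : ∀ a → KR.qnum a 3 ≡ qnum-poly 3 (ι a)
qnum-3 zero    = cong (qnum-poly 3) (sym ι-zero)
qnum-3 (suc a) = begin
  KR.qnum a 3 + KR.pow a 3                ≡⟨ cong₂ _+_ (qnum-3 a) (pow-3 a) ⟩
  qnum-poly 3 (ι a) + falling (ι a) 3     ≡⟨ qnum-poly-suc-3 (ι a) ⟩
  qnum-poly 3 (1ℚ + ι a)                  ≡⟨ cong (qnum-poly 3) (ι-suc a) ⟨
  qnum-poly 3 (ι (suc a))                 ∎
  where open ≡.≡-Reasoning

-- P j n is the sum of the j-th falling factorials of the area over the parking functions of length n.
P : ℕ → QS.Series
P j n = AE.A 1 n j

L : ℕ → QS.Series → QS.Series
L b f i = qnum-poly b (ι (suc i)) * f i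

scale : ℚ → QS.Series → QS.Series
scale a f n = a * f n

-- The ε-coefficients of the right-hand side of Kreweras' recurrence, split into the part linear in
-- the unknown series and the rest.
open QS using (Series; _⊕_; _⋆_; _≋_; D; ⊖_; C; 𝟘; 𝟙; Φ; Φ-cong; Φ-+; Φ-*ˡ; ⋆-cong; ⋆-comm; C-⋆; D-⋆; ⋆-identityˡ; ⋆-distribˡ; ⋆-distribʳ)

rhs₀ : QS.Series → QS.Series
rhs₀ f₀ = L 0 f₀ ⋆ f₀

linear : QS.Series → QS.Series → QS.Series
linear f₀ f = L 0 f ⋆ f₀ ⊕ L 0 f₀ ⋆ f

source₁ : QS.Series → QS.Series
source₁ f₀ = L 1 f₀ ⋆ f₀

source₂ : QS.Series → QS.Series → QS.Series
source₂ f₀ f₁ = L 2 f₀ ⋆ f₀ ⊕ scale (+ 2 / 1) (L 1 f₁ ⋆ f₀ ⊕ L 1 f₀ ⋆ f₁ ⊕ L 0 f₁ ⋆ f₁)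

source₃ : QS.Series → QS.Series → QS.Series → QS.Series
source₃ f₀ f₁ f₂ = L 3 f₀ ⋆ f₀
  ⊕ scale (+ 3 / 1) (L 2 f₁ ⋆ f₀ ⊕ L 2 f₀ ⋆ f₁ ⊕ L 1 f₂ ⋆ f₀ ⊕ L 1 f₀ ⋆ f₂ ⊕ L 0 f₂ ⋆ f₁ ⊕ L 0 f₁ ⋆ f₂)
  ⊕ scale (+ 6 / 1) (L 1 f₁ ⋆ f₁)

leibniz₂ : ∀ f g → (f ⋆ g) 2 ≡ f 2 * g 0 + (+ 2 / 1 * (f 1 * g 1) + f 0 * g 2)
leibniz₂ f g = solve 6 (λ a b c x y z →
    c :* x :+ b :* y :+ (b :* y :+ a :* z) := c :* x :+ (con (+ 2 / 1) :* (b :* y) :+ a :* z))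
  refl (f 0) (f 1) (f 2) (g 0) (g 1) (g 2)

leibniz₃ : ∀ f g → (f ⋆ g) 3 ≡ f 3 * g 0 + (+ 3 / 1 * (f 2 * g 1) + (+ 3 / 1 * (f 1 * g 2) + f 0 * g 3))
leibniz₃ f g = solve 8 (λ a b c d x y z w →
    d :* x :+ c :* y :+ (c :* y :+ b :* z) :+ (c :* y :+ b :* z :+ (b :* z :+ a :* w))
    := d :* x :+ (con (+ 3 / 1) :* (c :* y) :+ (con (+ 3 / 1) :* (b :* z) :+ a :* w)))
  refl (f 0) (f 1) (f 2) (f 3) (g 0) (g 1) (g 2) (g 3)

-- Here and for the higher orders, the last two summands contain the top coefficient of `g` or `h`
-- and become `linear`; all the others involve lower moments only and become the source.
leibniz-triple₁ : ∀ f g h → ((f ⋆ g) ⋆ h) 1 ≡ f 1 * g 0 * h 0 + (f 0 * g 1 * h 0 + f 0 * g 0 * h 1)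
leibniz-triple₁ f g h = solve 6 (λ f0 f1 g0 g1 h0 h1 →
    ((f1 :* g0 :+ f0 :* g1) :* h0 :+ (f0 :* g0) :* h1)
    := f1 :* g0 :* h0 :+ (f0 :* g1 :* h0 :+ f0 :* g0 :* h1))
  refl (f 0) (f 1) (g 0) (g 1) (h 0) (h 1)

leibniz-triple₂ : ∀ f g h → ((f ⋆ g) ⋆ h) 2 ≡ (f 2 * g 0 * h 0 + + 2 / 1 * ((f 1 * g 1 * h 0 + (f 1 * g 0 * h 1 + f 0 * g 1 * h 1)))) + (f 0 * g 2 * h 0 + f 0 * g 0 * h 2)
leibniz-triple₂ f g h = trans (leibniz₂ (f ⋆ g) h) (trans (cong (λ x → x * h 0 + (+ 2 / 1 * ((f ⋆ g) 1 * h 1) + (f ⋆ g) 0 * h 2)) (leibniz₂ f g)) (solve 9 (λ f0 f1 f2 g0 g1 g2 h0 h1 h2 →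
    ((f2 :* g0 :+ (con (+ 2 / 1) :* (f1 :* g1) :+ f0 :* g2)) :* h0 :+ (con (+ 2 / 1) :* ((f1 :* g0 :+ f0 :* g1) :* h1) :+ (f0 :* g0) :* h2))
    := (f2 :* g0 :* h0 :+ con (+ 2 / 1) :* ((f1 :* g1 :* h0 :+ (f1 :* g0 :* h1 :+ f0 :* g1 :* h1)))) :+ (f0 :* g2 :* h0 :+ f0 :* g0 :* h2))
  refl (f 0) (f 1) (f 2) (g 0) (g 1) (g 2) (h 0) (h 1) (h 2)))

leibniz-triple₃ : ∀ f g h → ((f ⋆ g) ⋆ h) 3 ≡ (f 3 * g 0 * h 0 + (+ 3 / 1 * ((f 2 * g 1 * h 0 + (f 2 * g 0 * h 1 + (f 1 * g 2 * h 0 + (f 1 * g 0 * h 2 + (f 0 * g 2 * h 1 + f 0 * g 1 * h 2)))))) + + 6 / 1 * (f 1 * g 1 * h 1))) + (f 0 * g 3 * h 0 + f 0 * g 0 * h 3)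
leibniz-triple₃ f g h = trans (leibniz₃ (f ⋆ g) h) (trans (cong₂ (λ x y → x * h 0 + (+ 3 / 1 * (y * h 1) + (+ 3 / 1 * ((f ⋆ g) 1 * h 2) + (f ⋆ g) 0 * h 3))) (leibniz₃ f g) (leibniz₂ f g)) (solve 12 (λ f0 f1 f2 f3 g0 g1 g2 g3 h0 h1 h2 h3 →
    ((f3 :* g0 :+ (con (+ 3 / 1) :* (f2 :* g1) :+ (con (+ 3 / 1) :* (f1 :* g2) :+ f0 :* g3))) :* h0 :+ (con (+ 3 / 1) :* ((f2 :* g0 :+ (con (+ 2 / 1) :* (f1 :* g1) :+ f0 :* g2)) :* h1) :+ (con (+ 3 / 1) :* ((f1 :* g0 :+ f0 :* g1) :* h2) :+ (f0 :* g0) :* h3)))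
    := (f3 :* g0 :* h0 :+ (con (+ 3 / 1) :* ((f2 :* g1 :* h0 :+ (f2 :* g0 :* h1 :+ (f1 :* g2 :* h0 :+ (f1 :* g0 :* h2 :+ (f0 :* g2 :* h1 :+ f0 :* g1 :* h2)))))) :+ con (+ 6 / 1) :* (f1 :* g1 :* h1))) :+ (f0 :* g3 :* h0 :+ f0 :* g0 :* h3))
  refl (f 0) (f 1) (f 2) (f 3) (g 0) (g 1) (g 2) (g 3) (h 0) (h 1) (h 2) (h 3)))

private
  kreweras-coefficient : ∀ j n → P j (suc n) ≡ QS.Φ (λ i l → ((KR.qnum (suc i) ⋆ AE.A 1 i) ⋆ AE.A 1 l) j) n
  kreweras-coefficient j n = trans (AE.kreweras n j) (Φ-coefficient _ n j)

  record _⟿_ (f : ℕ → ℕ → ℚ) (s : QS.Series) : Set where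
    constructor expansion
    field at : ∀ n → Φ f n ≡ s n
  open _⟿_

  infixr 5 _Φ+_
  _Φ+_ : ∀ {f g s t} → f ⟿ s → g ⟿ t → (λ k j → f k j + g k j) ⟿ (s ⊕ t)
  (expansion p Φ+ expansion q) .at n = trans (Φ-+ n _ _) (cong₂ _+_ (p n) (q n))

  infixr 6 _Φ*_
  _Φ*_ : ∀ {f s} (x : ℚ) → f ⟿ s → (λ k j → x * f k j) ⟿ scale x s
  (x Φ* expansion p) .at n = trans (Φ-*ˡ n x _) (cong (x *_) (p n))

  monomial : ∀ {b} c a → (∀ i → KR.qnum i b ≡ qnum-poly b (ι i)) →
    (λ i l → KR.qnum (suc i) b * P c i * P a l) ⟿ (L b (P c) ⋆ P a)
  monomial c a e .at n = Φ-cong n λ i l _ → cong (λ x → x * P c i * P a l) (e (suc i))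

P₀-equation : D (P 0) ≋ rhs₀ (P 0)
P₀-equation n = trans (kreweras-coefficient 0 n) (monomial 0 0 qnum-0 .at n)

P₁-equation : D (P 1) ≋ source₁ (P 0) ⊕ linear (P 0) (P 1)
P₁-equation n = trans (kreweras-coefficient 1 n) (trans
  (Φ-cong n λ i l _ → leibniz-triple₁ (KR.qnum (suc i)) (AE.A 1 i) (AE.A 1 l))
  ((monomial 0 0 qnum-1 Φ+ (monomial 1 0 qnum-0 Φ+ monomial 0 1 qnum-0)) .at n))

P₂-equation : D (P 2) ≋ source₂ (P 0) (P 1) ⊕ linear (P 0) (P 2)
P₂-equation n = trans (kreweras-coefficient 2 n) (trans
  (Φ-cong n λ i l _ → leibniz-triple₂ (KR.qnum (suc i)) (AE.A 1 i) (AE.A 1 l))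
  (((monomial 0 0 qnum-2 Φ+ (+ 2 / 1) Φ* (monomial 1 0 qnum-1 Φ+ (monomial 0 1 qnum-1 Φ+ monomial 1 1 qnum-0))) Φ+ (monomial 2 0 qnum-0 Φ+ monomial 0 2 qnum-0)) .at n))

P₃-equation : D (P 3) ≋ source₃ (P 0) (P 1) (P 2) ⊕ linear (P 0) (P 3)
P₃-equation n = trans (kreweras-coefficient 3 n) (trans
  (Φ-cong n λ i l _ → leibniz-triple₃ (KR.qnum (suc i)) (AE.A 1 i) (AE.A 1 l))
  (((monomial 0 0 qnum-3 Φ+ ((+ 3 / 1) Φ* (monomial 1 0 qnum-2 Φ+ (monomial 0 1 qnum-2 Φ+ (monomial 2 0 qnum-1 Φ+ (monomial 0 2 qnum-1 Φ+ (monomial 2 1 qnum-0 Φ+ monomial 1 2 qnum-0))))) Φ+ (+ 6 / 1) Φ* monomial 1 1 qnum-1)) Φ+ (monomial 3 0 qnum-0 Φ+ monomial 0 3 qnum-0)) .at n))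

module HR = CommutativeRing QS.hurwitzRing
import Relation.Binary.Reasoning.Setoid HR.setoid as ≋-Reasoning

-- The tree function

C-homomorphism : CommutativeRing.rawRing ℚP.+-*-commutativeRing ACR.-Raw-AlmostCommutative⟶ ACR.fromCommutativeRing QS.hurwitzRing
C-homomorphism = record
  { ⟦_⟧    = C
  ; +-homo = λ { a b zero → refl ; a b (suc n) → refl }
  ; *-homo = λ { a b n → sym (trans (C-⋆ a (C b) n) (constant a b n)) }
  ; -‿homo = λ { a zero → refl ; a (suc n) → refl }
  ; 0-homo = C-0
  ; 1-homo = HR.refl {C 1ℚ}
  }
  where
  C-0 : C 0ℚ ≋ 𝟘
  C-0 zero    = refl
  C-0 (suc n) = refl
  constant : ∀ a b n → a * C b n ≡ C (a * b) n
  constant a b zero    = refl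
  constant a b (suc n) = ℚP.*-zeroʳ a

module S = Algebra.Solver.Ring
  (CommutativeRing.rawRing ℚP.+-*-commutativeRing) (ACR.fromCommutativeRing QS.hurwitzRing) C-homomorphism
  (λ a b → Maybe.map (λ e → HR.reflexive (cong C e)) (dec⇒maybe (a ℚP.≟ b)))

recip : ℕ → ℚ
recip n = + 1 / suc n

recip-* : ∀ n → recip n * ι (suc n) ≡ 1ℚ
recip-* n = trans
  (cong₂ _*_ (ℚP.↥p/↧p≡p (mkℚ (+ 1) n (Coprimality.1-coprimeTo (suc n)))) (trans (ι-/1 (suc n)) (/1-mkℚ (+ suc n))))
  (ℚP.*-inverseˡ (mkℚ (+ suc n) 0 (Coprimality.sym (Coprimality.1-coprimeTo (suc n)))))

ι-cancel : ∀ n {x y} → ι (suc n) * x ≡ ι (suc n) * y → x ≡ y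
ι-cancel n {x} {y} e = begin
  x                            ≡⟨ unit x ⟨
  recip n * (ι (suc n) * x)    ≡⟨ cong (recip n *_) e ⟩
  recip n * (ι (suc n) * y)    ≡⟨ unit y ⟩
  y                            ∎
  where
  open ≡.≡-Reasoning
  unit : ∀ z → recip n * (ι (suc n) * z) ≡ z
  unit z = trans (sym (ℚP.*-assoc (recip n) (ι (suc n)) z)) (trans (cong (_* z) (recip-* n)) (ℚP.*-identityˡ z))

-- θ = t d/dt and X = multiplication by t, on Hurwitz series in t.
θ X : Series → Series
θ f n = ι n * f n

X f zero    = 0ℚ
X f (suc n) = ι (suc n) * f n

θ-cong : ∀ {f g} → f ≋ g → θ f ≋ θ g
θ-cong e n = cong (ι n *_) (e n)

X-cong : ∀ {f g} → f ≋ g → X f ≋ X g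
X-cong e zero    = refl
X-cong e (suc n) = cong (ι (suc n) *_) (e n)

-- Equations for D are multiplied by t, solved in terms of θ, and brought back by this cancellation.
X-injective : ∀ {f g} → X f ≋ X g → f ≋ g
X-injective e n = ι-cancel n (e (suc n))

θ-⊕ : ∀ f g → θ (f ⊕ g) ≋ θ f ⊕ θ g
θ-⊕ f g n = ℚP.*-distribˡ-+ (ι n) (f n) (g n)

X-⊕ : ∀ f g → X (f ⊕ g) ≋ X f ⊕ X g
X-⊕ f g zero    = refl
X-⊕ f g (suc n) = ℚP.*-distribˡ-+ (ι (suc n)) (f n) (g n)

X-scale : ∀ a f → X (scale a f) ≋ C a ⋆ X f
X-scale a f zero    = sym (ℚP.*-zeroʳ a)
X-scale a f (suc n) = trans
  (solve 3 (λ i a f → i :* (a :* f) := a :* (i :* f)) refl (ι (suc n)) a (f n))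
  (sym (C-⋆ a (X f) (suc n)))

θ-C : ∀ a → θ (C a) ≋ 𝟘
θ-C a zero    = trans (cong (_* a) ι-zero) (ℚP.*-zeroˡ a)
θ-C a (suc n) = ℚP.*-zeroʳ (ι (suc n))

θ-⋆ : ∀ f g → θ (f ⋆ g) ≋ θ f ⋆ g ⊕ f ⋆ θ g
θ-⋆ f g n = begin
  ι n * (f ⋆ g) n                                    ≡⟨ Φ-*ˡ n (ι n) _ ⟨
  Φ (λ k j → ι n * (f k * g j)) n                    ≡⟨ Φ-cong n split ⟩
  Φ (λ k j → ι k * f k * g j + f k * (ι j * g j)) n  ≡⟨ Φ-+ n _ _ ⟩
  (θ f ⋆ g ⊕ f ⋆ θ g) n                              ∎
  where
  open ≡.≡-Reasoning
  split : ∀ k j → k ℕ.+ j ≡ n → ι n * (f k * g j) ≡ ι k * f k * g j + f k * (ι j * g j)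
  split k j refl = trans (cong (_* (f k * g j)) (ι-+ k j))
    (solve 4 (λ x y a b → (x :+ y) :* (a :* b) := x :* a :* b :+ a :* (y :* b)) refl (ι k) (ι j) (f k) (g j))

XD : ∀ f → X (D f) ≋ θ f
XD f zero    = sym (trans (cong (_* f 0) ι-zero) (ℚP.*-zeroˡ (f 0)))
XD f (suc n) = refl

DX : ∀ f → D (X f) ≋ f ⊕ θ f
DX f n = trans (cong (_* f n) (ι-suc n))
  (solve 2 (λ i a → (con 1ℚ :+ i) :* a := a :+ i :* a) refl (ι n) (f n))

X-⋆ : ∀ f g → X f ⋆ g ≋ X (f ⋆ g)
X-⋆ f g zero    = ℚP.*-zeroˡ (g 0)
X-⋆ f g (suc n) = begin
  (D (X f) ⋆ g) n + (X f ⋆ D g) n               ≡⟨ cong₂ _+_ (⋆-cong {g = g} DX′ (λ _ → refl) n) (X-⋆ f (D g) n) ⟩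
  ((f ⊕ X (D f)) ⋆ g) n + X (f ⋆ D g) n         ≡⟨ cong (_+ X (f ⋆ D g) n) (⋆-distribʳ g f (X (D f)) n) ⟩
  (f ⋆ g) n + (X (D f) ⋆ g) n + X (f ⋆ D g) n   ≡⟨ cong (λ x → (f ⋆ g) n + x + X (f ⋆ D g) n) (X-⋆ (D f) g n) ⟩
  (f ⋆ g) n + X (D f ⋆ g) n + X (f ⋆ D g) n     ≡⟨ ℚP.+-assoc ((f ⋆ g) n) _ _ ⟩
  (f ⋆ g) n + (X (D f ⋆ g) n + X (f ⋆ D g) n)   ≡⟨ cong (_+_ ((f ⋆ g) n)) (X-⊕ (D f ⋆ g) (f ⋆ D g) n) ⟨
  (f ⋆ g) n + X (D (f ⋆ g)) n                   ≡⟨ cong (_+_ ((f ⋆ g) n)) (XD (f ⋆ g) n) ⟩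
  (f ⋆ g) n + θ (f ⋆ g) n                       ≡⟨ DX (f ⋆ g) n ⟨
  X (f ⋆ g) (suc n)                             ∎
  where
  open ≡.≡-Reasoning
  DX′ : D (X f) ≋ f ⊕ X (D f)
  DX′ k = trans (DX f k) (cong (_+_ (f k)) (sym (XD f k)))

θX : ∀ f → θ (X f) ≋ X f ⊕ X (θ f)
θX f zero    = ℚP.*-zeroʳ (ι 0)
θX f (suc n) = trans (cong (λ x → x * (ι (suc n) * f n)) (ι-suc n))
  (solve 3 (λ i j a → (con 1ℚ :+ i) :* (j :* a) := j :* a :+ j :* (i :* a)) refl (ι n) (ι (suc n)) (f n))

-- Multiplication by t absorbs the shift i + 1 in `L`, so that `L b` becomes the polynomial
-- `qnum-poly b` in the operator θ, applied to t f.
XL : ∀ b f n → X (L b f) n ≡ qnum-poly b (ι n) * X f n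
XL b f zero    = sym (ℚP.*-zeroʳ (qnum-poly b (ι 0)))
XL b f (suc n) = solve 3 (λ i a f → i :* (a :* f) := a :* (i :* f)) refl (ι (suc n)) (qnum-poly b (ι (suc n))) (f n)

-- As `θE` gives E = exp τ, the definition of τ reads τ = t exp τ, the tree function. Taking v = 1 +
-- θ τ avoids inverting a series; that v is 1 / (1 - τ) is the content of `τ⋆v`.
E τ v : Series
E = P 0
τ = X E
v = 𝟙 ⊕ θ τ

θE : θ E ≋ θ τ ⋆ E
θE = begin
  θ E            ≈⟨ XD E ⟨
  X (D E)        ≈⟨ X-cong P₀-equation ⟩
  X (L 0 E ⋆ E)  ≈⟨ X-⋆ (L 0 E) E ⟨
  X (L 0 E) ⋆ E  ≈⟨ HR.*-congʳ {x = E} (XL 0 E) ⟩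
  θ τ ⋆ E        ∎
  where open ≋-Reasoning

τ⋆v : τ ⋆ v ≋ θ τ
τ⋆v = begin
  τ ⋆ (𝟙 ⊕ θ τ)     ≈⟨ S.solve 2 (λ t s → t S.:* (S.con 1ℚ S.:+ s) S.:= t S.:+ t S.:* s) HR.refl τ (θ τ) ⟩
  τ ⊕ X E ⋆ θ τ     ≈⟨ HR.+-congˡ {x = τ} (X-⋆ E (θ τ)) ⟩
  τ ⊕ X (E ⋆ θ τ)   ≈⟨ HR.+-congˡ {x = τ} (X-cong (HR.trans (⋆-comm E (θ τ)) (HR.sym θE))) ⟩
  τ ⊕ X (θ E)       ≈⟨ θX E ⟨
  θ τ               ∎
  where open ≋-Reasoning

θv : θ v ≋ v ⋆ v ⋆ v ⊕ (⊖ (v ⋆ v))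
θv = begin
  θ v                              ≈⟨ θ-⊕ 𝟙 s ⟩
  θ 𝟙 ⊕ θ s                        ≈⟨ HR.+-congʳ {x = θ s} (θ-C 1ℚ) ⟩
  𝟘 ⊕ θ s                          ≈⟨ HR.+-identityˡ (θ s) ⟩
  θ s                              ≈⟨ θs ⟩
  s ⋆ v ⋆ v                        ≈⟨ S.solve 1 (λ s → let v = S.con 1ℚ S.:+ s in
                                        s S.:* v S.:* v S.:= v S.:* v S.:* v S.:- v S.:* v) HR.refl s ⟩
  v ⋆ v ⋆ v ⊕ (⊖ (v ⋆ v))          ∎
  where
  open ≋-Reasoning
  s = θ τ
  θs-split : θ s ≋ s ⋆ v ⊕ τ ⋆ θ s
  θs-split = begin
    θ s                     ≈⟨ θ-cong τ⋆v ⟨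
    θ (τ ⋆ v)               ≈⟨ θ-⋆ τ v ⟩
    s ⋆ v ⊕ τ ⋆ θ v         ≈⟨ HR.+-congˡ {x = s ⋆ v} (HR.*-congˡ {x = τ} (HR.trans (θ-⊕ 𝟙 s) (HR.trans (HR.+-congʳ {x = θ s} (θ-C 1ℚ)) (HR.+-identityˡ (θ s))))) ⟩
    s ⋆ v ⊕ τ ⋆ θ s         ∎
  θs : θ s ≋ s ⋆ v ⋆ v
  -- The unknown θ s also occurs on the right of `θs-split`, with factor τ. Multiplication by v
  -- turns this factor into τ v = s, and v - s = 1 isolates θ s without division.
  θs = begin
    θ s                                          ≈⟨ S.solve 2 (λ s w → w S.:= (S.con 1ℚ S.:+ s) S.:* w S.:- s S.:* w) HR.refl s (θ s) ⟩
    v ⋆ θ s ⊕ (⊖ (s ⋆ θ s))                      ≈⟨ HR.+-congʳ {x = ⊖ (s ⋆ θ s)} (HR.*-congˡ {x = v} θs-split) ⟩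
    v ⋆ (s ⋆ v ⊕ τ ⋆ θ s) ⊕ (⊖ (s ⋆ θ s))        ≈⟨ S.solve 4 (λ v s t w → v S.:* (s S.:* v S.:+ t S.:* w) S.:- s S.:* w
                                                     S.:= s S.:* v S.:* v S.:+ ((t S.:* v) S.:* w S.:- s S.:* w)) HR.refl v s τ (θ s) ⟩
    s ⋆ v ⋆ v ⊕ τ ⋆ v ⋆ θ s ⊕ (⊖ (s ⋆ θ s))      ≈⟨ HR.+-congˡ {x = s ⋆ v ⋆ v} (HR.+-congʳ {x = ⊖ (s ⋆ θ s)} (HR.*-congʳ {x = θ s} τ⋆v)) ⟩
    s ⋆ v ⋆ v ⊕ s ⋆ θ s ⊕ (⊖ (s ⋆ θ s))          ≈⟨ S.solve 2 (λ a b → a S.:+ (b S.:- b) S.:= a) HR.refl (s ⋆ v ⋆ v) (s ⋆ θ s) ⟩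
    s ⋆ v ⋆ v                                    ∎

-- Polynomials in `v`, represented by coefficient lists

Poly : Set
Poly = List ℚ

infixl 6 _+ₚ_ _-ₚ_
infixl 7 _*ₚ_
infixr 8 _·ₚ_

_+ₚ_ : Poly → Poly → Poly
[]      +ₚ r       = r
p       +ₚ []      = p
(a ∷ p) +ₚ (b ∷ r) = (a + b) ∷ (p +ₚ r)

_·ₚ_ : ℚ → Poly → Poly
a ·ₚ p = map (a *_) p

_-ₚ_ _*ₚ_ : Poly → Poly → Poly
p -ₚ r = p +ₚ (- 1ℚ) ·ₚ r

[]      *ₚ r = []
(a ∷ p) *ₚ r = a ·ₚ r +ₚ (0ℚ ∷ (p *ₚ r))

ev : Poly → Series
ev []      = 𝟘
ev (a ∷ p) = C a ⊕ v ⋆ ev p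

ev-0∷ : ∀ p → ev (0ℚ ∷ p) ≋ v ⋆ ev p
ev-0∷ p = S.solve 1 (λ f → S.con 0ℚ S.:+ f S.:= f) HR.refl (v ⋆ ev p)

ev-+ : ∀ p r → ev (p +ₚ r) ≋ ev p ⊕ ev r
ev-+ []      r       = HR.sym (HR.+-identityˡ (ev r))
ev-+ (a ∷ p) []      = HR.sym (HR.+-identityʳ (ev (a ∷ p)))
ev-+ (a ∷ p) (b ∷ r) = begin
  C (a + b) ⊕ v ⋆ ev (p +ₚ r)             ≈⟨ HR.+-cong (C+ a b) (HR.*-congˡ {x = v} (ev-+ p r)) ⟩
  (C a ⊕ C b) ⊕ v ⋆ (ev p ⊕ ev r)         ≈⟨ S.solve 5 (λ a b v p r → (a S.:+ b) S.:+ v S.:* (p S.:+ r)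
                                              S.:= (a S.:+ v S.:* p) S.:+ (b S.:+ v S.:* r)) HR.refl (C a) (C b) v (ev p) (ev r) ⟩
  (C a ⊕ v ⋆ ev p) ⊕ (C b ⊕ v ⋆ ev r)     ∎
  where
  open ≋-Reasoning
  C+ : ∀ a b → C (a + b) ≋ C a ⊕ C b
  C+ a b zero    = refl
  C+ a b (suc n) = refl

ev-· : ∀ a p → ev (a ·ₚ p) ≋ C a ⋆ ev p
ev-· a []      = HR.sym (HR.zeroʳ (C a))
ev-· a (b ∷ p) = begin
  C (a * b) ⊕ v ⋆ ev (a ·ₚ p)     ≈⟨ HR.+-cong (C* a b) (HR.*-congˡ {x = v} (ev-· a p)) ⟩
  C a ⋆ C b ⊕ v ⋆ (C a ⋆ ev p)    ≈⟨ S.solve 4 (λ a b v p → a S.:* b S.:+ v S.:* (a S.:* p) S.:= a S.:* (b S.:+ v S.:* p))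
                                       HR.refl (C a) (C b) v (ev p) ⟩
  C a ⋆ (C b ⊕ v ⋆ ev p)          ∎
  where
  open ≋-Reasoning
  C* : ∀ a b → C (a * b) ≋ C a ⋆ C b
  C* = ACR._-Raw-AlmostCommutative⟶_.*-homo C-homomorphism

ev-- : ∀ p r → ev (p -ₚ r) ≋ ev p ⊕ (⊖ ev r)
ev-- p r = begin
  ev (p -ₚ r)                   ≈⟨ ev-+ p ((- 1ℚ) ·ₚ r) ⟩
  ev p ⊕ ev ((- 1ℚ) ·ₚ r)       ≈⟨ HR.+-congˡ {x = ev p} (ev-· (- 1ℚ) r) ⟩
  ev p ⊕ C (- 1ℚ) ⋆ ev r        ≈⟨ S.solve 2 (λ p r → p S.:+ S.con (- 1ℚ) S.:* r S.:= p S.:- r) HR.refl (ev p) (ev r) ⟩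
  ev p ⊕ (⊖ ev r)               ∎
  where open ≋-Reasoning

ev-* : ∀ p r → ev (p *ₚ r) ≋ ev p ⋆ ev r
ev-* []      r = HR.sym (HR.zeroˡ (ev r))
ev-* (a ∷ p) r = begin
  ev (a ·ₚ r +ₚ (0ℚ ∷ (p *ₚ r)))          ≈⟨ ev-+ (a ·ₚ r) _ ⟩
  ev (a ·ₚ r) ⊕ ev (0ℚ ∷ (p *ₚ r))        ≈⟨ HR.+-cong (ev-· a r) (HR.trans (ev-0∷ (p *ₚ r)) (HR.*-congˡ {x = v} (ev-* p r))) ⟩
  C a ⋆ ev r ⊕ v ⋆ (ev p ⋆ ev r)          ≈⟨ S.solve 4 (λ a v p r → a S.:* r S.:+ v S.:* (p S.:* r) S.:= (a S.:+ v S.:* p) S.:* r)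
                                               HR.refl (C a) v (ev p) (ev r) ⟩
  (C a ⊕ v ⋆ ev p) ⋆ ev r                 ∎
  where open ≋-Reasoning

ev-zero : ∀ {p} → All (_≡ 0ℚ) p → ev p ≋ 𝟘
ev-zero []                = HR.refl
ev-zero {_ ∷ p} (refl ∷ z) = HR.trans (ev-0∷ p) (HR.trans (HR.*-congˡ {x = v} (ev-zero z)) (HR.zeroʳ v))

-- Testing the difference for zeros makes trailing zeros harmless and leaves a condition that is
-- decided by computation.
ev-equal : ∀ p r → All (_≡ 0ℚ) (p -ₚ r) → ev p ≋ ev r
ev-equal p r z = begin
  ev p                          ≈⟨ S.solve 2 (λ p r → p S.:= (p S.:- r) S.:+ r) HR.refl (ev p) (ev r) ⟩
  (ev p ⊕ (⊖ ev r)) ⊕ ev r      ≈⟨ HR.+-congʳ {x = ev r} (HR.trans (HR.sym (ev-- p r)) (ev-zero z)) ⟩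
  𝟘 ⊕ ev r                      ≈⟨ HR.+-identityˡ (ev r) ⟩
  ev r                          ∎
  where open ≋-Reasoning

-- Both θ f and θ (τ f) are polynomials in v if f is, because θ v = v³ - v² and τ v = v - 1.
θₚ Θₚ : Poly → Poly
θₚ []      = []
θₚ (a ∷ p) = (0ℚ ∷ θₚ p) +ₚ (0ℚ ∷ 0ℚ ∷ ((0ℚ ∷ p) -ₚ p))

Θₚ []      = []
Θₚ (a ∷ p) = a ·ₚ (- 1ℚ ∷ 1ℚ ∷ []) +ₚ (0ℚ ∷ (Θₚ p +ₚ (p +ₚ (0ℚ ∷ ((- (+ 2 / 1)) ·ₚ p +ₚ (0ℚ ∷ p))))))

ev-θ : ∀ p → ev (θₚ p) ≋ θ (ev p)
ev-θ []      = λ n → sym (ℚP.*-zeroʳ (ι n))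
ev-θ (a ∷ p) = begin
  ev ((0ℚ ∷ θₚ p) +ₚ (0ℚ ∷ 0ℚ ∷ ((0ℚ ∷ p) -ₚ p)))
    ≈⟨ ev-+ (0ℚ ∷ θₚ p) (0ℚ ∷ 0ℚ ∷ ((0ℚ ∷ p) -ₚ p)) ⟩
  ev (0ℚ ∷ θₚ p) ⊕ ev (0ℚ ∷ 0ℚ ∷ ((0ℚ ∷ p) -ₚ p))
    ≈⟨ HR.+-cong (ev-0∷ (θₚ p)) (HR.trans (ev-0∷ (0ℚ ∷ ((0ℚ ∷ p) -ₚ p))) (HR.*-congˡ {x = v} (ev-0∷ ((0ℚ ∷ p) -ₚ p)))) ⟩
  v ⋆ ev (θₚ p) ⊕ v ⋆ (v ⋆ ev ((0ℚ ∷ p) -ₚ p))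
    ≈⟨ HR.+-cong (HR.*-congˡ {x = v} (ev-θ p)) (HR.*-congˡ {x = v} (HR.*-congˡ {x = v}
         (HR.trans (ev-- (0ℚ ∷ p) p) (HR.+-congʳ {x = ⊖ ev p} (ev-0∷ p))))) ⟩
  v ⋆ θ (ev p) ⊕ v ⋆ (v ⋆ (v ⋆ ev p ⊕ (⊖ ev p)))
    ≈⟨ S.solve 3 (λ v p w → v S.:* w S.:+ v S.:* (v S.:* (v S.:* p S.:- p))
         S.:= S.con 0ℚ S.:+ ((v S.:* v S.:* v S.:- v S.:* v) S.:* p S.:+ v S.:* w)) HR.refl v (ev p) (θ (ev p)) ⟩
  C 0ℚ ⊕ ((v ⋆ v ⋆ v ⊕ (⊖ (v ⋆ v))) ⋆ ev p ⊕ v ⋆ θ (ev p))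
    ≈⟨ HR.+-cong (HR.trans (θ-C a) (HR.sym {C 0ℚ} {𝟘} (ACR._-Raw-AlmostCommutative⟶_.0-homo C-homomorphism)))
                 (HR.trans (θ-⋆ v (ev p)) (HR.+-congʳ {x = v ⋆ θ (ev p)} (HR.*-congʳ {x = ev p} θv))) ⟨
  θ (C a) ⊕ θ (v ⋆ ev p)
    ≈⟨ θ-⊕ (C a) (v ⋆ ev p) ⟨
  θ (C a ⊕ v ⋆ ev p) ∎
  where open ≋-Reasoning

ev-Θ : ∀ p → ev (Θₚ p) ≋ θ (τ ⋆ ev p)
ev-Θ []      = λ n → sym (trans (cong (ι n *_) (HR.zeroʳ τ n)) (ℚP.*-zeroʳ (ι n)))
ev-Θ (a ∷ p) = begin
  ev (a ·ₚ (- 1ℚ ∷ 1ℚ ∷ []) +ₚ (0ℚ ∷ (Θₚ p +ₚ t₁)))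
    ≈⟨ ev-+ (a ·ₚ (- 1ℚ ∷ 1ℚ ∷ [])) (0ℚ ∷ (Θₚ p +ₚ t₁)) ⟩
  ev (a ·ₚ (- 1ℚ ∷ 1ℚ ∷ [])) ⊕ ev (0ℚ ∷ (Θₚ p +ₚ t₁))
    ≈⟨ HR.+-cong (ev-· a (- 1ℚ ∷ 1ℚ ∷ [])) (HR.trans (ev-0∷ (Θₚ p +ₚ t₁)) (HR.*-congˡ {x = v}
         (HR.trans (ev-+ (Θₚ p) t₁) (HR.+-cong (ev-Θ p) t₁-value)))) ⟩
  C a ⋆ ev (- 1ℚ ∷ 1ℚ ∷ []) ⊕ v ⋆ (θ (τ ⋆ f) ⊕ (f ⊕ v ⋆ (C (- (+ 2 / 1)) ⋆ f ⊕ v ⋆ f)))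
    ≈⟨ HR.+-congʳ {x = v ⋆ (θ (τ ⋆ f) ⊕ (f ⊕ v ⋆ (C (- (+ 2 / 1)) ⋆ f ⊕ v ⋆ f)))} (HR.*-congˡ {x = C a} (HR.+-congˡ {x = C (- 1ℚ)}
         (HR.*-congˡ {x = v} (HR.+-congˡ {x = C 1ℚ} (HR.zeroʳ v))))) ⟩
  C a ⋆ (C (- 1ℚ) ⊕ v ⋆ (C 1ℚ ⊕ 𝟘)) ⊕ v ⋆ (θ (τ ⋆ f) ⊕ (f ⊕ v ⋆ (C (- (+ 2 / 1)) ⋆ f ⊕ v ⋆ f)))
    ≈⟨ HR.+-congʳ {x = v ⋆ (θ (τ ⋆ f) ⊕ (f ⊕ v ⋆ (C (- (+ 2 / 1)) ⋆ f ⊕ v ⋆ f)))} (HR.*-congˡ {x = C a} (HR.+-congˡ {x = C (- 1ℚ)}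
         (HR.*-congˡ {x = v} (HR.+-identityʳ (C 1ℚ))))) ⟩
  C a ⋆ (C (- 1ℚ) ⊕ v ⋆ C 1ℚ) ⊕ v ⋆ (θ (τ ⋆ f) ⊕ (f ⊕ v ⋆ (C (- (+ 2 / 1)) ⋆ f ⊕ v ⋆ f)))
    ≈⟨ S.solve 4 (λ a s f w → let v = S.con 1ℚ S.:+ s in
         a S.:* (S.con (- 1ℚ) S.:+ v S.:* S.con 1ℚ)
           S.:+ v S.:* (w S.:+ (f S.:+ v S.:* (S.con (- (+ 2 / 1)) S.:* f S.:+ v S.:* f)))
         S.:= a S.:* s S.:+ ((v S.:* s S.:* s) S.:* f S.:+ v S.:* w)) HR.refl (C a) (θ τ) f (θ (τ ⋆ f)) ⟩
  C a ⋆ θ τ ⊕ ((v ⋆ θ τ ⋆ θ τ) ⋆ f ⊕ v ⋆ θ (τ ⋆ f))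
    ≈⟨ HR.+-congˡ {x = C a ⋆ θ τ} split ⟩
  C a ⋆ θ τ ⊕ θ (v ⋆ (τ ⋆ f))
    ≈⟨ HR.+-congʳ {x = θ (v ⋆ (τ ⋆ f))} constant ⟩
  θ (C a ⋆ τ) ⊕ θ (v ⋆ (τ ⋆ f))
    ≈⟨ θ-⊕ (C a ⋆ τ) (v ⋆ (τ ⋆ f)) ⟨
  θ (C a ⋆ τ ⊕ v ⋆ (τ ⋆ f))
    ≈⟨ θ-cong (S.solve 4 (λ a t v f → a S.:* t S.:+ v S.:* (t S.:* f) S.:= t S.:* (a S.:+ v S.:* f)) HR.refl (C a) τ v f) ⟩
  θ (τ ⋆ (C a ⊕ v ⋆ f)) ∎
  where
  open ≋-Reasoning
  f = ev p
  t₁ = p +ₚ (0ℚ ∷ ((- (+ 2 / 1)) ·ₚ p +ₚ (0ℚ ∷ p)))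
  t₁-value : ev t₁ ≋ f ⊕ v ⋆ (C (- (+ 2 / 1)) ⋆ f ⊕ v ⋆ f)
  t₁-value = HR.trans (ev-+ p (0ℚ ∷ ((- (+ 2 / 1)) ·ₚ p +ₚ (0ℚ ∷ p)))) (HR.+-congˡ {x = f}
    (HR.trans (ev-0∷ ((- (+ 2 / 1)) ·ₚ p +ₚ (0ℚ ∷ p))) (HR.*-congˡ {x = v}
      (HR.trans (ev-+ ((- (+ 2 / 1)) ·ₚ p) (0ℚ ∷ p)) (HR.+-cong (ev-· (- (+ 2 / 1)) p) (ev-0∷ p))))))
  constant : C a ⋆ θ τ ≋ θ (C a ⋆ τ)
  constant = HR.sym (HR.trans (θ-⋆ (C a) τ) (HR.trans (HR.+-congʳ {x = C a ⋆ θ τ}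
    (HR.trans (HR.*-congʳ {x = τ} (θ-C a)) (HR.zeroˡ τ))) (HR.+-identityˡ (C a ⋆ θ τ))))
  -- θ v · τ = (v - 1) v² τ = v (v - 1)²
  split : (v ⋆ θ τ ⋆ θ τ) ⋆ f ⊕ v ⋆ θ (τ ⋆ f) ≋ θ (v ⋆ (τ ⋆ f))
  split = begin
    (v ⋆ θ τ ⋆ θ τ) ⋆ f ⊕ v ⋆ θ (τ ⋆ f)
      ≈⟨ HR.+-congʳ {x = v ⋆ θ (τ ⋆ f)} (HR.*-congʳ {x = f} (HR.*-congˡ {x = v ⋆ θ τ} τ⋆v)) ⟨
    (v ⋆ θ τ ⋆ (τ ⋆ v)) ⋆ f ⊕ v ⋆ θ (τ ⋆ f)
      ≈⟨ S.solve 4 (λ s t f w → let v = S.con 1ℚ S.:+ s in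
           (v S.:* s S.:* (t S.:* v)) S.:* f S.:+ v S.:* w
           S.:= (v S.:* v S.:* v S.:- v S.:* v) S.:* (t S.:* f) S.:+ v S.:* w) HR.refl (θ τ) τ f (θ (τ ⋆ f)) ⟩
    (v ⋆ v ⋆ v ⊕ (⊖ (v ⋆ v))) ⋆ (τ ⋆ f) ⊕ v ⋆ θ (τ ⋆ f)
      ≈⟨ HR.+-congʳ {x = v ⋆ θ (τ ⋆ f)} (HR.*-congʳ {x = τ ⋆ f} θv) ⟨
    θ v ⋆ (τ ⋆ f) ⊕ v ⋆ θ (τ ⋆ f)
      ≈⟨ θ-⋆ v (τ ⋆ f) ⟨
    θ (v ⋆ (τ ⋆ f)) ∎

-- For f = E p(v) the series t f = τ p(v) need not be a polynomial in v, since τ = 1 - 1/v. The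
-- factor x of `qnum-poly` becomes θ, and θ (τ p(v)) is one; each further factor x - (b + 1) acts as
-- θ - (b + 1). The factor E has been used up in τ = t E.
Mₚ : ℕ → Poly → Poly
Mₚ zero    p = Θₚ p
Mₚ (suc b) p = (+ suc b / suc (suc b)) ·ₚ (θₚ (Mₚ b p) -ₚ (+ suc b / 1) ·ₚ Mₚ b p)

record Represents (p : Poly) (f : Series) : Set where
  constructor represents
  field value-as-E⋆ev : f ≋ E ⋆ ev p
open Represents

XL-represents : ∀ b {p f} → Represents p f → X (L b f) ≋ ev (Mₚ b p)
XL-represents zero {p} {f} (represents r) = begin
  X (L 0 f)          ≈⟨ XL 0 f ⟩
  θ (X f)            ≈⟨ θ-cong (X-cong r) ⟩
  θ (X (E ⋆ ev p))   ≈⟨ θ-cong (X-⋆ E (ev p)) ⟨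
  θ (τ ⋆ ev p)       ≈⟨ ev-Θ p ⟨
  ev (Θₚ p)          ∎
  where open ≋-Reasoning
XL-represents (suc b) {p} {f} r = begin
  X (L (suc b) f)
    ≈⟨ recurrence ⟩
  C c ⋆ (θ (X (L b f)) ⊕ (⊖ (C d ⋆ X (L b f))))
    ≈⟨ HR.*-congˡ {x = C c} (HR.+-cong (θ-cong (XL-represents b r)) (HR.-‿cong (HR.*-congˡ {x = C d} (XL-represents b r)))) ⟩
  C c ⋆ (θ (ev (Mₚ b p)) ⊕ (⊖ (C d ⋆ ev (Mₚ b p))))
    ≈⟨ HR.*-congˡ {x = C c} (HR.+-cong (ev-θ (Mₚ b p)) (HR.-‿cong (ev-· d (Mₚ b p)))) ⟨
  C c ⋆ (ev (θₚ (Mₚ b p)) ⊕ (⊖ ev (d ·ₚ Mₚ b p)))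
    ≈⟨ HR.*-congˡ {x = C c} (ev-- (θₚ (Mₚ b p)) (d ·ₚ Mₚ b p)) ⟨
  C c ⋆ ev (θₚ (Mₚ b p) -ₚ d ·ₚ Mₚ b p)
    ≈⟨ ev-· c (θₚ (Mₚ b p) -ₚ d ·ₚ Mₚ b p) ⟨
  ev (Mₚ (suc b) p) ∎
  where
  open ≋-Reasoning
  c = + suc b / suc (suc b)
  d = + suc b / 1
  recurrence : X (L (suc b) f) ≋ C c ⋆ (θ (X (L b f)) ⊕ (⊖ (C d ⋆ X (L b f))))
  recurrence n = trans (XL (suc b) f n) (trans
    (solve 5 (λ c d i a x → c :* ((i :- d) :* a) :* x := c :* (i :* (a :* x) :- d :* (a :* x)))
       refl c d (ι n) (qnum-poly b (ι n)) (X f n))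
    (sym (trans (C-⋆ c _ n) (cong (c *_) (cong₂ _-_ (cong (ι n *_) (XL b f n))
       (trans (C-⋆ d (X (L b f)) n) (cong (d *_) (XL b f n))))))))

-- The statement is about t f because the sources are products with some `L b f`, and only t `L b f`
-- is known to be a polynomial in v. The other factor of each product supplies the single E.
record _⊩_ (p : Poly) (f : Series) : Set where
  constructor forces
  field X-value : X f ≋ E ⋆ ev p
open _⊩_

infixr 6 _⊩+_
_⊩+_ : ∀ {p r f g} → p ⊩ f → r ⊩ g → (p +ₚ r) ⊩ (f ⊕ g)
_⊩+_ {p} {r} {f} {g} (forces x) (forces y) .X-value = begin
  X (f ⊕ g)                  ≈⟨ X-⊕ f g ⟩
  X f ⊕ X g                  ≈⟨ HR.+-cong x y ⟩
  E ⋆ ev p ⊕ E ⋆ ev r        ≈⟨ ⋆-distribˡ E (ev p) (ev r) ⟨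
  E ⋆ (ev p ⊕ ev r)          ≈⟨ HR.*-congˡ {x = E} (ev-+ p r) ⟨
  E ⋆ ev (p +ₚ r)            ∎
  where open ≋-Reasoning

infixr 7 _⊩·_
_⊩·_ : ∀ a {p f} → p ⊩ f → (a ·ₚ p) ⊩ scale a f
_⊩·_ a {p} {f} (forces x) .X-value = begin
  X (scale a f)       ≈⟨ X-scale a f ⟩
  C a ⋆ X f           ≈⟨ HR.*-congˡ {x = C a} x ⟩
  C a ⋆ (E ⋆ ev p)    ≈⟨ S.solve 3 (λ a e p → a S.:* (e S.:* p) S.:= e S.:* (a S.:* p)) HR.refl (C a) E (ev p) ⟩
  E ⋆ (C a ⋆ ev p)    ≈⟨ HR.*-congˡ {x = E} (ev-· a p) ⟨
  E ⋆ ev (a ·ₚ p)     ∎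
  where open ≋-Reasoning

⊩-L⋆ : ∀ b {p r f g} → Represents p f → Represents r g → (Mₚ b p *ₚ r) ⊩ (L b f ⋆ g)
⊩-L⋆ b {p} {r} {f} {g} x (represents y) .X-value = begin
  X (L b f ⋆ g)                 ≈⟨ X-⋆ (L b f) g ⟨
  X (L b f) ⋆ g                 ≈⟨ ⋆-cong (XL-represents b x) y ⟩
  ev (Mₚ b p) ⋆ (E ⋆ ev r)      ≈⟨ S.solve 3 (λ m e r → m S.:* (e S.:* r) S.:= e S.:* (m S.:* r)) HR.refl (ev (Mₚ b p)) E (ev r) ⟩
  E ⋆ (ev (Mₚ b p) ⋆ ev r)      ≈⟨ HR.*-congˡ {x = E} (ev-* (Mₚ b p) r) ⟨
  E ⋆ ev (Mₚ b p *ₚ r)          ∎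
  where open ≋-Reasoning

Dₚ : Poly → Poly
Dₚ p = ((0ℚ ∷ p) -ₚ p) +ₚ θₚ p

⊩-D : ∀ p → Dₚ p ⊩ D (E ⋆ ev p)
⊩-D p .X-value = begin
  X (D (E ⋆ ev p))                            ≈⟨ XD (E ⋆ ev p) ⟩
  θ (E ⋆ ev p)                                ≈⟨ θ-⋆ E (ev p) ⟩
  θ E ⋆ ev p ⊕ E ⋆ θ (ev p)                   ≈⟨ HR.+-congʳ {x = E ⋆ θ (ev p)} (HR.*-congʳ {x = ev p} θE) ⟩
  θ τ ⋆ E ⋆ ev p ⊕ E ⋆ θ (ev p)               ≈⟨ S.solve 4 (λ s e p w → s S.:* e S.:* p S.:+ e S.:* w
                                                   S.:= e S.:* (((S.con 1ℚ S.:+ s) S.:* p S.:- p) S.:+ w))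
                                                   HR.refl (θ τ) E (ev p) (θ (ev p)) ⟩
  E ⋆ ((v ⋆ ev p ⊕ (⊖ ev p)) ⊕ θ (ev p))      ≈⟨ HR.*-congˡ {x = E} (HR.+-cong
                                                   (HR.trans (ev-- (0ℚ ∷ p) p) (HR.+-congʳ {x = ⊖ ev p} (ev-0∷ p))) (ev-θ p)) ⟨
  E ⋆ (ev ((0ℚ ∷ p) -ₚ p) ⊕ ev (θₚ p))        ≈⟨ HR.*-congˡ {x = E} (ev-+ ((0ℚ ∷ p) -ₚ p) (θₚ p)) ⟨
  E ⋆ ev (Dₚ p)                               ∎
  where open ≋-Reasoning

linearₚ : Poly → Poly
linearₚ p = Mₚ 0 p *ₚ (1ℚ ∷ []) +ₚ Mₚ 0 (1ℚ ∷ []) *ₚ p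

E-represented : Represents (1ℚ ∷ []) E
E-represented .value-as-E⋆ev = HR.sym (HR.trans (HR.*-congˡ {x = E} (HR.trans (HR.+-congˡ {x = C 1ℚ} (HR.zeroʳ v)) (HR.+-identityʳ (C 1ℚ)))) (HR.*-identityʳ E))

⊩-linear : ∀ {p f} → Represents p f → linearₚ p ⊩ linear E f
⊩-linear r = ⊩-L⋆ 0 r E-represented ⊩+ ⊩-L⋆ 0 E-represented r

-- The coefficient at n + 1 is determined by coefficients with index at most n; the bound N makes
-- the induction strong.
linear-ode-unique : ∀ {e k f g} → D f ≋ k ⊕ linear e f → D g ≋ k ⊕ linear e g → f 0 ≡ g 0 → f ≋ g
linear-ode-unique {e} {k} {f} {g} df dg base n = below n n ℕP.≤-refl
  where
  open ≡.≡-Reasoning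
  below : ∀ N n → n ℕ.≤ N → f n ≡ g n
  below N       zero    n≤N       = base
  below (suc N) (suc n) (s≤s n≤N) = begin
    f (suc n)                ≡⟨ df n ⟩
    k n + linear e f n       ≡⟨ cong (_+_ (k n)) (cong₂ _+_
                                  (Φ-cong n λ i l p → cong (λ x → qnum-poly 0 (ι (suc i)) * x * e l)
                                    (below N i (ℕP.≤-trans (subst (i ℕ.≤_) p (ℕP.m≤m+n i l)) n≤N)))
                                  (Φ-cong n λ i l p → cong (L 0 e i *_)
                                    (below N l (ℕP.≤-trans (subst (l ℕ.≤_) p (ℕP.m≤n+m l i)) n≤N)))) ⟩
    k n + linear e g n       ≡⟨ dg n ⟨
    g (suc n)                ∎

-- The series τ has no constant term, so v is 1 at t = 0, and a vanishing initial value means that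
-- the coefficients sum to 0.
ev-at-0 : ∀ p → ev p 0 ≡ sumℚ p
ev-at-0 []      = refl
ev-at-0 (a ∷ p) = cong (_+_ a) (begin
  v 0 * ev p 0      ≡⟨ cong (_* ev p 0) (cong (λ x → 1ℚ + x * 0ℚ) ι-zero) ⟩
  1ℚ * ev p 0       ≡⟨ ℚP.*-identityˡ _ ⟩
  ev p 0            ≡⟨ ev-at-0 p ⟩
  sumℚ p            ∎)
  where open ≡.≡-Reasoning

-- The candidate E p(v) solves the differential equation of f: after multiplication by t both sides
-- are E times a polynomial in v, and the two lists are compared by evaluation. Uniqueness then
-- identifies it with f.
represented : ∀ {p k f} {κ : Series} → k ⊩ κ → D f ≋ κ ⊕ linear E f → f 0 ≡ 0ℚ → sumℚ p ≡ 0ℚ →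
  True (All.all? (ℚP._≟ 0ℚ) (Dₚ p -ₚ (k +ₚ linearₚ p))) → Represents p f
represented {p} {k} {f} {κ} src df f₀ p₀ z .value-as-E⋆ev = linear-ode-unique {E} {κ} df candidate
  (trans f₀ (sym (trans (cong (E 0 *_) (trans (ev-at-0 p) p₀)) (ℚP.*-zeroʳ (E 0)))))
  where
  open ≋-Reasoning
  candidate : D (E ⋆ ev p) ≋ κ ⊕ linear E (E ⋆ ev p)
  candidate = X-injective (begin
    X (D (E ⋆ ev p))                    ≈⟨ ⊩-D p .X-value ⟩
    E ⋆ ev (Dₚ p)                       ≈⟨ HR.*-congˡ {x = E} (ev-equal (Dₚ p) (k +ₚ linearₚ p) (toWitness z)) ⟩
    E ⋆ ev (k +ₚ linearₚ p)             ≈⟨ (src ⊩+ ⊩-linear {p} (represents HR.refl)) .X-value ⟨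
    X (κ ⊕ linear E (E ⋆ ev p))         ∎)

-- This is (v - 1)² / 2. The j-th moment has a polynomial of degree 3j - 1 in v. The polynomials are
-- proposed here and only checked afterwards, by `represented`.
g₁ : Poly
g₁ = + 1 / 2 ∷ - (+ 1 / 1) ∷ + 1 / 2 ∷ []

g₂ : Poly
g₂ = - (+ 1 / 6) ∷ - (+ 1 / 12) ∷ 0ℚ ∷ + 13 / 6 ∷ - (+ 19 / 6) ∷ + 5 / 4 ∷ []

g₃ : Poly
g₃ = + 1 / 4 ∷ + 1 / 8 ∷ 0ℚ ∷ - (+ 23 / 8) ∷ + 21 / 2 ∷ - (+ 261 / 8) ∷ + 54 / 1 ∷ - (+ 325 / 8) ∷ + 45 / 4 ∷ []

P₁-represented : Represents g₁ (P 1)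
P₁-represented = represented
  (⊩-L⋆ 1 E-represented E-represented)
  P₁-equation refl refl _

P₂-represented : Represents g₂ (P 2)
P₂-represented = represented
  ((⊩-L⋆ 2 E-represented E-represented ⊩+ (+ 2 / 1) ⊩· (⊩-L⋆ 1 P₁-represented E-represented ⊩+ (⊩-L⋆ 1 E-represented P₁-represented ⊩+ ⊩-L⋆ 0 P₁-represented P₁-represented))))
  P₂-equation refl refl _

P₃-represented : Represents g₃ (P 3)
P₃-represented = represented
  ((⊩-L⋆ 3 E-represented E-represented ⊩+ ((+ 3 / 1) ⊩· (⊩-L⋆ 2 P₁-represented E-represented ⊩+ (⊩-L⋆ 2 E-represented P₁-represented ⊩+ (⊩-L⋆ 1 P₂-represented E-represented ⊩+ (⊩-L⋆ 1 E-represented P₂-represented ⊩+ (⊩-L⋆ 0 P₂-represented P₁-represented ⊩+ ⊩-L⋆ 0 P₁-represented P₂-represented))))) ⊩+ (+ 6 / 1) ⊩· ⊩-L⋆ 1 P₁-represented P₁-represented)))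
  P₃-equation refl refl _

-- Extraction of coefficients

V : ℕ → Series
V zero    = E
V (suc k) = v ⋆ V k

θV : ∀ k → θ (V k) ≋ C (ι k) ⋆ V (suc (suc k)) ⊕ (C (1ℚ - ι k) ⋆ V (suc k) ⊕ (⊖ V k))
θV zero = begin
  θ E                                   ≈⟨ θE ⟩
  θ τ ⋆ E                               ≈⟨ S.solve 2 (λ s e → let v = S.con 1ℚ S.:+ s in
                                             s S.:* e S.:= S.con 0ℚ S.:* (v S.:* (v S.:* e))
                                               S.:+ (S.con 1ℚ S.:* (v S.:* e) S.:- e)) HR.refl (θ τ) E ⟩
  C 0ℚ ⋆ V 2 ⊕ (C 1ℚ ⋆ V 1 ⊕ (⊖ V 0))   ≡⟨ cong (λ x → C x ⋆ V 2 ⊕ (C (1ℚ - x) ⋆ V 1 ⊕ (⊖ V 0))) ι-zero ⟨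
  C (ι 0) ⋆ V 2 ⊕ (C (1ℚ - ι 0) ⋆ V 1 ⊕ (⊖ V 0)) ∎
  where open ≋-Reasoning
θV (suc k) = begin
  θ (v ⋆ V k)
    ≈⟨ θ-⋆ v (V k) ⟩
  θ v ⋆ V k ⊕ v ⋆ θ (V k)
    ≈⟨ HR.+-cong (HR.*-congʳ {x = V k} θv) (HR.*-congˡ {x = v} (θV k)) ⟩
  (v ⋆ v ⋆ v ⊕ (⊖ (v ⋆ v))) ⋆ V k ⊕ v ⋆ (C (ι k) ⋆ V (suc (suc k)) ⊕ (C (1ℚ - ι k) ⋆ V (suc k) ⊕ (⊖ V k)))
    ≈⟨ HR.+-congˡ {x = (v ⋆ v ⋆ v ⊕ (⊖ (v ⋆ v))) ⋆ V k} (HR.*-congˡ {x = v} (HR.+-congˡ {x = C (ι k) ⋆ V (suc (suc k))}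
         (HR.+-congʳ {x = ⊖ V k} (HR.*-congʳ {x = V (suc k)} (C-1- (ι k)))))) ⟩
  (v ⋆ v ⋆ v ⊕ (⊖ (v ⋆ v))) ⋆ V k ⊕ v ⋆ (C (ι k) ⋆ V (suc (suc k)) ⊕ ((C 1ℚ ⊕ (⊖ C (ι k))) ⋆ V (suc k) ⊕ (⊖ V k)))
    ≈⟨ S.solve 3 (λ v c e →
         (v S.:* v S.:* v S.:- v S.:* v) S.:* e
           S.:+ v S.:* (c S.:* (v S.:* (v S.:* e)) S.:+ ((S.con 1ℚ S.:- c) S.:* (v S.:* e) S.:- e))
         S.:= (S.con 1ℚ S.:+ c) S.:* (v S.:* (v S.:* (v S.:* e)))
           S.:+ ((S.con 1ℚ S.:- (S.con 1ℚ S.:+ c)) S.:* (v S.:* (v S.:* e)) S.:- v S.:* e))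
         HR.refl v (C (ι k)) (V k) ⟩
  (C 1ℚ ⊕ C (ι k)) ⋆ V (3 ℕ.+ k) ⊕ ((C 1ℚ ⊕ (⊖ (C 1ℚ ⊕ C (ι k)))) ⋆ V (2 ℕ.+ k) ⊕ (⊖ V (suc k)))
    ≈⟨ HR.+-cong (HR.*-congʳ {x = V (3 ℕ.+ k)} (C-suc k)) (HR.+-congʳ {x = ⊖ V (suc k)} (HR.*-congʳ {x = V (2 ℕ.+ k)}
         (HR.trans (C-1- (ι (suc k))) (HR.+-congˡ {x = C 1ℚ} (HR.-‿cong (C-suc k)))))) ⟨
  C (ι (suc k)) ⋆ V (3 ℕ.+ k) ⊕ (C (1ℚ - ι (suc k)) ⋆ V (2 ℕ.+ k) ⊕ (⊖ V (suc k))) ∎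
  where
  open ≋-Reasoning
  C-1- : ∀ a → C (1ℚ - a) ≋ C 1ℚ ⊕ (⊖ C a)
  C-1- a zero    = refl
  C-1- a (suc n) = refl
  C-suc : ∀ k → C (ι (suc k)) ≋ C 1ℚ ⊕ C (ι k)
  C-suc k zero    = ι-suc k
  C-suc k (suc n) = refl

-- Comparison of coefficients in `θV`. For k = 0 the term with V 2 drops out and V 1 is expressed by
-- E. For k ≥ 1 every later V follows from V 1 and V 2, so V 2 is the only genuinely new quantity.
V-recurrence : ∀ k n → ι k * V (suc (suc k)) n ≡ (ι k - 1ℚ) * V (suc k) n + (1ℚ + ι n) * V k n
V-recurrence k n = begin
  ι k * V (suc (suc k)) n
    ≡⟨ solve 4 (λ k a b c → k :* a := (k :* a :+ ((con 1ℚ :- k) :* b :- c)) :+ ((k :- con 1ℚ) :* b :+ c)) refl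
         (ι k) (V (suc (suc k)) n) (V (suc k) n) (V k n) ⟩
  (ι k * V (suc (suc k)) n + ((1ℚ - ι k) * V (suc k) n - V k n)) + ((ι k - 1ℚ) * V (suc k) n + V k n)
    ≡⟨ cong (_+ ((ι k - 1ℚ) * V (suc k) n + V k n)) (cong₂ (λ x y → x + (y - V k n)) (C-⋆ (ι k) (V (suc (suc k))) n) (C-⋆ (1ℚ - ι k) (V (suc k)) n)) ⟨
  (C (ι k) ⋆ V (suc (suc k)) ⊕ (C (1ℚ - ι k) ⋆ V (suc k) ⊕ (⊖ V k))) n + ((ι k - 1ℚ) * V (suc k) n + V k n)
    ≡⟨ cong (_+ ((ι k - 1ℚ) * V (suc k) n + V k n)) (θV k n) ⟨
  ι n * V k n + ((ι k - 1ℚ) * V (suc k) n + V k n)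
    ≡⟨ solve 4 (λ n k b c → n :* c :+ ((k :- con 1ℚ) :* b :+ c) := (k :- con 1ℚ) :* b :+ (con 1ℚ :+ n) :* c) refl
         (ι n) (ι k) (V (suc k) n) (V k n) ⟩
  (ι k - 1ℚ) * V (suc k) n + (1ℚ + ι n) * V k n ∎
  where open ≡.≡-Reasoning

V-1 : ∀ n → V 1 n ≡ (1ℚ + ι n) * E n
V-1 n = begin
  V 1 n                                             ≡⟨ solve 2 (λ a b → a := con 0ℚ :* b :+ a) refl (V 1 n) (V 2 n) ⟩
  0ℚ * V 2 n + V 1 n                                ≡⟨ cong (λ x → x * V 2 n + V 1 n) ι-zero ⟨
  ι 0 * V 2 n + V 1 n                               ≡⟨ cong (_+ V 1 n) (V-recurrence 0 n) ⟩
  (ι 0 - 1ℚ) * V 1 n + (1ℚ + ι n) * E n + V 1 n     ≡⟨ cong (λ x → (x - 1ℚ) * V 1 n + (1ℚ + ι n) * E n + V 1 n) ι-zero ⟩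
  (0ℚ - 1ℚ) * V 1 n + (1ℚ + ι n) * E n + V 1 n      ≡⟨ solve 2 (λ a b → (con 0ℚ :- con 1ℚ) :* a :+ b :+ a := b) refl (V 1 n) ((1ℚ + ι n) * E n) ⟩
  (1ℚ + ι n) * E n                                  ∎
  where open ≡.≡-Reasoning

V-next : ∀ k n → V (3 ℕ.+ k) n ≡ recip k * ((ι (suc k) - 1ℚ) * V (2 ℕ.+ k) n + (1ℚ + ι n) * V (suc k) n)
V-next k n = trans (sym unit) (cong (recip k *_) (V-recurrence (suc k) n))
  where
  unit : recip k * (ι (suc k) * V (3 ℕ.+ k) n) ≡ V (3 ℕ.+ k) n
  unit = trans (sym (ℚP.*-assoc (recip k) (ι (suc k)) _)) (trans (cong (_* V (3 ℕ.+ k) n) (recip-* k)) (ℚP.*-identityˡ _))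

combination : ℕ → Poly → Series
combination k []      = 𝟘
combination k (a ∷ p) = scale a (V k) ⊕ combination (suc k) p

V⋆ev : ∀ k p → V k ⋆ ev p ≋ combination k p
V⋆ev k []      = HR.zeroʳ (V k)
V⋆ev k (a ∷ p) = begin
  V k ⋆ (C a ⊕ v ⋆ ev p)                 ≈⟨ S.solve 4 (λ e a v p → e S.:* (a S.:+ v S.:* p) S.:= a S.:* e S.:+ (v S.:* e) S.:* p)
                                              HR.refl (V k) (C a) v (ev p) ⟩
  C a ⋆ V k ⊕ V (suc k) ⋆ ev p           ≈⟨ HR.+-cong (C-⋆ a (V k)) (V⋆ev (suc k) p) ⟩
  scale a (V k) ⊕ combination (suc k) p  ∎
  where open ≋-Reasoning

P₁-value : ∀ n → P 1 n ≡ combination 0 g₁ n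
P₁-value n = trans (Represents.value-as-E⋆ev P₁-represented n) (V⋆ev 0 g₁ n)

P₃-value : ∀ n → P 3 n ≡ combination 0 g₃ n
P₃-value n = trans (Represents.value-as-E⋆ev P₃-represented n) (V⋆ev 0 g₃ n)

-- w3, …, w8 are V 3 n, …, V 8 n in terms of N = n + 1, a = V 1 n and b = V 2 n.
module _ (N a b : ℚ) where
  w3 : ℚ
  w3 = + 1 / 1 * ((+ 1 / 1 - 1ℚ) * b + N * a)
  w4 : ℚ
  w4 = + 1 / 2 * ((+ 2 / 1 - 1ℚ) * w3 + N * b)
  w5 : ℚ
  w5 = + 1 / 3 * ((+ 3 / 1 - 1ℚ) * w4 + N * w3)
  w6 : ℚ
  w6 = + 1 / 4 * ((+ 4 / 1 - 1ℚ) * w5 + N * w4)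
  w7 : ℚ
  w7 = + 1 / 5 * ((+ 5 / 1 - 1ℚ) * w6 + N * w5)
  w8 : ℚ
  w8 = + 1 / 6 * ((+ 6 / 1 - 1ℚ) * w7 + N * w6)

V-3 : ∀ n → V 3 n ≡ w3 (1ℚ + ι n) (V 1 n) (V 2 n)
V-3 n = trans (V-next 0 n) (cong (recip 0 *_) (cong₂ _+_
  (cong₂ _*_ (cong (_- 1ℚ) (ι-/1 1)) refl) (cong ((1ℚ + ι n) *_) refl)))

V-4 : ∀ n → V 4 n ≡ w4 (1ℚ + ι n) (V 1 n) (V 2 n)
V-4 n = trans (V-next 1 n) (cong (recip 1 *_) (cong₂ _+_
  (cong₂ _*_ (cong (_- 1ℚ) (ι-/1 2)) (V-3 n)) (cong ((1ℚ + ι n) *_) refl)))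

V-5 : ∀ n → V 5 n ≡ w5 (1ℚ + ι n) (V 1 n) (V 2 n)
V-5 n = trans (V-next 2 n) (cong (recip 2 *_) (cong₂ _+_
  (cong₂ _*_ (cong (_- 1ℚ) (ι-/1 3)) (V-4 n)) (cong ((1ℚ + ι n) *_) (V-3 n))))

V-6 : ∀ n → V 6 n ≡ w6 (1ℚ + ι n) (V 1 n) (V 2 n)
V-6 n = trans (V-next 3 n) (cong (recip 3 *_) (cong₂ _+_
  (cong₂ _*_ (cong (_- 1ℚ) (ι-/1 4)) (V-5 n)) (cong ((1ℚ + ι n) *_) (V-4 n))))

V-7 : ∀ n → V 7 n ≡ w7 (1ℚ + ι n) (V 1 n) (V 2 n)
V-7 n = trans (V-next 4 n) (cong (recip 4 *_) (cong₂ _+_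
  (cong₂ _*_ (cong (_- 1ℚ) (ι-/1 5)) (V-6 n)) (cong ((1ℚ + ι n) *_) (V-5 n))))

V-8 : ∀ n → V 8 n ≡ w8 (1ℚ + ι n) (V 1 n) (V 2 n)
V-8 n = trans (V-next 5 n) (cong (recip 5 *_) (cong₂ _+_
  (cong₂ _*_ (cong (_- 1ℚ) (ι-/1 6)) (V-7 n)) (cong ((1ℚ + ι n) *_) (V-6 n))))

closed-f closed-g : ℚ → ℚ
closed-f x = - (+ 175 / 192) * (x * x * x * x) + - (+ 283 / 192) * (x * x * x) + + 199 / 192 * (x * x) + + 259 / 192 * x
closed-g x = + 15 / 32 * (x * x * x) + + 521 / 96 * (x * x) + + 1219 / 96 * x + + 743 / 96

-- Both sides are linear in e and b with coefficients in ℚ[x]. The factor of b on the left is half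
-- of `closed-g`, which fixes the multiple of the first moment; `closed-f` collects what then
-- remains of e.
combination₃-closed : ∀ x e b →
  ((+ 1 / 4) * e + ((+ 1 / 8) * ((1ℚ + x) * e) + (0ℚ * b + ((- (+ 23 / 8)) * w3 (1ℚ + x) ((1ℚ + x) * e) b + ((+ 21 / 2) * w4 (1ℚ + x) ((1ℚ + x) * e) b + ((- (+ 261 / 8)) * w5 (1ℚ + x) ((1ℚ + x) * e) b + ((+ 54 / 1) * w6 (1ℚ + x) ((1ℚ + x) * e) b + ((- (+ 325 / 8)) * w7 (1ℚ + x) ((1ℚ + x) * e) b + ((+ 45 / 4) * w8 (1ℚ + x) ((1ℚ + x) * e) b + 0ℚ)))))))))
    ≡ closed-f x * e + closed-g x * ((+ 1 / 2) * e + ((- (+ 1 / 1)) * ((1ℚ + x) * e) + ((+ 1 / 2) * b + 0ℚ)))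
combination₃-closed = solve 3 (λ x e b →
  (con (+ 1 / 4) :* e :+ (con (+ 1 / 8) :* ((con 1ℚ :+ x) :* e) :+ (con 0ℚ :* b :+ (con (- (+ 23 / 8)) :* (con (+ 1 / 1) :* ((con (+ 1 / 1) :- con 1ℚ) :* b :+ (con 1ℚ :+ x) :* ((con 1ℚ :+ x) :* e))) :+ (con (+ 21 / 2) :* (con (+ 1 / 2) :* ((con (+ 2 / 1) :- con 1ℚ) :* (con (+ 1 / 1) :* ((con (+ 1 / 1) :- con 1ℚ) :* b :+ (con 1ℚ :+ x) :* ((con 1ℚ :+ x) :* e))) :+ (con 1ℚ :+ x) :* b)) :+ (con (- (+ 261 / 8)) :* (con (+ 1 / 3) :* ((con (+ 3 / 1) :- con 1ℚ) :* (con (+ 1 / 2) :* ((con (+ 2 / 1) :- con 1ℚ) :* (con (+ 1 / 1) :* ((con (+ 1 / 1) :- con 1ℚ) :* b :+ (con 1ℚ :+ x) :* ((con 1ℚ :+ x) :* e))) :+ (con 1ℚ :+ x) :* b)) :+ (con 1ℚ :+ x) :* (con (+ 1 / 1) :* ((con (+ 1 / 1) :- con 1ℚ) :* b :+ (con 1ℚ :+ x) :* ((con 1ℚ :+ x) :* e))))) :+ (con (+ 54 / 1) :* (con (+ 1 / 4) :* ((con (+ 4 / 1) :- con 1ℚ) :* (con (+ 1 / 3) :* ((con (+ 3 / 1) :- con 1ℚ) :* (con (+ 1 / 2) :* ((con (+ 2 / 1) :- con 1ℚ) :* (con (+ 1 / 1) :* ((con (+ 1 / 1) :- con 1ℚ)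 :* b :+ (con 1ℚ :+ x) :* ((con 1ℚ :+ x) :* e))) :+ (con 1ℚ :+ x) :* b)) :+ (con 1ℚ :+ x) :* (con (+ 1 / 1) :* ((con (+ 1 / 1) :- con 1ℚ) :* b :+ (con 1ℚ :+ x) :* ((con 1ℚ :+ x) :* e))))) :+ (con 1ℚ :+ x) :* (con (+ 1 / 2) :* ((con (+ 2 / 1) :- con 1ℚ) :* (con (+ 1 / 1) :* ((con (+ 1 / 1) :- con 1ℚ) :* b :+ (con 1ℚ :+ x) :* ((con 1ℚ :+ x) :* e))) :+ (con 1ℚ :+ x) :* b)))) :+ (con (- (+ 325 / 8)) :* (con (+ 1 / 5) :* ((con (+ 5 / 1) :- con 1ℚ) :* (con (+ 1 / 4) :* ((con (+ 4 / 1) :- con 1ℚ) :* (con (+ 1 / 3) :* ((con (+ 3 / 1) :- con 1ℚ) :* (con (+ 1 / 2) :* ((con (+ 2 / 1) :- con 1ℚ) :* (con (+ 1 / 1) :* ((con (+ 1 / 1) :- con 1ℚ) :* b :+ (con 1ℚ :+ x) :* ((con 1ℚ :+ x) :* e))) :+ (con 1ℚ :+ x) :* b)) :+ (con 1ℚ :+ x) :* (con (+ 1 / 1) :* ((con (+ 1 / 1) :- con 1ℚ) :* b :+ (con 1ℚ :+ x) :* ((con 1ℚ :+ x) :* e))))) :+ (con 1ℚ :+ x) :* (con (+ 1 / 2) :* ((con (+ 2 / 1) :- con 1ℚ) :* (con (+ 1 / 1) :* ((con (+ 1 / 1) :- con 1ℚ) :* b :+ (con 1ℚ :+ x) :* ((con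 1ℚ :+ x) :* e))) :+ (con 1ℚ :+ x) :* b)))) :+ (con 1ℚ :+ x) :* (con (+ 1 / 3) :* ((con (+ 3 / 1) :- con 1ℚ) :* (con (+ 1 / 2) :* ((con (+ 2 / 1) :- con 1ℚ) :* (con (+ 1 / 1) :* ((con (+ 1 / 1) :- con 1ℚ) :* b :+ (con 1ℚ :+ x) :* ((con 1ℚ :+ x) :* e))) :+ (con 1ℚ :+ x) :* b)) :+ (con 1ℚ :+ x) :* (con (+ 1 / 1) :* ((con (+ 1 / 1) :- con 1ℚ) :* b :+ (con 1ℚ :+ x) :* ((con 1ℚ :+ x) :* e))))))) :+ (con (+ 45 / 4) :* (con (+ 1 / 6) :* ((con (+ 6 / 1) :- con 1ℚ) :* (con (+ 1 / 5) :* ((con (+ 5 / 1) :- con 1ℚ) :* (con (+ 1 / 4) :* ((con (+ 4 / 1) :- con 1ℚ) :* (con (+ 1 / 3) :* ((con (+ 3 / 1) :- con 1ℚ) :* (con (+ 1 / 2) :* ((con (+ 2 / 1) :- con 1ℚ) :* (con (+ 1 / 1) :* ((con (+ 1 / 1) :- con 1ℚ) :* b :+ (con 1ℚ :+ x) :* ((con 1ℚ :+ x) :* e))) :+ (con 1ℚ :+ x) :* b)) :+ (con 1ℚ :+ x) :* (con (+ 1 / 1) :* ((con (+ 1 / 1) :- con 1ℚ) :* b :+ (con 1ℚ :+ x) :* ((con 1ℚ :+ x) :* e))))) :+ (con 1ℚ :+ x) :* (con (+ 1 / 2) :* ((con (+ 2 / 1) :- con 1ℚ) :* (con (+ 1 /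 1) :* ((con (+ 1 / 1) :- con 1ℚ) :* b :+ (con 1ℚ :+ x) :* ((con 1ℚ :+ x) :* e))) :+ (con 1ℚ :+ x) :* b)))) :+ (con 1ℚ :+ x) :* (con (+ 1 / 3) :* ((con (+ 3 / 1) :- con 1ℚ) :* (con (+ 1 / 2) :* ((con (+ 2 / 1) :- con 1ℚ) :* (con (+ 1 / 1) :* ((con (+ 1 / 1) :- con 1ℚ) :* b :+ (con 1ℚ :+ x) :* ((con 1ℚ :+ x) :* e))) :+ (con 1ℚ :+ x) :* b)) :+ (con 1ℚ :+ x) :* (con (+ 1 / 1) :* ((con (+ 1 / 1) :- con 1ℚ) :* b :+ (con 1ℚ :+ x) :* ((con 1ℚ :+ x) :* e))))))) :+ (con 1ℚ :+ x) :* (con (+ 1 / 4) :* ((con (+ 4 / 1) :- con 1ℚ) :* (con (+ 1 / 3) :* ((con (+ 3 / 1) :- con 1ℚ) :* (con (+ 1 / 2) :* ((con (+ 2 / 1) :- con 1ℚ) :* (con (+ 1 / 1) :* ((con (+ 1 / 1) :- con 1ℚ) :* b :+ (con 1ℚ :+ x) :* ((con 1ℚ :+ x) :* e))) :+ (con 1ℚ :+ x) :* b)) :+ (con 1ℚ :+ x) :* (con (+ 1 / 1) :* ((con (+ 1 / 1) :- con 1ℚ) :* b :+ (con 1ℚ :+ x) :* ((con 1ℚ :+ x) :* e))))) :+ (con 1ℚ :+ x) :* (con (+ 1 / 2) :* ((con (+ 2 / 1) :- con 1ℚ) :* (con (+ 1 / 1) :* ((con (+ 1 / 1) :- con 1ℚ)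 :* b :+ (con 1ℚ :+ x) :* ((con 1ℚ :+ x) :* e))) :+ (con 1ℚ :+ x) :* b)))))) :+ con 0ℚ)))))))))
    := (con (- (+ 175 / 192)) :* (x :* x :* x :* x) :+ con (- (+ 283 / 192)) :* (x :* x :* x) :+ con (+ 199 / 192) :* (x :* x) :+ con (+ 259 / 192) :* x) :* e
     :+ (con (+ 15 / 32) :* (x :* x :* x) :+ con (+ 521 / 96) :* (x :* x) :+ con (+ 1219 / 96) :* x :+ con (+ 743 / 96))
       :* (con (+ 1 / 2) :* e :+ (con (- (+ 1 / 1)) :* ((con 1ℚ :+ x) :* e) :+ (con (+ 1 / 2) :* b :+ con 0ℚ)))) refl

P₃-closed : ∀ n → P 3 n ≡ closed-f (ι n) * E n + closed-g (ι n) * P 1 n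
P₃-closed n = begin
  P 3 n
    ≡⟨ P₃-value n ⟩
  ((+ 1 / 4) * E n + ((+ 1 / 8) * V 1 n + (0ℚ * V 2 n + ((- (+ 23 / 8)) * V 3 n + ((+ 21 / 2) * V 4 n + ((- (+ 261 / 8)) * V 5 n + ((+ 54 / 1) * V 6 n + ((- (+ 325 / 8)) * V 7 n + ((+ 45 / 4) * V 8 n + 0ℚ)))))))))
    ≡⟨ cong (_+_ (+ 1 / 4 * E n)) (cong (λ r → + 1 / 8 * V 1 n + (0ℚ * V 2 n + r)) 
         (cong₂ _+_ (cong (- (+ 23 / 8) *_) (V-3 n)) (cong₂ _+_ (cong (+ 21 / 2 *_) (V-4 n)) (cong₂ _+_ (cong (- (+ 261 / 8) *_) (V-5 n)) (cong₂ _+_ (cong (+ 54 / 1 *_) (V-6 n)) (cong₂ _+_ (cong (- (+ 325 / 8) *_) (V-7 n)) (cong (λ y → + 45 / 4 * y + 0ℚ) (V-8 n)))))))) ⟩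
  value₃ (V 1 n)
    ≡⟨ cong value₃ (V-1 n) ⟩
  value₃ ((1ℚ + ι n) * E n)
    ≡⟨ combination₃-closed (ι n) (E n) (V 2 n) ⟩
  closed-f (ι n) * E n + closed-g (ι n) * value₁ ((1ℚ + ι n) * E n)
    ≡⟨ cong (λ y → closed-f (ι n) * E n + closed-g (ι n) * value₁ y) (V-1 n) ⟨
  closed-f (ι n) * E n + closed-g (ι n) * value₁ (V 1 n)
    ≡⟨ cong (λ y → closed-f (ι n) * E n + closed-g (ι n) * y) (P₁-value n) ⟨
  closed-f (ι n) * E n + closed-g (ι n) * P 1 n ∎
  where
  open ≡.≡-Reasoning
  value₁ value₃ : ℚ → ℚ
  value₁ a = ((+ 1 / 2) * E n + ((- (+ 1 / 1)) * a + ((+ 1 / 2) * V 2 n + 0ℚ)))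
  value₃ a = ((+ 1 / 4) * E n + ((+ 1 / 8) * a + (0ℚ * V 2 n + ((- (+ 23 / 8)) * w3 (1ℚ + ι n) a (V 2 n) + ((+ 21 / 2) * w4 (1ℚ + ι n) a (V 2 n) + ((- (+ 261 / 8)) * w5 (1ℚ + ι n) a (V 2 n) + ((+ 54 / 1) * w6 (1ℚ + ι n) a (V 2 n) + ((- (+ 325 / 8)) * w7 (1ℚ + ι n) a (V 2 n) + ((+ 45 / 4) * w8 (1ℚ + ι n) a (V 2 n) + 0ℚ)))))))))

-- Coefficients of powers of `E`

Epow : ℕ → Series
Epow zero    = 𝟙
Epow (suc x) = E ⋆ Epow x

Dτ : D τ ≋ E ⋆ v
Dτ = X-injective (begin
  X (D τ)     ≈⟨ XD τ ⟩
  θ τ         ≈⟨ τ⋆v ⟨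
  X E ⋆ v     ≈⟨ X-⋆ E v ⟩
  X (E ⋆ v)   ∎)
  where open ≋-Reasoning

D-Epow : ∀ x → D (Epow x) ≋ C (ι x) ⋆ (Epow (suc x) ⋆ v)
D-Epow zero    n = sym (trans (C-⋆ (ι 0) (Epow 1 ⋆ v) n) (trans (cong (_* (Epow 1 ⋆ v) n) ι-zero) (ℚP.*-zeroˡ ((Epow 1 ⋆ v) n))))
D-Epow (suc x) = begin
  D (E ⋆ Epow x)
    ≈⟨ D-⋆ E (Epow x) ⟩
  D E ⋆ Epow x ⊕ E ⋆ D (Epow x)
    ≈⟨ HR.+-cong (HR.*-congʳ {x = Epow x} (HR.trans P₀-equation (HR.*-congʳ {x = E} Dτ))) (HR.*-congˡ {x = E} (D-Epow x)) ⟩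
  E ⋆ v ⋆ E ⋆ Epow x ⊕ E ⋆ (C (ι x) ⋆ (E ⋆ Epow x ⋆ v))
    ≈⟨ S.solve 4 (λ e v p c → e S.:* v S.:* e S.:* p S.:+ e S.:* (c S.:* (e S.:* p S.:* v))
         S.:= (S.con 1ℚ S.:+ c) S.:* (e S.:* (e S.:* p) S.:* v)) HR.refl E v (Epow x) (C (ι x)) ⟩
  (C 1ℚ ⊕ C (ι x)) ⋆ (Epow (suc (suc x)) ⋆ v)
    ≈⟨ HR.*-congʳ {x = Epow (suc (suc x)) ⋆ v} C-suc ⟨
  C (ι (suc x)) ⋆ (Epow (suc (suc x)) ⋆ v) ∎
  where
  open ≋-Reasoning
  C-suc : C (ι (suc x)) ≋ C 1ℚ ⊕ C (ι x)
  C-suc zero    = ι-suc x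
  C-suc (suc n) = refl

-- The relation v = 1 + τ v with τ = t E: a factor v is removed, or else t is split off and the
-- exponent x grows by one.
⋆v : ∀ x g → Epow x ⋆ v ⋆ g ≋ Epow x ⋆ g ⊕ X (Epow (suc x) ⋆ v ⋆ g)
⋆v x g = begin
  Epow x ⋆ (𝟙 ⊕ θ τ) ⋆ g
    ≈⟨ HR.*-congʳ {x = g} (HR.*-congˡ {x = Epow x} (HR.+-congˡ {x = 𝟙} τ⋆v)) ⟨
  Epow x ⋆ (𝟙 ⊕ τ ⋆ v) ⋆ g
    ≈⟨ S.solve 4 (λ p t v g → p S.:* (S.con 1ℚ S.:+ t S.:* v) S.:* g S.:= p S.:* g S.:+ t S.:* (p S.:* v S.:* g))
         HR.refl (Epow x) τ v g ⟩
  Epow x ⋆ g ⊕ X E ⋆ (Epow x ⋆ v ⋆ g)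
    ≈⟨ HR.+-congˡ {x = Epow x ⋆ g} (X-⋆ E (Epow x ⋆ v ⋆ g)) ⟩
  Epow x ⋆ g ⊕ X (E ⋆ (Epow x ⋆ v ⋆ g))
    ≈⟨ HR.+-congˡ {x = Epow x ⋆ g} (X-cong (S.solve 4 (λ e p v g → e S.:* (p S.:* v S.:* g) S.:= e S.:* p S.:* v S.:* g)
         HR.refl E (Epow x) v g)) ⟩
  Epow x ⋆ g ⊕ X (Epow (suc x) ⋆ v ⋆ g) ∎
  where open ≋-Reasoning

Epow-zero : ∀ x → Epow x 0 ≡ 1ℚ
Epow-zero zero    = refl
Epow-zero (suc x) = cong (E 0 *_) (Epow-zero x)

-- Takes the place of Lagrange inversion. At n + 1 the derivative of E^x contributes x f and the
-- shifted term (n + 1) f, with the same coefficient f of E^(x+1) v. The exponent grows as n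
-- shrinks, so x + n stays fixed.
Epow⋆v : ∀ n x → (Epow x ⋆ v) n ≡ ι ((x ℕ.+ n) ℕ.^ n)
Epow⋆v n x = trans (HR.sym (HR.*-identityʳ (Epow x ⋆ v)) n) (trans (⋆v x 𝟙 n) (trans
  (cong₂ _+_ (HR.*-identityʳ (Epow x) n) (X-cong (HR.*-identityʳ (Epow (suc x) ⋆ v)) n)) (value n)))
  where
  open ≡.≡-Reasoning
  value : ∀ n → Epow x n + X (Epow (suc x) ⋆ v) n ≡ ι ((x ℕ.+ n) ℕ.^ n)
  value zero    = trans (cong (_+ 0ℚ) (Epow-zero x)) (sym (ι-/1 1))
  value (suc n) = begin
    Epow x (suc n) + ι (suc n) * f              ≡⟨ cong (_+ ι (suc n) * f) (trans (D-Epow x n) (C-⋆ (ι x) _ n)) ⟩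
    ι x * f + ι (suc n) * f                     ≡⟨ ℚP.*-distribʳ-+ f (ι x) (ι (suc n)) ⟨
    (ι x + ι (suc n)) * f                       ≡⟨ cong₂ _*_ (sym (ι-+ x (suc n))) (Epow⋆v n (suc x)) ⟩
    ι (x ℕ.+ suc n) * ι ((suc x ℕ.+ n) ℕ.^ n)   ≡⟨ cong (λ y → ι (x ℕ.+ suc n) * ι (y ℕ.^ n)) (sym (ℕP.+-suc x n)) ⟩
    ι (x ℕ.+ suc n) * ι ((x ℕ.+ suc n) ℕ.^ n)   ≡⟨ ι-* (x ℕ.+ suc n) _ ⟨
    ι ((x ℕ.+ suc n) ℕ.^ suc n)                 ∎
    where f = (Epow (suc x) ⋆ v) n

-- n! times the sum of N ^ k / k! over k ≤ n
expSum : ℕ → ℕ → ℕ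
expSum N zero    = 1
expSum N (suc n) = N ℕ.^ suc n ℕ.+ suc n ℕ.* expSum N n

Epow⋆v⋆v : ∀ n x → (Epow x ⋆ v ⋆ v) n ≡ ι (expSum (x ℕ.+ n) n)
Epow⋆v⋆v n x = trans (⋆v x v n) (trans (cong (_+ X (Epow (suc x) ⋆ v ⋆ v) n) (Epow⋆v n x)) (value n))
  where
  open ≡.≡-Reasoning
  value : ∀ n → ι ((x ℕ.+ n) ℕ.^ n) + X (Epow (suc x) ⋆ v ⋆ v) n ≡ ι (expSum (x ℕ.+ n) n)
  value zero    = ℚP.+-identityʳ _
  value (suc n) = begin
    ι (N ℕ.^ suc n) + ι (suc n) * (Epow (suc x) ⋆ v ⋆ v) n   ≡⟨ cong (λ y → ι (N ℕ.^ suc n) + ι (suc n) * y) (Epow⋆v⋆v n (suc x)) ⟩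
    ι (N ℕ.^ suc n) + ι (suc n) * ι (expSum (suc x ℕ.+ n) n) ≡⟨ cong (λ y → ι (N ℕ.^ suc n) + ι (suc n) * ι (expSum y n)) (sym (ℕP.+-suc x n)) ⟩
    ι (N ℕ.^ suc n) + ι (suc n) * ι (expSum N n)             ≡⟨ cong (_+_ (ι (N ℕ.^ suc n))) (ι-* (suc n) _) ⟨
    ι (N ℕ.^ suc n) + ι (suc n ℕ.* expSum N n)               ≡⟨ ι-+ (N ℕ.^ suc n) _ ⟨
    ι (expSum N (suc n))                                     ∎
    where N = x ℕ.+ suc n

V₁-value : ∀ n → V 1 n ≡ ι (suc n ℕ.^ n)
V₁-value n = trans (S.solve 2 (λ v e → v S.:* e S.:= (e S.:* S.con 1ℚ) S.:* v) HR.refl v E n) (Epow⋆v n 1)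

V₂-value : ∀ n → V 2 n ≡ ι (expSum (suc n) n)
V₂-value n = trans (S.solve 2 (λ v e → v S.:* (v S.:* e) S.:= (e S.:* S.con 1ℚ) S.:* v S.:* v) HR.refl v E n) (Epow⋆v⋆v n 1)

-- There are (n + 1)^(n-1) parking functions; multiplying by n + 1 avoids the exponent n - 1 at n =
-- 0.
E-value : ∀ n → ι (suc n) * E n ≡ ι (suc n ℕ.^ n)
E-value n = trans (cong (_* E n) (ι-suc n)) (trans (sym (V-1 n)) (V₁-value n))

P₁-closed : ∀ n → P 1 n ≡ + 1 / 2 * ι (expSum (suc n) n) - (+ 1 / 2 + ι n) * E n
P₁-closed n = begin
  P 1 n                                                                  ≡⟨ P₁-value n ⟩
  + 1 / 2 * E n + (- (+ 1 / 1) * V 1 n + (+ 1 / 2 * V 2 n + 0ℚ))         ≡⟨ cong₂ (λ x y → + 1 / 2 * E n + (- (+ 1 / 1) * x + (+ 1 / 2 * y + 0ℚ))) (V-1 n) (V₂-value n) ⟩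
  + 1 / 2 * E n + (- (+ 1 / 1) * ((1ℚ + ι n) * E n) + (+ 1 / 2 * ι (expSum (suc n) n) + 0ℚ))
    ≡⟨ solve 3 (λ e x y → con (+ 1 / 2) :* e :+ (con (- (+ 1 / 1)) :* ((con 1ℚ :+ x) :* e) :+ (con (+ 1 / 2) :* y :+ con 0ℚ))
         := con (+ 1 / 2) :* y :- (con (+ 1 / 2) :+ x) :* e) refl (E n) (ι n) (ι (expSum (suc n) n)) ⟩
  + 1 / 2 * ι (expSum (suc n) n) - (+ 1 / 2 + ι n) * E n                 ∎
  where open ≡.≡-Reasoning

fraction-* : ∀ i n .{{_ : ℕ.NonZero n}} → (i / n) * ι n ≡ i / 1
fraction-* i (suc d) = trans (cong ((i / suc d) *_) (ι-/1 (suc d))) (ℚP.toℚᵘ-injective (begin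
  ℚ.toℚᵘ ((i / suc d) * (+ suc d / 1))            ≈⟨ ℚP.toℚᵘ-homo-* (i / suc d) (+ suc d / 1) ⟩
  ℚ.toℚᵘ (i / suc d) ℚᵘ.* ℚ.toℚᵘ (+ suc d / 1)    ≈⟨ ℚᵘP.*-cong (ℚP.toℚᵘ-fromℚᵘ (ℚᵘ.mkℚᵘ i d)) (ℚP.toℚᵘ-fromℚᵘ (ℚᵘ.mkℚᵘ (+ suc d) 0)) ⟩
  ℚᵘ.mkℚᵘ i d ℚᵘ.* ℚᵘ.mkℚᵘ (+ suc d) 0            ≈⟨ ℚᵘ.*≡* (trans (ℤP.*-identityʳ _) (cong (i ℤ.*_) (cong +_ (sym (ℕP.*-identityʳ (suc d)))))) ⟩
  ℚᵘ.mkℚᵘ i 0                                     ≈⟨ ℚP.toℚᵘ-fromℚᵘ (ℚᵘ.mkℚᵘ i 0) ⟨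
  ℚ.toℚᵘ (i / 1)                                  ∎))
  where open ℚᵘP.≃-Reasoning

module WQ = WordSums ℚP.+-*-commutativeRing
module NS = Data.Nat.Solver.+-*-Solver

-- The third moment

sum-upTo-suc : ∀ (f : ℕ → ℚ) n → sumℚ (map f (upTo (suc n))) ≡ sumℚ (map f (upTo n)) + f n
sum-upTo-suc f n = begin
  sumℚ (map f (upTo (suc n)))                   ≡⟨ cong (λ xs → sumℚ (map f xs)) (upTo-∷ʳ n) ⟨
  sumℚ (map f (upTo n ++ n ∷ []))               ≡⟨ WQ.sum-++ f (upTo n) (n ∷ []) ⟩
  sumℚ (map f (upTo n)) + (f n + 0ℚ)            ≡⟨ cong (_+_ (sumℚ (map f (upTo n)))) (ℚP.+-identityʳ (f n)) ⟩
  sumℚ (map f (upTo n)) + f n                   ∎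
  where open ≡.≡-Reasoning

expTerm : ℕ → ℕ → ℚ
expTerm N k = _/_ (+ (N ℕ.^ k)) (k !) {{k ℕP.!≢0}}

expTerm-* : ∀ N k → ι (k !) * expTerm N k ≡ ι (N ℕ.^ k)
expTerm-* N k = trans (ℚP.*-comm (ι (k !)) (expTerm N k))
  (trans (fraction-* (+ (N ℕ.^ k)) (k !) {{k ℕP.!≢0}}) (sym (ι-/1 (N ℕ.^ k))))

expSum-value : ∀ N n → ι (n !) * sumℚ (map (expTerm N) (upTo (suc n))) ≡ ι (expSum N n)
expSum-value N zero    = trans (cong (_* (1ℚ + 0ℚ)) (ι-/1 1)) (sym (ι-/1 1))
expSum-value N (suc n) = begin
  ι (suc n !) * sumℚ (map (expTerm N) (upTo (suc (suc n))))
    ≡⟨ cong (ι (suc n !) *_) (sum-upTo-suc (expTerm N) (suc n)) ⟩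
  ι (suc n !) * (w + expTerm N (suc n))
    ≡⟨ ℚP.*-distribˡ-+ (ι (suc n !)) w (expTerm N (suc n)) ⟩
  ι (suc n !) * w + ι (suc n !) * expTerm N (suc n)
    ≡⟨ cong₂ _+_ (trans (cong (_* w) (ι-* (suc n) (n !))) (ℚP.*-assoc (ι (suc n)) (ι (n !)) w)) (expTerm-* N (suc n)) ⟩
  ι (suc n) * (ι (n !) * w) + ι (N ℕ.^ suc n)
    ≡⟨ cong (λ y → ι (suc n) * y + ι (N ℕ.^ suc n)) (expSum-value N n) ⟩
  ι (suc n) * ι (expSum N n) + ι (N ℕ.^ suc n)
    ≡⟨ cong (_+ ι (N ℕ.^ suc n)) (ι-* (suc n) (expSum N n)) ⟨
  ι (suc n ℕ.* expSum N n) + ι (N ℕ.^ suc n)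
    ≡⟨ ℚP.+-comm _ (ι (N ℕ.^ suc n)) ⟩
  ι (N ℕ.^ suc n) + ι (suc n ℕ.* expSum N n)
    ≡⟨ ι-+ (N ℕ.^ suc n) _ ⟨
  ι (expSum N (suc n)) ∎
  where
  open ≡.≡-Reasoning
  w = sumℚ (map (expTerm N) (upTo (suc n)))

half : ∀ n → + n / 2 ≡ + 1 / 2 * ι n
half n = begin
  + n / 2                        ≡⟨ solve 1 (λ y → y := con (+ 1 / 2) :* (y :* con (+ 2 / 1))) refl (+ n / 2) ⟩
  + 1 / 2 * (+ n / 2 * (+ 2 / 1))  ≡⟨ cong (λ z → + 1 / 2 * (+ n / 2 * z)) (ι-/1 2) ⟨
  + 1 / 2 * (+ n / 2 * ι 2)      ≡⟨ cong (+ 1 / 2 *_) (trans (fraction-* (+ n) 2) (sym (ι-/1 n))) ⟩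
  + 1 / 2 * ι n                  ∎
  where open ≡.≡-Reasoning

E1-* : ∀ n → E1 n * E n ≡ P 1 n
E1-* n = trans (cong (λ z → (- z + + 1 / 2 * F * w) * E n) (half n)) (begin
  (- (+ 1 / 2 * ι n) + + 1 / 2 * F * w) * E n
    ≡⟨ solve 4 (λ x F w e → (:- (con (+ 1 / 2) :* x) :+ con (+ 1 / 2) :* F :* w) :* e
         := :- (con (+ 1 / 2) :* x) :* e :+ con (+ 1 / 2) :* ((F :* e) :* w)) refl (ι n) F w (E n) ⟩
  - (+ 1 / 2 * ι n) * E n + + 1 / 2 * ((F * E n) * w)
    ≡⟨ cong (λ y → - (+ 1 / 2 * ι n) * E n + + 1 / 2 * (y * w)) F*E ⟩
  - (+ 1 / 2 * ι n) * E n + + 1 / 2 * (ι (n !) * w)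
    ≡⟨ cong (λ y → - (+ 1 / 2 * ι n) * E n + + 1 / 2 * y) n!*w ⟩
  - (+ 1 / 2 * ι n) * E n + + 1 / 2 * (ι (expSum (suc n) n) - (1ℚ + ι n) * E n)
    ≡⟨ solve 3 (λ x e s → :- (con (+ 1 / 2) :* x) :* e :+ con (+ 1 / 2) :* (s :- (con 1ℚ :+ x) :* e)
         := con (+ 1 / 2) :* s :- (con (+ 1 / 2) :+ x) :* e) refl (ι n) (E n) (ι (expSum (suc n) n)) ⟩
  + 1 / 2 * ι (expSum (suc n) n) - (+ 1 / 2 + ι n) * E n
    ≡⟨ P₁-closed n ⟨
  P 1 n ∎)
  where
  open ≡.≡-Reasoning
  F = _/_ (+ (suc n !)) (suc n ℕ.^ n) {{ℕP.m^n≢0 (suc n) n}}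
  w = sumℚ (map (expTerm (suc n)) (upTo n))
  F*E : F * E n ≡ ι (n !)
  F*E = ι-cancel n (begin
    ι (suc n) * (F * E n)      ≡⟨ solve 3 (λ i F e → i :* (F :* e) := F :* (i :* e)) refl (ι (suc n)) F (E n) ⟩
    F * (ι (suc n) * E n)      ≡⟨ cong (F *_) (E-value n) ⟩
    F * ι (suc n ℕ.^ n)        ≡⟨ trans (fraction-* (+ (suc n !)) (suc n ℕ.^ n) {{ℕP.m^n≢0 (suc n) n}}) (sym (ι-/1 (suc n !))) ⟩
    ι (suc n !)                ≡⟨ ι-* (suc n) (n !) ⟩
    ι (suc n) * ι (n !)        ∎)
  n!*w : ι (n !) * w ≡ ι (expSum (suc n) n) - (1ℚ + ι n) * E n
  n!*w = begin
    ι (n !) * w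
      -- The sum in `E1` stops at k = n - 1, whereas `expSum` includes k = n. The missing term
      -- contributes (n + 1)^n, which is (n + 1) E n.
      ≡⟨ solve 3 (λ a w t → a :* w := a :* (w :+ t) :- a :* t) refl (ι (n !)) w (expTerm (suc n) n) ⟩
    ι (n !) * (w + expTerm (suc n) n) - ι (n !) * expTerm (suc n) n
      ≡⟨ cong₂ _-_ (trans (cong (ι (n !) *_) (sym (sum-upTo-suc (expTerm (suc n)) n))) (expSum-value (suc n) n))
                   (trans (expTerm-* (suc n) n) (trans (sym (E-value n)) (cong (_* E n) (ι-suc n)))) ⟩
    ι (expSum (suc n) n) - (1ℚ + ι n) * E n ∎

sum-filterᵇ : ∀ {a} {A : Set a} (b : A → Bool) (f : A → ℚ) xs →
  sumℚ (map f (filterᵇ b xs)) ≡ sumℚ (map (λ x → if b x then f x else 0ℚ) xs)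
sum-filterᵇ b f []       = refl
sum-filterᵇ b f (x ∷ xs) with b x
... | true  = cong (_+_ (f x)) (sum-filterᵇ b f xs)
... | false = trans (sum-filterᵇ b f xs) (sym (ℚP.+-identityˡ _))

sum-coefficient : ∀ {a} {A : Set a} (F : A → Series) xs j →
  foldr _⊕_ 𝟘 (map F xs) j ≡ sumℚ (map (λ x → F x j) xs)
sum-coefficient F []       j = refl
sum-coefficient F (x ∷ xs) j = cong (_+_ (F x j)) (sum-coefficient F xs j)

-- The area of a parking function as an exponent of `q`

areaFrom : ℕ → List ℕ → ℕ
areaFrom i []       = 0
areaFrom i (y ∷ ys) = (i ∸ y) ℕ.+ areaFrom (suc i) ys

weight-value : ∀ i s j → AE.weight i s j ≡ (if boundedFrom i s then KR.pow (areaFrom i s) j else 0ℚ)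
weight-value i []       j = refl
weight-value i (y ∷ ys) j with y ≤ᵇ i
... | false = refl
... | true with boundedFrom (suc i) ys | weight-value (suc i) ys
... | true  | ih = trans (⋆-congˡ ih j) (sym (KR.pow-+ (i ∸ y) (areaFrom (suc i) ys) j))
  where
  ⋆-congˡ : ∀ {f g} → f ≋ g → KR.pow (i ∸ y) ⋆ f ≋ KR.pow (i ∸ y) ⋆ g
  ⋆-congˡ e = QS.⋆-cong {f = KR.pow (i ∸ y)} (λ _ → refl) e
... | false | ih = trans (QS.⋆-cong {f = KR.pow (i ∸ y)} {g' = 𝟘} (λ _ → refl) ih j) (HR.zeroʳ (KR.pow (i ∸ y)) j)

ramp : ℕ → ℕ → ℕ
ramp i zero    = 0
ramp i (suc l) = i ℕ.+ ramp (suc i) l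

-- The arithmetic series i + (i + 1) + ... + (i + l - 1), with l moved to the left so that no
-- subtraction occurs.
ramp-value : ∀ i l → 2 ℕ.* ramp i l ℕ.+ l ≡ l ℕ.* (i ℕ.+ i ℕ.+ l)
ramp-value i zero    = refl
ramp-value i (suc l) = begin
  2 ℕ.* (i ℕ.+ ramp (suc i) l) ℕ.+ suc l
    ≡⟨ NS.solve 3 (λ i r l → NS.con 2 NS.:* (i NS.:+ r) NS.:+ (NS.con 1 NS.:+ l)
         NS.:= (NS.con 2 NS.:* r NS.:+ l) NS.:+ (NS.con 2 NS.:* i NS.:+ NS.con 1)) refl i (ramp (suc i) l) l ⟩
  (2 ℕ.* ramp (suc i) l ℕ.+ l) ℕ.+ (2 ℕ.* i ℕ.+ 1)
    ≡⟨ cong (ℕ._+ (2 ℕ.* i ℕ.+ 1)) (ramp-value (suc i) l) ⟩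
  l ℕ.* (suc i ℕ.+ suc i ℕ.+ l) ℕ.+ (2 ℕ.* i ℕ.+ 1)
    ≡⟨ NS.solve 2 (λ i l → l NS.:* ((NS.con 1 NS.:+ i) NS.:+ (NS.con 1 NS.:+ i) NS.:+ l) NS.:+ (NS.con 2 NS.:* i NS.:+ NS.con 1)
         NS.:= (NS.con 1 NS.:+ l) NS.:* (i NS.:+ i NS.:+ (NS.con 1 NS.:+ l))) refl i l ⟩
  suc l ℕ.* (i ℕ.+ i ℕ.+ suc l) ∎
  where open ≡.≡-Reasoning

∧-true : ∀ a b → a ∧ b ≡ true → a ≡ true × b ≡ true
∧-true true true _ = refl , refl

≤ᵇ-true : ∀ m n → (m ≤ᵇ n) ≡ true → m ℕ.≤ n
≤ᵇ-true m n e = ℕP.≤ᵇ⇒≤ m n (subst Data.Bool.T (sym e) _)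

areaFrom-value : ∀ i s → boundedFrom i s ≡ true → areaFrom i s ℕ.+ sumℕ s ≡ ramp i (length s)
areaFrom-value i []       b = refl
areaFrom-value i (y ∷ ys) b = begin
  (i ∸ y) ℕ.+ areaFrom (suc i) ys ℕ.+ (y ℕ.+ sumℕ ys)
    ≡⟨ NS.solve 4 (λ d a y s → d NS.:+ a NS.:+ (y NS.:+ s) NS.:= (d NS.:+ y) NS.:+ (a NS.:+ s)) refl
         (i ∸ y) (areaFrom (suc i) ys) y (sumℕ ys) ⟩
  (i ∸ y ℕ.+ y) ℕ.+ (areaFrom (suc i) ys ℕ.+ sumℕ ys)
    ≡⟨ cong₂ ℕ._+_ (ℕP.m∸n+n≡m (≤ᵇ-true y i (proj₁ bs))) (areaFrom-value (suc i) ys (proj₂ bs)) ⟩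
  ramp i (suc (length ys)) ∎
  where
  open ≡.≡-Reasoning
  bs = ∧-true (y ≤ᵇ i) (boundedFrom (suc i) ys) b

Area-value : ∀ n p → length p ≡ n → isParkingᵇ p ≡ true → ι (areaFrom 1 (sort p)) ≡ Area n p
Area-value n p len b = begin
  ι a
    ≡⟨ solve 2 (λ a s → a := (a :+ s) :- s) refl (ι a) (ι (sumℕ p)) ⟩
  (ι a + ι (sumℕ p)) - ι (sumℕ p)
    ≡⟨ cong₂ _-_ triangular (ι-/1 (sumℕ p)) ⟩
  Area n p ∎
  where
  open ≡.≡-Reasoning
  a = areaFrom 1 (sort p)
  a+sum : a ℕ.+ sumℕ p ≡ ramp 1 n
  a+sum = trans (cong (a ℕ.+_) (sym (sum-↭ (sort-↭ p))))
    (trans (areaFrom-value 1 (sort p) b) (cong (ramp 1) (trans (↭-length (sort-↭ p)) len)))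
  doubled : 2 ℕ.* ramp 1 n ≡ n ℕ.* suc n
  doubled = ℕP.+-cancelʳ-≡ n (2 ℕ.* ramp 1 n) (n ℕ.* suc n) (trans (ramp-value 1 n)
    (NS.solve 1 (λ n → n NS.:* (NS.con 2 NS.:+ n) NS.:= n NS.:* (NS.con 1 NS.:+ n) NS.:+ n) refl n))
  triangular : ι a + ι (sumℕ p) ≡ + (n ℕ.* suc n) / 2
  triangular = begin
    ι a + ι (sumℕ p)               ≡⟨ ι-+ a (sumℕ p) ⟨
    ι (a ℕ.+ sumℕ p)               ≡⟨ cong ι a+sum ⟩
    ι (ramp 1 n)                   ≡⟨ solve 1 (λ r → r := con (+ 1 / 2) :* (con (+ 2 / 1) :* r)) refl (ι (ramp 1 n)) ⟩
    + 1 / 2 * (+ 2 / 1 * ι (ramp 1 n)) ≡⟨ cong (λ y → + 1 / 2 * (y * ι (ramp 1 n))) (ι-/1 2) ⟨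
    + 1 / 2 * (ι 2 * ι (ramp 1 n)) ≡⟨ cong (+ 1 / 2 *_) (trans (sym (ι-* 2 (ramp 1 n))) (cong ι doubled)) ⟩
    + 1 / 2 * ι (n ℕ.* suc n)      ≡⟨ half (n ℕ.* suc n) ⟨
    + (n ℕ.* suc n) / 2            ∎

P-value : ∀ j n → (∀ a → KR.pow a j ≡ falling (ι a) j) →
  P j n ≡ sumℚ (map (λ p → falling (Area n p) j) (ParkingFunctions n))
P-value j n pow-j = begin
  P j n
    ≡⟨ sum-coefficient (λ p → AE.weight 1 (sort p)) (candidates n n) j ⟩
  sumℚ (map (λ p → AE.weight 1 (sort p) j) (candidates n n))
    ≡⟨ WQ.sum-cong (All.map (λ {p} spec → local p (proj₁ spec)) (candidates-spec n n)) ⟩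
  sumℚ (map (λ p → if isParkingᵇ p then falling (Area n p) j else 0ℚ) (candidates n n))
    ≡⟨ sum-filterᵇ isParkingᵇ _ (candidates n n) ⟨
  sumℚ (map (λ p → falling (Area n p) j) (ParkingFunctions n)) ∎
  where
  open ≡.≡-Reasoning
  local : ∀ p → length p ≡ n → AE.weight 1 (sort p) j ≡ (if isParkingᵇ p then falling (Area n p) j else 0ℚ)
  local p len = trans (weight-value 1 (sort p) j) (branch (isParkingᵇ p) refl)
    where
    branch : ∀ b → isParkingᵇ p ≡ b →
      (if b then KR.pow (areaFrom 1 (sort p)) j else 0ℚ) ≡ (if b then falling (Area n p) j else 0ℚ)
    branch true  e = trans (pow-j (areaFrom 1 (sort p))) (cong (λ x → falling x j) (Area-value n p len e))
    branch false e = refl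

sum-ones : ∀ {a} {A : Set a} (xs : List A) → sumℚ (map (λ _ → 1ℚ) xs) ≡ ι (length xs)
sum-ones []       = sym ι-zero
sum-ones (x ∷ xs) = trans (cong (_+_ 1ℚ) (sum-ones xs)) (sym (ι-suc (length xs)))

E-length : ∀ n → E n ≡ ι (length (ParkingFunctions n))
E-length n = trans (P-value 0 n pow-0) (sum-ones (ParkingFunctions n))

ι≢0 : ∀ n → ι (suc n) ≡ 0ℚ → ⊥
ι≢0 n e with trans (sym (recip-* n)) (trans (cong (recip n *_) e) (ℚP.*-zeroʳ (recip n)))
... | ()

inv-* : ∀ m → (ι m ≡ 0ℚ → ⊥) → ι m * inv m ≡ 1ℚ
inv-* zero    m≢0 = ⊥-elim (m≢0 ι-zero)
inv-* (suc m) m≢0 = trans (ℚP.*-comm (ι (suc m)) (recip m)) (recip-* m)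

E-inverse : ∀ n → E n * inv (length (ParkingFunctions n)) ≡ 1ℚ
E-inverse n = trans (cong (_* inv (length (ParkingFunctions n))) (E-length n))
  (inv-* (length (ParkingFunctions n)) λ e →
    nonzero (suc n ℕ.^ n) {{ℕP.m^n≢0 (suc n) n}}
      (trans (sym (E-value n)) (trans (cong (ι (suc n) *_) (trans (E-length n) e)) (ℚP.*-zeroʳ (ι (suc n))))))
  where
  nonzero : ∀ m .{{_ : ℕ.NonZero m}} → ι m ≡ 0ℚ → ⊥
  nonzero (suc m) = ι≢0 m

M3-closed : ∀ n → M3 n ≡ closed-f (ι n) + closed-g (ι n) * E1 n
M3-closed n = begin
  M3 n                                                             ≡⟨ cong (_* i) (P-value 3 n pow-3) ⟨
  P 3 n * i                                                        ≡⟨ cong (_* i) (P₃-closed n) ⟩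
  (closed-f (ι n) * E n + closed-g (ι n) * P 1 n) * i              ≡⟨ cong (λ y → (closed-f (ι n) * E n + closed-g (ι n) * y) * i) (E1-* n) ⟨
  (closed-f (ι n) * E n + closed-g (ι n) * (E1 n * E n)) * i
    ≡⟨ solve 5 (λ f g e u i → (f :* e :+ g :* (u :* e)) :* i := (f :+ g :* u) :* (e :* i)) refl
         (closed-f (ι n)) (closed-g (ι n)) (E n) (E1 n) i ⟩
  (closed-f (ι n) + closed-g (ι n) * E1 n) * (E n * i)             ≡⟨ cong ((closed-f (ι n) + closed-g (ι n) * E1 n) *_) (E-inverse n) ⟩
  (closed-f (ι n) + closed-g (ι n) * E1 n) * 1ℚ                    ≡⟨ ℚP.*-identityʳ _ ⟩
  closed-f (ι n) + closed-g (ι n) * E1 n                           ∎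
  where
  open ≡.≡-Reasoning
  i = inv (length (ParkingFunctions n))

power : ℚ → ℕ → ℚ
power x zero    = 1ℚ
power x (suc k) = x * power x k

ι-^ : ∀ n k → ι (n ℕ.^ k) ≡ power (ι n) k
ι-^ n zero    = ι-/1 1
ι-^ n (suc k) = trans (ι-* n (n ℕ.^ k)) (cong (ι n *_) (ι-^ n k))

power-/1 : ∀ n k → + (n ℕ.^ k) / 1 ≡ power (ι n) k
power-/1 n k = trans (sym (ι-/1 (n ℕ.^ k))) (ι-^ n k)

third-moment : ∀ n → M3 n ≡
  (-[1+ 174 ] / 192) * ((+ (n ℕ.^ 4)) / 1)
  + (-[1+ 282 ] / 192) * ((+ (n ℕ.^ 3)) / 1)
  + ((+ 199) / 192) * ((+ (n ℕ.^ 2)) / 1)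
  + ((+ 259) / 192) * ((+ n) / 1)
  + ( ((+ 15) / 32) * ((+ (n ℕ.^ 3)) / 1)
    + ((+ 521) / 96) * ((+ (n ℕ.^ 2)) / 1)
    + ((+ 1219) / 96) * ((+ n) / 1)
    + ((+ 743) / 96) ) * E1 n
third-moment n = trans (M3-closed n) (trans (expand (ι n) (E1 n)) (sym
  (trans (cong₂ (λ a b → formula a b ((+ (n ℕ.^ 2)) / 1) ((+ n) / 1)) (power-/1 n 4) (power-/1 n 3))
         (cong₂ (formula (power (ι n) 4) (power (ι n) 3)) (power-/1 n 2) (sym (ι-/1 n))))))
  where
  formula : ℚ → ℚ → ℚ → ℚ → ℚ
  formula n⁴ n³ n² n¹ = (-[1+ 174 ] / 192) * n⁴ + (-[1+ 282 ] / 192) * n³ + ((+ 199) / 192) * n² + ((+ 259) / 192) * n¹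
    + ( ((+ 15) / 32) * n³ + ((+ 521) / 96) * n² + ((+ 1219) / 96) * n¹ + ((+ 743) / 96) ) * E1 n
  expand : ∀ x u → closed-f x + closed-g x * u ≡
    (-[1+ 174 ] / 192) * power x 4 + (-[1+ 282 ] / 192) * power x 3 + ((+ 199) / 192) * power x 2 + ((+ 259) / 192) * x
    + ( ((+ 15) / 32) * power x 3 + ((+ 521) / 96) * power x 2 + ((+ 1219) / 96) * x + ((+ 743) / 96) ) * u
  expand = solve 2 (λ x u →
    con (- (+ 175 / 192)) :* (x :* x :* x :* x) :+ con (- (+ 283 / 192)) :* (x :* x :* x) :+ con (+ 199 / 192) :* (x :* x) :+ con (+ 259 / 192) :* x
    :+ (con (+ 15 / 32) :* (x :* x :* x) :+ con (+ 521 / 96) :* (x :* x) :+ con (+ 1219 / 96) :* x :+ con (+ 743 / 96)) :* u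
    := con (-[1+ 174 ] / 192) :* (x :* (x :* (x :* (x :* con 1ℚ)))) :+ con (-[1+ 282 ] / 192) :* (x :* (x :* (x :* con 1ℚ)))
       :+ con (+ 199 / 192) :* (x :* (x :* con 1ℚ)) :+ con (+ 259 / 192) :* x
       :+ (con (+ 15 / 32) :* (x :* (x :* (x :* con 1ℚ))) :+ con (+ 521 / 96) :* (x :* (x :* con 1ℚ)) :+ con (+ 1219 / 96) :* x :+ con (+ 743 / 96)) :* u) refl

-- A damped Leibniz series

0≤+ : ∀ {x y} → 0ℚ ≤ x → 0ℚ ≤ y → 0ℚ ≤ x + y
0≤+ = ℚP.+-mono-≤

0≤* : ∀ {x y} → 0ℚ ≤ x → 0ℚ ≤ y → 0ℚ ≤ x * y
0≤* {x} {y} p q = subst (_≤ x * y) (ℚP.*-zeroˡ y) (ℚP.*-monoʳ-≤-nonNeg y {{ℚ.nonNegative q}} p)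

0≤ι : ∀ n → 0ℚ ≤ ι n
0≤ι zero    = ℚP.≤-reflexive (sym ι-zero)
0≤ι (suc n) = subst (0ℚ ≤_) (sym (ι-suc n)) (0≤+ {1ℚ} (toWitness {a? = 0ℚ ℚP.≤? 1ℚ} _) (0≤ι n))

0≤constant : ∀ {x} {_ : True (0ℚ ℚP.≤? x)} → 0ℚ ≤ x
0≤constant {x} {p} = toWitness p

≤-by : ∀ {x y} d → 0ℚ ≤ d → y ≡ x + d → x ≤ y
≤-by {x} {y} d p e = subst (x ≤_) (sym e) (subst (_≤ x + d) (ℚP.+-identityʳ x) (ℚP.+-monoʳ-≤ x p))

0≤- : ∀ {x y} → x ≤ y → 0ℚ ≤ y - x
0≤- {x} {y} p = subst (_≤ y - x) (ℚP.+-inverseʳ x) (ℚP.+-monoˡ-≤ (- x) p)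

*-monoˡ : ∀ {c x y} → 0ℚ ≤ c → x ≤ y → c * x ≤ c * y
*-monoˡ {c} {x} {y} p q = ≤-by (c * (y - x)) (0≤* p (0≤- q))
  (solve 3 (λ c x y → c :* y := c :* x :+ c :* (y :- x)) refl c x y)

0≤recip : ∀ n → 0ℚ ≤ recip n
0≤recip n = ℚP.nonNegative⁻¹ (recip n) {{ℚP.normalize-nonNeg 1 (suc n)}}

ι-suc-cancel-≤ : ∀ n {x y} → ι (suc n) * x ≤ ι (suc n) * y → x ≤ y
ι-suc-cancel-≤ n {x} {y} p = subst₂ _≤_ (unit x) (unit y) (*-monoˡ (0≤recip n) p)
  where
  unit : ∀ z → recip n * (ι (suc n) * z) ≡ z
  unit z = trans (sym (ℚP.*-assoc (recip n) (ι (suc n)) z)) (trans (cong (_* z) (recip-* n)) (ℚP.*-identityˡ z))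

-- Linear arithmetic: the first argument exhibits p - r as a combination of the given equations.
combine₁ : ∀ {p r a b} l → p ≡ r + l * (a - b) → a ≡ b → p ≡ r
combine₁ {r = r} {a} l e refl = trans e (solve 3 (λ r l a → r :+ l :* (a :- a) := r) refl r l a)

combine₂ : ∀ {p r a b c d} l k → p ≡ r + l * (a - b) + k * (c - d) → a ≡ b → c ≡ d → p ≡ r
combine₂ {c = c} l k e e₁ refl = combine₁ l (trans e (solve 3 (λ y k c → y :+ k :* (c :- c) := y) refl _ k c)) e₁

combine₃ : ∀ {p r a b c d g h} l k j → p ≡ r + l * (a - b) + k * (c - d) + j * (g - h) → a ≡ b → c ≡ d → g ≡ h → p ≡ r
combine₃ {g = g} l k j e e₁ e₂ refl = combine₂ l k (trans e (solve 3 (λ y k c → y :+ k :* (c :- c) := y) refl _ j g)) e₁ e₂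

ι-linear₂ : ∀ m → ι (suc (suc m)) ≡ + 2 / 1 + ι m
ι-linear₂ m = trans (ι-suc (suc m)) (trans (cong (_+_ 1ℚ) (ι-suc m)) (solve 1 (λ x → con 1ℚ :+ (con 1ℚ :+ x) := con (+ 2 / 1) :+ x) refl (ι m)))

-- κ m = C(2m+1, m) / C(2m+3, m+1)
κ : ℕ → ℚ
κ m = (+ 2 / 1 + ι m) * recip (5 ℕ.+ 4 ℕ.* m)

ι-4m+6 : ∀ m → ι (6 ℕ.+ 4 ℕ.* m) ≡ + 6 / 1 + + 4 / 1 * ι m
ι-4m+6 m = trans (ι-+ 6 (4 ℕ.* m)) (cong₂ _+_ (ι-/1 6) (trans (ι-* 4 m) (cong (_* ι m) (ι-/1 4))))

κ-* : ∀ m → κ m * (+ 6 / 1 + + 4 / 1 * ι m) ≡ + 2 / 1 + ι m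
κ-* m = begin
  (+ 2 / 1 + ι m) * recip (5 ℕ.+ 4 ℕ.* m) * (+ 6 / 1 + + 4 / 1 * ι m)
    ≡⟨ ℚP.*-assoc (+ 2 / 1 + ι m) _ _ ⟩
  (+ 2 / 1 + ι m) * (recip (5 ℕ.+ 4 ℕ.* m) * (+ 6 / 1 + + 4 / 1 * ι m))
    ≡⟨ cong (λ y → (+ 2 / 1 + ι m) * (recip (5 ℕ.+ 4 ℕ.* m) * y)) (ι-4m+6 m) ⟨
  (+ 2 / 1 + ι m) * (recip (5 ℕ.+ 4 ℕ.* m) * ι (6 ℕ.+ 4 ℕ.* m))
    ≡⟨ cong ((+ 2 / 1 + ι m) *_) (recip-* (5 ℕ.+ 4 ℕ.* m)) ⟩
  (+ 2 / 1 + ι m) * 1ℚ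
    ≡⟨ ℚP.*-identityʳ _ ⟩
  + 2 / 1 + ι m ∎
  where open ≡.≡-Reasoning

0≤κ : ∀ m → 0ℚ ≤ κ m
0≤κ m = 0≤* (0≤+ {+ 2 / 1} 0≤constant (0≤ι m)) (0≤recip (5 ℕ.+ 4 ℕ.* m))

-- b m k = C(2m+1, m-k) / C(2m+1, m)
b : ℕ → ℕ → ℚ
b zero    zero    = 1ℚ
b zero    (suc k) = 0ℚ
-- Pascal's rule applied twice, then normalised by κ. At k = 0 the symmetry C(2m+1, m+1) = C(2m+1,
-- m) merges two of the terms, hence the 3.
b (suc m) zero    = κ m * (+ 3 / 1 * b m 0 + b m 1)
b (suc m) (suc k) = κ m * (b m k + + 2 / 1 * b m (suc k) + b m (suc (suc k)))

0≤b : ∀ m k → 0ℚ ≤ b m k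
0≤b zero    zero    = 0≤constant
0≤b zero    (suc k) = 0≤constant
0≤b (suc m) zero    = 0≤* (0≤κ m) (0≤+ (0≤* {+ 3 / 1} 0≤constant (0≤b m 0)) (0≤b m 1))
0≤b (suc m) (suc k) = 0≤* (0≤κ m) (0≤+ (0≤+ (0≤b m k) (0≤* {+ 2 / 1} 0≤constant (0≤b m (suc k)))) (0≤b m (suc (suc k))))

b-vanish : ∀ m k → m ℕ.< k → b m k ≡ 0ℚ
b-vanish zero    (suc k) _       = refl
b-vanish (suc m) (suc k) (s≤s p) = trans
  (cong (κ m *_) (cong₂ _+_ (cong₂ (λ x y → x + + 2 / 1 * y) (b-vanish m k p) (b-vanish m (suc k) (ℕP.m≤n⇒m≤1+n p)))
    (b-vanish m (suc (suc k)) (ℕP.m≤n⇒m≤1+n (ℕP.m≤n⇒m≤1+n p)))))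
  (ℚP.*-zeroʳ (κ m))

-- The ratio of neighbouring binomial coefficients, proved from the recurrence: the relation at m +
-- 1 is a combination of those at m for neighbouring k, with the weights of Pascal's rule.
b-ratio : ∀ m k → (ι m + + 2 / 1 + ι k) * b m (suc k) ≡ (ι m - ι k) * b m k
b-ratio zero    zero    = trans (cong (λ x → (x + + 2 / 1 + x) * 0ℚ) ι-zero) (cong (λ x → (x - x) * 1ℚ) (sym ι-zero))
b-ratio zero    (suc k) = trans (ℚP.*-zeroʳ (ι 0 + + 2 / 1 + ι (suc k))) (sym (ℚP.*-zeroʳ (ι 0 - ι (suc k))))
b-ratio (suc m) zero    = trans (cong₂ (λ x y → (x + + 2 / 1 + y) * b (suc m) 1) (ι-suc m) ι-zero)
  (trans (combine₂ (+ 2 / 1 * κ m) (κ m)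
    (solve 5 (λ x κ b₀ b₁ b₂ →
      (con 1ℚ :+ x :+ con (+ 2 / 1) :+ con 0ℚ) :* (κ :* (b₀ :+ con (+ 2 / 1) :* b₁ :+ b₂))
      := (con 1ℚ :+ x :- con 0ℚ) :* (κ :* (con (+ 3 / 1) :* b₀ :+ b₁))
        :+ con (+ 2 / 1) :* κ :* ((x :+ con (+ 2 / 1) :+ con 0ℚ) :* b₁ :- (x :- con 0ℚ) :* b₀)
        :+ κ :* ((x :+ con (+ 2 / 1) :+ con 1ℚ) :* b₂ :- (x :- con 1ℚ) :* b₁)) refl
      (ι m) (κ m) (b m 0) (b m 1) (b m 2))
    (subst (λ y → (ι m + + 2 / 1 + y) * b m 1 ≡ (ι m - y) * b m 0) ι-zero (b-ratio m 0))
    (subst (λ y → (ι m + + 2 / 1 + y) * b m 2 ≡ (ι m - y) * b m 1) (ι-/1 1) (b-ratio m 1)))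
  (sym (cong₂ (λ x y → (x - y) * b (suc m) 0) (ι-suc m) ι-zero)))
b-ratio (suc m) (suc k) = trans (cong₂ (λ x y → (x + + 2 / 1 + y) * b (suc m) (suc (suc k))) (ι-suc m) (ι-suc k))
  (trans (combine₃ (κ m) (+ 2 / 1 * κ m) (κ m)
    (solve 7 (λ x y κ b₀ b₁ b₂ b₃ →
      (con 1ℚ :+ x :+ con (+ 2 / 1) :+ (con 1ℚ :+ y)) :* (κ :* (b₁ :+ con (+ 2 / 1) :* b₂ :+ b₃))
      := (con 1ℚ :+ x :- (con 1ℚ :+ y)) :* (κ :* (b₀ :+ con (+ 2 / 1) :* b₁ :+ b₂))
        :+ κ :* ((x :+ con (+ 2 / 1) :+ y) :* b₁ :- (x :- y) :* b₀)
        :+ con (+ 2 / 1) :* κ :* ((x :+ con (+ 2 / 1) :+ (con 1ℚ :+ y)) :* b₂ :- (x :- (con 1ℚ :+ y)) :* b₁)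
        :+ κ :* ((x :+ con (+ 2 / 1) :+ (con (+ 2 / 1) :+ y)) :* b₃ :- (x :- (con (+ 2 / 1) :+ y)) :* b₂)) refl
      (ι m) (ι k) (κ m) (b m k) (b m (suc k)) (b m (suc (suc k))) (b m (suc (suc (suc k)))))
    (b-ratio m k)
    (subst (λ y → (ι m + + 2 / 1 + y) * b m (suc (suc k)) ≡ (ι m - y) * b m (suc k)) (ι-suc k) (b-ratio m (suc k)))
    (subst (λ y → (ι m + + 2 / 1 + y) * b m (suc (suc (suc k))) ≡ (ι m - y) * b m (suc (suc k))) (ι-linear₂ k) (b-ratio m (suc (suc k)))))
  (sym (cong₂ (λ x y → (x - y) * b (suc m) (suc k)) (ι-suc m) (ι-suc k))))

b-zero : ∀ m → b m 0 ≡ 1ℚ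
b-zero zero    = refl
b-zero (suc m) = ι-cancel (suc m) (begin
  ι (suc (suc m)) * (κ m * (+ 3 / 1 * b m 0 + b m 1))
    ≡⟨ cong₂ (λ x y → x * (κ m * (+ 3 / 1 * y + b m 1))) (ι-linear₂ m) (b-zero m) ⟩
  (+ 2 / 1 + ι m) * (κ m * (+ 3 / 1 * 1ℚ + b m 1))
    ≡⟨ combine₂ (κ m) 1ℚ (solve 3 (λ x κ b₁ →
         (con (+ 2 / 1) :+ x) :* (κ :* (con (+ 3 / 1) :* con 1ℚ :+ b₁))
         := (con (+ 2 / 1) :+ x) :* con 1ℚ
           :+ κ :* ((x :+ con (+ 2 / 1) :+ con 0ℚ) :* b₁ :- (x :- con 0ℚ) :* con 1ℚ)
           :+ con 1ℚ :* (κ :* (con (+ 6 / 1) :+ con (+ 4 / 1) :* x) :- (con (+ 2 / 1) :+ x))) refl (ι m) (κ m) (b m 1))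
         (subst₂ (λ y z → (ι m + + 2 / 1 + y) * b m 1 ≡ (ι m - y) * z) ι-zero (b-zero m) (b-ratio m 0))
         (κ-* m) ⟩
  (+ 2 / 1 + ι m) * 1ℚ
    ≡⟨ cong (_* 1ℚ) (ι-linear₂ m) ⟨
  ι (suc (suc m)) * 1ℚ ∎)
  where open ≡.≡-Reasoning

sumTo : (ℕ → ℚ) → ℕ → ℚ
sumTo f zero    = 0ℚ
sumTo f (suc L) = sumTo f L + f L

-- Half a row of Pascal's triangle, normalised: 4^m / C(2m+1, m).
σ : ℕ → ℚ
σ m = sumTo (b m) (suc m)

-- The sum b_{k-1} + 2 b_k + b_{k+1} is 4 b_k plus a difference of consecutive increments. These
-- telescope to the boundary terms, which vanish beyond the support of b.
b-sum-suc : ∀ m L → sumTo (b (suc m)) (suc L) ≡ κ m * (+ 4 / 1 * sumTo (b m) (suc L) - b m L + b m (suc L))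
b-sum-suc m zero    = solve 3 (λ κ b₀ b₁ → con 0ℚ :+ κ :* (con (+ 3 / 1) :* b₀ :+ b₁)
  := κ :* (con (+ 4 / 1) :* (con 0ℚ :+ b₀) :- b₀ :+ b₁)) refl (κ m) (b m 0) (b m 1)
b-sum-suc m (suc L) = trans (cong (_+ b (suc m) (suc L)) (b-sum-suc m L))
  (solve 5 (λ κ s b₀ b₁ b₂ →
    κ :* (con (+ 4 / 1) :* s :- b₀ :+ b₁) :+ κ :* (b₀ :+ con (+ 2 / 1) :* b₁ :+ b₂)
    := κ :* (con (+ 4 / 1) :* (s :+ b₁) :- b₁ :+ b₂)) refl
    (κ m) (sumTo (b m) (suc L)) (b m L) (b m (suc L)) (b m (suc (suc L))))

σ-suc : ∀ m → σ (suc m) ≡ κ m * (+ 4 / 1 * σ m)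
σ-suc m = trans (b-sum-suc m (suc m)) (trans
  (cong₂ (λ x y → κ m * (+ 4 / 1 * (σ m + x) - x + y)) (b-vanish m (suc m) ℕP.≤-refl) (b-vanish m (suc (suc m)) (ℕP.m≤n⇒m≤1+n ℕP.≤-refl)))
  (solve 2 (λ κ s → κ :* (con (+ 4 / 1) :* (s :+ con 0ℚ) :- con 0ℚ :+ con 0ℚ) := κ :* (con (+ 4 / 1) :* s)) refl (κ m) (σ m)))

sgn : ℕ → ℚ
sgn zero    = 1ℚ
sgn (suc k) = - sgn k

private
  odd : ℕ → ℚ
  odd j = 1ℚ + + 2 / 1 * ι j

  ι-odd : ∀ j → ι (suc (2 ℕ.* j)) ≡ odd j
  ι-odd j = trans (ι-suc (2 ℕ.* j)) (cong (_+_ 1ℚ) (trans (ι-* 2 j) (cong (_* ι j) (ι-/1 2))))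

  leibniz-abs : ∀ j → ((+ 4) / suc (2 ℕ.* j)) * odd j ≡ + 4 / 1
  leibniz-abs j = trans (cong (((+ 4) / suc (2 ℕ.* j)) *_) (sym (ι-odd j))) (fraction-* (+ 4) (suc (2 ℕ.* j)))

  parity : ∀ j → (j ℕ.% 2 ≡ 0 × sgn j ≡ 1ℚ) ⊎ (j ℕ.% 2 ≡ 1 × sgn j ≡ - 1ℚ)
  parity zero          = inj₁ (refl , refl)
  parity (suc zero)    = inj₂ (refl , refl)
  parity (suc (suc j)) with parity j
  ... | inj₁ (p , s) = inj₁ (p , cong (λ x → - (- x)) s)
  ... | inj₂ (p , s) = inj₂ (p , cong (λ x → - (- x)) s)

leibniz-sgn : ∀ j → leibnizTerm j ≡ sgn j * err j
leibniz-sgn j with j ℕ.% 2 | parity j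
... | zero  | inj₁ (_ , s) = sym (trans (cong (_* err j) s) (ℚP.*-identityˡ (err j)))
... | zero  | inj₂ (() , _)
... | suc _ | inj₁ (() , _)
... | suc _ | inj₂ (_ , s) = sym (trans (cong (_* err j) s) (solve 1 (λ e → (:- con 1ℚ) :* e := :- e) refl (err j)))

leibniz-* : ∀ j → leibnizTerm j * odd j ≡ + 4 / 1 * sgn j
leibniz-* j = trans (cong (_* odd j) (leibniz-sgn j)) (trans (ℚP.*-assoc (sgn j) (err j) (odd j))
  (trans (cong (sgn j *_) (leibniz-abs j)) (ℚP.*-comm (sgn j) _)))

T : ℕ → ℚ
T m = sumTo (λ k → leibnizTerm k * b m k) (suc m)

-- The recurrence for T, which mirrors the reduction formula of the integral of cos^(2m+1), holds
-- for partial sums up to one boundary term. The factor 2k + 1 cancels against the Leibniz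
-- denominator by `leibniz-*`, and the rest telescopes through `b-ratio`.
T-sum-suc : ∀ m L → (+ 3 / 1 + + 2 / 1 * ι m) * sumTo (λ k → leibnizTerm k * b (suc m) k) (suc L)
  ≡ κ m * (+ 8 / 1 * (1ℚ + ι m) * sumTo (λ k → leibnizTerm k * b m k) (suc L) + + 4 / 1 * sgn L * (b m L - b m (suc L)))
T-sum-suc m zero = combine₁ (+ 8 / 1 * κ m)
  (solve 4 (λ x κ b₀ b₁ →
    (con (+ 3 / 1) :+ con (+ 2 / 1) :* x) :* (con 0ℚ :+ con (+ 4 / 1) :* (κ :* (con (+ 3 / 1) :* b₀ :+ b₁)))
    := κ :* (con (+ 8 / 1) :* (con 1ℚ :+ x) :* (con 0ℚ :+ con (+ 4 / 1) :* b₀) :+ con (+ 4 / 1) :* con 1ℚ :* (b₀ :- b₁))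
      :+ con (+ 8 / 1) :* κ :* ((x :+ con (+ 2 / 1) :+ con 0ℚ) :* b₁ :- (x :- con 0ℚ) :* b₀)) refl
    (ι m) (κ m) (b m 0) (b m 1))
  (subst (λ y → (ι m + + 2 / 1 + y) * b m 1 ≡ (ι m - y) * b m 0) ι-zero (b-ratio m 0))
T-sum-suc m (suc L) = trans (ℚP.*-distribˡ-+ (+ 3 / 1 + + 2 / 1 * ι m) A (l * b (suc m) (suc L)))
  (trans (cong (_+ (+ 3 / 1 + + 2 / 1 * ι m) * (l * b (suc m) (suc L))) (T-sum-suc m L))
  (combine₃ (κ m * (b m L - b m (2 ℕ.+ L))) (- (+ 2 / 1) * κ m * l) (+ 2 / 1 * κ m * l)
    (solve 9 (λ x y κ B l s b₀ b₁ b₂ →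
      κ :* (con (+ 8 / 1) :* (con 1ℚ :+ x) :* B :+ con (+ 4 / 1) :* s :* (b₀ :- b₁))
        :+ (con (+ 3 / 1) :+ con (+ 2 / 1) :* x) :* (l :* (κ :* (b₀ :+ con (+ 2 / 1) :* b₁ :+ b₂)))
      := κ :* (con (+ 8 / 1) :* (con 1ℚ :+ x) :* (B :+ l :* b₁) :+ con (+ 4 / 1) :* (:- s) :* (b₁ :- b₂))
        :+ κ :* (b₀ :- b₂) :* (l :* (con 1ℚ :+ con (+ 2 / 1) :* (con 1ℚ :+ y)) :- con (+ 4 / 1) :* (:- s))
        :+ con (- (+ 2 / 1)) :* κ :* l :* ((x :+ con (+ 2 / 1) :+ y) :* b₁ :- (x :- y) :* b₀)
        :+ con (+ 2 / 1) :* κ :* l :* ((x :+ con (+ 2 / 1) :+ (con 1ℚ :+ y)) :* b₂ :- (x :- (con 1ℚ :+ y)) :* b₁)) refl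
      (ι m) (ι L) (κ m) (sumTo (λ k → leibnizTerm k * b m k) (suc L)) l (sgn L) (b m L) (b m (suc L)) (b m (2 ℕ.+ L)))
    (subst (λ y → l * (1ℚ + + 2 / 1 * y) ≡ + 4 / 1 * sgn (suc L)) (ι-suc L) (leibniz-* (suc L)))
    (b-ratio m L)
    (subst (λ y → (ι m + + 2 / 1 + y) * b m (2 ℕ.+ L) ≡ (ι m - y) * b m (suc L)) (ι-suc L) (b-ratio m (suc L)))))
  where
  A = sumTo (λ k → leibnizTerm k * b (suc m) k) (suc L)
  l = leibnizTerm (suc L)

T-suc : ∀ m → (+ 3 / 1 + + 2 / 1 * ι m) * T (suc m) ≡ κ m * (+ 8 / 1 * (1ℚ + ι m) * T m)
T-suc m = trans (T-sum-suc m (suc m)) (trans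
  (cong₂ (λ x y → κ m * (+ 8 / 1 * (1ℚ + ι m) * (T m + leibnizTerm (suc m) * x) + + 4 / 1 * sgn (suc m) * (x - y)))
    (b-vanish m (suc m) ℕP.≤-refl) (b-vanish m (suc (suc m)) (ℕP.m≤n⇒m≤1+n ℕP.≤-refl)))
  (solve 5 (λ κ x t l s → κ :* (con (+ 8 / 1) :* (con 1ℚ :+ x) :* (t :+ l :* con 0ℚ) :+ con (+ 4 / 1) :* s :* (con 0ℚ :- con 0ℚ))
    := κ :* (con (+ 8 / 1) :* (con 1ℚ :+ x) :* t)) refl (κ m) (ι m) (T m) (leibnizTerm (suc m)) (sgn (suc m))))

ι-2m+3 : ∀ m → ι (suc (2 ℕ.+ 2 ℕ.* m)) ≡ + 3 / 1 + + 2 / 1 * ι m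
ι-2m+3 m = trans (ι-+ 3 (2 ℕ.* m)) (cong₂ _+_ (ι-/1 3) (trans (ι-* 2 m) (cong (_* ι m) (ι-/1 2))))

cancel-3+2x : ∀ m {x y} → (+ 3 / 1 + + 2 / 1 * ι m) * x ≤ (+ 3 / 1 + + 2 / 1 * ι m) * y → x ≤ y
cancel-3+2x m {x} {y} p = ι-suc-cancel-≤ (2 ℕ.+ 2 ℕ.* m) (subst (λ z → z * x ≤ z * y) (sym (ι-2m+3 m)) p)

cancel-3+2x-≡ : ∀ m {x y} → (+ 3 / 1 + + 2 / 1 * ι m) * x ≡ (+ 3 / 1 + + 2 / 1 * ι m) * y → x ≡ y
cancel-3+2x-≡ m {x} {y} p = ι-cancel (2 ℕ.+ 2 ℕ.* m) (subst (λ z → z * x ≡ z * y) (sym (ι-2m+3 m)) p)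

σ²-T : ∀ m → + 4 / 1 * (σ m * σ m) ≡ (1ℚ + ι m) * T m
σ²-T zero    = cong (λ x → (1ℚ + x) * (+ 4 / 1)) (sym ι-zero)
σ²-T (suc m) = cancel-3+2x-≡ m (trans
  (cong (λ s → (+ 3 / 1 + + 2 / 1 * ι m) * (+ 4 / 1 * (s * s))) (σ-suc m)) (trans
  (combine₃ (+ 32 / 1 * (κ m * (σ m * σ m))) (+ 8 / 1 * κ m * (+ 2 / 1 + ι m)) (- (+ 2 / 1 + ι m))
    (solve 5 (λ x κ s t t′ →
      (con (+ 3 / 1) :+ con (+ 2 / 1) :* x) :* (con (+ 4 / 1) :* (κ :* (con (+ 4 / 1) :* s) :* (κ :* (con (+ 4 / 1) :* s))))
      := (con (+ 3 / 1) :+ con (+ 2 / 1) :* x) :* ((con 1ℚ :+ (con 1ℚ :+ x)) :* t′)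
        :+ con (+ 32 / 1) :* (κ :* (s :* s)) :* (κ :* (con (+ 6 / 1) :+ con (+ 4 / 1) :* x) :- (con (+ 2 / 1) :+ x))
        :+ con (+ 8 / 1) :* κ :* (con (+ 2 / 1) :+ x) :* (con (+ 4 / 1) :* (s :* s) :- (con 1ℚ :+ x) :* t)
        :+ (:- (con (+ 2 / 1) :+ x)) :* ((con (+ 3 / 1) :+ con (+ 2 / 1) :* x) :* t′ :- κ :* (con (+ 8 / 1) :* (con 1ℚ :+ x) :* t)))
      refl (ι m) (κ m) (σ m) (T m) (T (suc m)))
    (κ-* m) (σ²-T m) (T-suc m))
  (cong (λ y → (+ 3 / 1 + + 2 / 1 * ι m) * ((1ℚ + y) * T (suc m))) (sym (ι-suc m)))))

0≤square : ∀ x → 0ℚ ≤ x * x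
0≤square x with ℚP.≤-total 0ℚ x
... | inj₁ p = 0≤* p p
... | inj₂ p = subst (0ℚ ≤_) (solve 1 (λ x → (con 0ℚ :- x) :* (con 0ℚ :- x) := x :* x) refl x) (0≤* (0≤- p) (0≤- p))

0≤T : ∀ m → 0ℚ ≤ T m
0≤T m = ι-suc-cancel-≤ m (subst₂ _≤_ (sym (ℚP.*-zeroʳ (ι (suc m))))
  (trans (σ²-T m) (cong (_* T m) (sym (ι-suc m)))) (0≤* {+ 4 / 1} 0≤constant (0≤square (σ m))))

-- The quotient of consecutive values is 4 (m + 1)(m + 2) / (2m + 3)² = 1 - 1 / (2m + 3)². After
-- clearing the square the slack is therefore exactly T m.
T-antitone : ∀ m → T (suc m) ≤ T m
T-antitone m = cancel-3+2x m (cancel-3+2x m (≤-by (T m) (0≤T m)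
  (combine₂ (- (+ 3 / 1 + + 2 / 1 * ι m)) (- (+ 4 / 1 * (1ℚ + ι m) * T m))
    (solve 4 (λ x κ t t′ → let z = con (+ 3 / 1) :+ con (+ 2 / 1) :* x in
      z :* (z :* t) := z :* (z :* t′) :+ t
        :+ (:- z) :* (z :* t′ :- κ :* (con (+ 8 / 1) :* (con 1ℚ :+ x) :* t))
        :+ (:- (con (+ 4 / 1) :* (con 1ℚ :+ x) :* t)) :* (κ :* (con (+ 6 / 1) :+ con (+ 4 / 1) :* x) :- (con (+ 2 / 1) :+ x)))
      refl (ι m) (κ m) (T m) (T (suc m)))
    (T-suc m) (κ-* m))))

W : ℕ → ℚ
W m = σ m * σ m * recip (2 ℕ.+ 2 ℕ.* m)

W-* : ∀ m → (+ 3 / 1 + + 2 / 1 * ι m) * W m ≡ σ m * σ m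
W-* m = begin
  (+ 3 / 1 + + 2 / 1 * ι m) * W m
    ≡⟨ cong (_* W m) (ι-2m+3 m) ⟨
  ι (3 ℕ.+ 2 ℕ.* m) * (σ m * σ m * recip (2 ℕ.+ 2 ℕ.* m))
    ≡⟨ solve 3 (λ i s r → i :* (s :* r) := s :* (r :* i)) refl (ι (3 ℕ.+ 2 ℕ.* m)) (σ m * σ m) (recip (2 ℕ.+ 2 ℕ.* m)) ⟩
  σ m * σ m * (recip (2 ℕ.+ 2 ℕ.* m) * ι (3 ℕ.+ 2 ℕ.* m))
    ≡⟨ cong (σ m * σ m *_) (recip-* (2 ℕ.+ 2 ℕ.* m)) ⟩
  σ m * σ m * 1ℚ
    ≡⟨ ℚP.*-identityʳ _ ⟩
  σ m * σ m ∎
  where open ≡.≡-Reasoning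

-- The quotient of consecutive values is (2m + 4)² / ((2m + 3)(2m + 5)) = 1 + 1 / ((2m + 3)(2m +
-- 5)).
W-monotone : ∀ m → W m ≤ W (suc m)
W-monotone m = cancel-3+2x m (cancel-3+2x m (cancel-3+2x (suc m) (≤-by (σ m * σ m) (0≤square (σ m))
  (combine₃ (z * z) (- (+ 3 / 1 + + 2 / 1 * ι (suc m)) * z) (+ 4 / 1 * (σ m * σ m) * (κ m * (+ 6 / 1 + + 4 / 1 * ι m) + (+ 2 / 1 + ι m)))
    (trans (cong (λ y → (+ 3 / 1 + + 2 / 1 * y) * (z * (z * W (suc m)))) (ι-suc m)) (trans
      (solve 5 (λ x κ s w w′ → let z = con (+ 3 / 1) :+ con (+ 2 / 1) :* x in
        (con (+ 3 / 1) :+ con (+ 2 / 1) :* (con 1ℚ :+ x)) :* (z :* (z :* w′))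
        := (con (+ 3 / 1) :+ con (+ 2 / 1) :* (con 1ℚ :+ x)) :* (z :* (z :* w)) :+ s :* s
          :+ z :* z :* ((con (+ 3 / 1) :+ con (+ 2 / 1) :* (con 1ℚ :+ x)) :* w′ :- κ :* (con (+ 4 / 1) :* s) :* (κ :* (con (+ 4 / 1) :* s)))
          :+ (:- (con (+ 3 / 1) :+ con (+ 2 / 1) :* (con 1ℚ :+ x))) :* z :* (z :* w :- s :* s)
          :+ con (+ 4 / 1) :* (s :* s) :* (κ :* (con (+ 6 / 1) :+ con (+ 4 / 1) :* x) :+ (con (+ 2 / 1) :+ x))
             :* (κ :* (con (+ 6 / 1) :+ con (+ 4 / 1) :* x) :- (con (+ 2 / 1) :+ x)))
        refl (ι m) (κ m) (σ m) (W m) (W (suc m)))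
      (cong₂ (λ y r → (+ 3 / 1 + + 2 / 1 * y) * (z * (z * W m)) + σ m * σ m
          + z * z * ((+ 3 / 1 + + 2 / 1 * y) * W (suc m) - r * r)
          + (- (+ 3 / 1 + + 2 / 1 * y)) * z * (z * W m - σ m * σ m)
          + + 4 / 1 * (σ m * σ m) * (κ m * (+ 6 / 1 + + 4 / 1 * ι m) + (+ 2 / 1 + ι m))
             * (κ m * (+ 6 / 1 + + 4 / 1 * ι m) - (+ 2 / 1 + ι m)))
        (sym (ι-suc m)) (sym (σ-suc m)))))
    (W-* (suc m)) (W-* m) (κ-* m)))))
  where z = + 3 / 1 + + 2 / 1 * ι m

-- By `σ²-T`, the left side is (2m + 2) / (2m + 3) times T m.
W-T : ∀ m → + 8 / 1 * W m ≤ T m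
W-T m = cancel-3+2x m (≤-by (T m) (0≤T m)
  (combine₂ (- (+ 8 / 1)) (- (+ 2 / 1))
    (solve 4 (λ x w t s → let z = con (+ 3 / 1) :+ con (+ 2 / 1) :* x in
      z :* t := z :* (con (+ 8 / 1) :* w) :+ t :+ (:- con (+ 8 / 1)) :* (z :* w :- s :* s)
        :+ (:- con (+ 2 / 1)) :* (con (+ 4 / 1) :* (s :* s) :- (con 1ℚ :+ x) :* t)) refl (ι m) (W m) (T m) (σ m))
    (W-* m) (σ²-T m)))

sgn-cases : ∀ k → sgn k ≡ 1ℚ ⊎ sgn k ≡ - 1ℚ
sgn-cases zero    = inj₁ refl
sgn-cases (suc k) with sgn-cases k
... | inj₁ e = inj₂ (cong -_ e)
... | inj₂ e = inj₁ (cong -_ e)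

-- Alternating sums with decreasing terms

module Alternating (a : ℕ → ℚ) (0≤a : ∀ k → 0ℚ ≤ a k) (a-antitone : ∀ k → a (suc k) ≤ a k) where

  partial : ℕ → ℚ
  partial = sumTo (λ k → sgn k * a k)

  private
    tail : ℕ → ℕ → ℚ
    tail L zero    = 0ℚ
    tail L (suc i) = a L - tail (suc L) i

    tail-bounds : ∀ L i → 0ℚ ≤ tail L i × tail L i ≤ a L
    tail-bounds L zero    = ℚP.≤-refl , 0≤a L
    tail-bounds L (suc i) with tail-bounds (suc L) i
    ... | lo , hi = 0≤- (ℚP.≤-trans hi (a-antitone L)) ,
      ≤-by (tail (suc L) i) lo (solve 2 (λ a t → a := (a :- t) :+ t) refl (a L) (tail (suc L) i))

    partial-+ : ∀ L i → partial (L ℕ.+ i) ≡ partial L + sgn L * tail L i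
    partial-+ L zero    = trans (cong partial (ℕP.+-identityʳ L))
      (solve 2 (λ p s → p := p :+ s :* con 0ℚ) refl (partial L) (sgn L))
    partial-+ L (suc i) = trans (cong partial (ℕP.+-suc L i)) (trans (partial-+ (suc L) i)
      (solve 4 (λ p s a t → p :+ s :* a :+ (:- s) :* t := p :+ s :* (a :- t)) refl (partial L) (sgn L) (a L) (tail (suc L) i)))

  partial-≥ : ∀ L i → sgn L ≡ 1ℚ → partial L ≤ partial (L ℕ.+ i)
  partial-≥ L i e = ≤-by (tail L i) (proj₁ (tail-bounds L i))
    (trans (partial-+ L i) (cong (_+_ (partial L)) (trans (cong (_* tail L i) e) (ℚP.*-identityˡ (tail L i)))))

  partial-≤ : ∀ L i → sgn L ≡ - 1ℚ → partial (L ℕ.+ i) ≤ partial L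
  partial-≤ L i e = ≤-by (tail L i) (proj₁ (tail-bounds L i)) (trans
    (solve 2 (λ p t → p := (p :+ (:- con 1ℚ) :* t) :+ t) refl (partial L) (tail L i))
    (cong (_+ tail L i) (sym (trans (partial-+ L i) (cong (λ s → partial L + s * tail L i) e)))))

  partial-≤-first : ∀ L → partial L ≤ a 0
  partial-≤-first L = subst (_≤ a 0)
    (sym (trans (partial-+ 0 L) (solve 1 (λ t → con 0ℚ :+ con 1ℚ :* t := t) refl (tail 0 L))))
    (proj₂ (tail-bounds 0 L))

0≤err : ∀ k → 0ℚ ≤ err k
0≤err k = ℚP.nonNegative⁻¹ (err k) {{ℚP.normalize-nonNeg 4 (suc (2 ℕ.* k))}}

err-* : ∀ k → ι (suc (2 ℕ.* k)) * err k ≡ + 4 / 1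
err-* k = trans (ℚP.*-comm (ι (suc (2 ℕ.* k))) (err k)) (fraction-* (+ 4) (suc (2 ℕ.* k)))

err-antitone : ∀ k → err (suc k) ≤ err k
err-antitone k = ι-suc-cancel-≤ (2 ℕ.* k) (ι-suc-cancel-≤ (2 ℕ.* suc k) (≤-by (+ 8 / 1) 0≤constant
  (combine₂ o′ (- o)
    (trans (solve 4 (λ o o′ e e′ → o′ :* (o :* e) := o′ :* (o :* e′) :+ con (+ 4 / 1) :* (o′ :- o) :+ o′ :* (o :* e :- con (+ 4 / 1)) :+ (:- o) :* (o′ :* e′ :- con (+ 4 / 1)))
             refl o o′ (err k) (err (suc k)))
           (cong (λ d → o′ * (o * err (suc k)) + d + o′ * (o * err k - + 4 / 1) + (- o) * (o′ * err (suc k) - + 4 / 1)) gap))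
    (err-* k) (err-* (suc k)))))
  where
  o o′ : ℚ
  o  = ι (suc (2 ℕ.* k))
  o′ = ι (suc (2 ℕ.* suc k))
  gap : + 4 / 1 * (o′ - o) ≡ + 8 / 1
  gap = trans (cong (λ y → + 4 / 1 * (y - o)) (trans (cong (λ j → ι (suc j)) (ℕP.*-suc 2 k)) (ι-linear₂ (suc (2 ℕ.* k)))))
    (solve 1 (λ o → con (+ 4 / 1) :* (con (+ 2 / 1) :+ o :- o) := con (+ 8 / 1)) refl o)

err≤4 : ∀ k → err k ≤ + 4 / 1
err≤4 zero    = ℚP.≤-refl
err≤4 (suc k) = ℚP.≤-trans (err-antitone k) (err≤4 k)

ι-m+k+2 : ∀ m k → ι (suc (suc (m ℕ.+ k))) ≡ ι m + + 2 / 1 + ι k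
ι-m+k+2 m k = trans (ι-linear₂ (m ℕ.+ k)) (trans (cong (_+_ (+ 2 / 1)) (ι-+ m k))
  (solve 2 (λ x y → con (+ 2 / 1) :+ (x :+ y) := x :+ con (+ 2 / 1) :+ y) refl (ι m) (ι k)))

b-antitone : ∀ m k → b m (suc k) ≤ b m k
b-antitone m k = ι-suc-cancel-≤ (suc (m ℕ.+ k)) (subst (λ z → z * b m (suc k) ≤ z * b m k) (sym (ι-m+k+2 m k))
  (≤-by ((+ 2 / 1 + + 2 / 1 * ι k) * b m k) (0≤* (0≤+ {+ 2 / 1} 0≤constant (0≤* {+ 2 / 1} 0≤constant (0≤ι k))) (0≤b m k))
    (combine₁ (- 1ℚ)
      (solve 4 (λ x y b b′ → (x :+ con (+ 2 / 1) :+ y) :* b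
        := (x :+ con (+ 2 / 1) :+ y) :* b′ :+ (con (+ 2 / 1) :+ con (+ 2 / 1) :* y) :* b
          :+ (:- con 1ℚ) :* ((x :+ con (+ 2 / 1) :+ y) :* b′ :- (x :- y) :* b)) refl (ι m) (ι k) (b m k) (b m (suc k)))
      (b-ratio m k))))

b≤1 : ∀ m k → b m k ≤ 1ℚ
b≤1 m zero    = ℚP.≤-reflexive (b-zero m)
b≤1 m (suc k) = ℚP.≤-trans (b-antitone m k) (b≤1 m k)

module Weighted (m : ℕ) = Alternating (λ k → err k * b m k) (λ k → 0≤* (0≤err k) (0≤b m k))
  (λ k → ℚP.≤-trans (*-monoˡ (0≤err (suc k)) (b-antitone m k))
    (subst₂ _≤_ (ℚP.*-comm (b m k) (err (suc k))) (ℚP.*-comm (b m k) (err k)) (*-monoˡ (0≤b m k) (err-antitone k))))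

module Plain = Alternating err 0≤err err-antitone

sumTo-cong : ∀ {f g} L → (∀ k → f k ≡ g k) → sumTo f L ≡ sumTo g L
sumTo-cong zero    e = refl
sumTo-cong (suc L) e = cong₂ _+_ (sumTo-cong L e) (e L)

S-partial : ∀ L → S L ≡ Plain.partial L
S-partial zero    = refl
S-partial (suc L) = trans (sum-upTo-suc leibnizTerm L) (cong₂ _+_ (S-partial L) (leibniz-sgn L))

-- Since b m k vanishes for k > m, the partial sums are constant from m + 1 on, so T m is the full
-- alternating sum and every earlier partial sum bounds it on one side.
T-partial : ∀ m i → Weighted.partial m (suc m ℕ.+ i) ≡ T m
T-partial m zero    = trans (cong (Weighted.partial m) (ℕP.+-identityʳ (suc m)))
  (sumTo-cong (suc m) λ k → trans (sym (ℚP.*-assoc (sgn k) (err k) (b m k))) (cong (_* b m k) (sym (leibniz-sgn k))))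
T-partial m (suc i) = trans (cong (Weighted.partial m) (ℕP.+-suc (suc m) i)) (trans
  (cong₂ (λ p b → p + sgn (suc m ℕ.+ i) * (err (suc m ℕ.+ i) * b)) (T-partial m i) (b-vanish m (suc m ℕ.+ i) (s≤s (ℕP.m≤m+n m i))))
  (solve 3 (λ t s e → t :+ s :* (e :* con 0ℚ) := t) refl (T m) (sgn (suc m ℕ.+ i)) (err (suc m ℕ.+ i))))

partial≤T : ∀ m L → sgn L ≡ 1ℚ → Weighted.partial m L ≤ T m
partial≤T m L e = subst (Weighted.partial m L ≤_)
  (trans (cong (Weighted.partial m) (ℕP.+-comm L (suc m))) (T-partial m L)) (Weighted.partial-≥ m L (suc m) e)

T≤partial : ∀ m L → sgn L ≡ - 1ℚ → T m ≤ Weighted.partial m L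
T≤partial m L e = subst (_≤ Weighted.partial m L)
  (trans (cong (Weighted.partial m) (ℕP.+-comm L (suc m))) (T-partial m L)) (Weighted.partial-≤ m L (suc m) e)

-- By b-close, b m k → 1 as m → ∞, so that T m tends to the Leibniz series.
pronic : ℕ → ℕ
pronic zero    = 0
pronic (suc k) = pronic k ℕ.+ 2 ℕ.* suc k

-- By `b-ratio`, (m + 2)(b_k - b_{k+1}) = (k + 2) b_k + k b_{k+1}, which is at most 2 (k + 1).
-- Adding these steps gives k (k + 1).
b-close : ∀ m k → (ι m + + 2 / 1) * (1ℚ - b m k) ≤ ι (pronic k)
b-close m zero    = ℚP.≤-reflexive (trans (cong (λ y → (ι m + + 2 / 1) * (1ℚ - y)) (b-zero m))
  (trans (solve 1 (λ x → (x :+ con (+ 2 / 1)) :* (con 1ℚ :- con 1ℚ) := con 0ℚ) refl (ι m)) (sym ι-zero)))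
b-close m (suc k) = ℚP.≤-trans (≤-by d 0≤d e) (subst ((ι m + + 2 / 1) * (1ℚ - b m k) + + 2 / 1 * (1ℚ + ι k) ≤_)
    (sym (trans (ι-+ (pronic k) (2 ℕ.* suc k)) (cong (_+_ (ι (pronic k))) (trans (ι-* 2 (suc k)) (cong₂ _*_ (ι-/1 2) (ι-suc k))))))
    (ℚP.+-monoˡ-≤ (+ 2 / 1 * (1ℚ + ι k)) (b-close m k)))
  where
  d = ι k * (b m k - b m (suc k)) + + 2 / 1 * (1ℚ + ι k) * (1ℚ - b m k)
  0≤d : 0ℚ ≤ d
  0≤d = 0≤+ (0≤* (0≤ι k) (0≤- (b-antitone m k)))
    (0≤* (0≤* {+ 2 / 1} 0≤constant (0≤+ {1ℚ} 0≤constant (0≤ι k))) (0≤- (b≤1 m k)))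
  e : (ι m + + 2 / 1) * (1ℚ - b m k) + + 2 / 1 * (1ℚ + ι k) ≡ (ι m + + 2 / 1) * (1ℚ - b m (suc k)) + d
  e = combine₁ 1ℚ (solve 4 (λ x y b b′ →
      (x :+ con (+ 2 / 1)) :* (con 1ℚ :- b) :+ con (+ 2 / 1) :* (con 1ℚ :+ y)
      := (x :+ con (+ 2 / 1)) :* (con 1ℚ :- b′) :+ (y :* (b :- b′) :+ con (+ 2 / 1) :* (con 1ℚ :+ y) :* (con 1ℚ :- b))
        :+ con 1ℚ :* ((x :+ con (+ 2 / 1) :+ y) :* b′ :- (x :- y) :* b)) refl (ι m) (ι k) (b m k) (b m (suc k)))
    (b-ratio m k)

deviation : ℕ → ℕ
deviation zero    = 0
deviation (suc L) = deviation L ℕ.+ 4 ℕ.* pronic L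

ι-deviation : ∀ L → ι (deviation (suc L)) ≡ ι (deviation L) + + 4 / 1 * ι (pronic L)
ι-deviation L = trans (ι-+ (deviation L) _) (cong (_+_ (ι (deviation L))) (trans (ι-* 4 (pronic L)) (cong (_* ι (pronic L)) (ι-/1 4))))

private
  term-close : ∀ m k → (ι m + + 2 / 1) * (err k * (1ℚ - b m k)) ≤ + 4 / 1 * ι (pronic k)
  term-close m k = ℚP.≤-trans
    (≤-by ((+ 4 / 1 - err k) * ((ι m + + 2 / 1) * (1ℚ - b m k)))
      (0≤* (0≤- (err≤4 k)) (0≤* (0≤+ (0≤ι m) (0≤constant {+ 2 / 1})) (0≤- (b≤1 m k))))
      (solve 3 (λ x e c → con (+ 4 / 1) :* (x :* c) := x :* (e :* c) :+ (con (+ 4 / 1) :- e) :* (x :* c)) refl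
        (ι m + + 2 / 1) (err k) (1ℚ - b m k)))
    (*-monoˡ {+ 4 / 1} 0≤constant (b-close m k))

  0≤term : ∀ m k → 0ℚ ≤ (ι m + + 2 / 1) * (err k * (1ℚ - b m k))
  0≤term m k = 0≤* (0≤+ (0≤ι m) (0≤constant {+ 2 / 1})) (0≤* (0≤err k) (0≤- (b≤1 m k)))

  signed-bounds : ∀ k {z c} → 0ℚ ≤ z → z ≤ c → 0ℚ ≤ c - sgn k * z × 0ℚ ≤ c + sgn k * z
  signed-bounds k {z} {c} p q with sgn-cases k
  ... | inj₁ e = subst (λ s → 0ℚ ≤ c - s * z) (sym e) (subst (0ℚ ≤_) (solve 2 (λ c z → c :- z := c :- con 1ℚ :* z) refl c z) (0≤- q))
               , subst (λ s → 0ℚ ≤ c + s * z) (sym e) (0≤+ (ℚP.≤-trans p q) (subst (0ℚ ≤_) (sym (ℚP.*-identityˡ z)) p))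
  ... | inj₂ e = subst (λ s → 0ℚ ≤ c - s * z) (sym e) (subst (0ℚ ≤_) (solve 2 (λ c z → c :+ z := c :- (:- con 1ℚ) :* z) refl c z) (0≤+ (ℚP.≤-trans p q) p))
               , subst (λ s → 0ℚ ≤ c + s * z) (sym e) (subst (0ℚ ≤_) (solve 2 (λ c z → c :- z := c :+ (:- con 1ℚ) :* z) refl c z) (0≤- q))

private
  close-above : ∀ x p q s e b d r → x * p ≤ x * q + d → 0ℚ ≤ + 4 / 1 * r - s * (x * (e * (1ℚ - b))) →
    x * (p + s * e) ≤ x * (q + s * (e * b)) + (d + + 4 / 1 * r)
  close-above x p q s e b d r h k = ≤-by ((x * q + d - x * p) + (+ 4 / 1 * r - s * (x * (e * (1ℚ - b))))) (0≤+ (0≤- h) k)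
    (solve 8 (λ x p q s e b d r → x :* (q :+ s :* (e :* b)) :+ (d :+ con (+ 4 / 1) :* r)
      := x :* (p :+ s :* e) :+ ((x :* q :+ d :- x :* p) :+ (con (+ 4 / 1) :* r :- s :* (x :* (e :* (con 1ℚ :- b)))))) refl
      x p q s e b d r)

  close-below : ∀ x p q s e b d r → x * q ≤ x * p + d → 0ℚ ≤ + 4 / 1 * r + s * (x * (e * (1ℚ - b))) →
    x * (q + s * (e * b)) ≤ x * (p + s * e) + (d + + 4 / 1 * r)
  close-below x p q s e b d r h k = ≤-by ((x * p + d - x * q) + (+ 4 / 1 * r + s * (x * (e * (1ℚ - b))))) (0≤+ (0≤- h) k)
    (solve 8 (λ x p q s e b d r → x :* (p :+ s :* e) :+ (d :+ con (+ 4 / 1) :* r)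
      := x :* (q :+ s :* (e :* b)) :+ ((x :* p :+ d :- x :* q) :+ (con (+ 4 / 1) :* r :+ s :* (x :* (e :* (con 1ℚ :- b)))))) refl
      x p q s e b d r)

  partial-close : ∀ m L → (ι m + + 2 / 1) * Plain.partial L ≤ (ι m + + 2 / 1) * Weighted.partial m L + ι (deviation L)
                        × (ι m + + 2 / 1) * Weighted.partial m L ≤ (ι m + + 2 / 1) * Plain.partial L + ι (deviation L)
  partial-close m zero    = base , base
    where
    base : (ι m + + 2 / 1) * 0ℚ ≤ (ι m + + 2 / 1) * 0ℚ + ι 0
    base = ≤-by (ι 0) (0≤ι 0) refl
  partial-close m (suc L) =
      subst (λ y → x * Plain.partial (suc L) ≤ x * Weighted.partial m (suc L) + y) (sym (ι-deviation L))
        (close-above x p q (sgn L) (err L) (b m L) (ι (deviation L)) (ι (pronic L)) (proj₁ ih) (proj₁ bounds))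
    , subst (λ y → x * Weighted.partial m (suc L) ≤ x * Plain.partial (suc L) + y) (sym (ι-deviation L))
        (close-below x p q (sgn L) (err L) (b m L) (ι (deviation L)) (ι (pronic L)) (proj₂ ih) (proj₂ bounds))
    where
    x p q : ℚ
    x = ι m + + 2 / 1
    p = Plain.partial L
    q = Weighted.partial m L
    ih = partial-close m L
    bounds = signed-bounds L (0≤term m L) (term-close m L)

S-close : ∀ m L → (ι m + + 2 / 1) * S L ≤ (ι m + + 2 / 1) * Weighted.partial m L + ι (deviation L)
                × (ι m + + 2 / 1) * Weighted.partial m L ≤ (ι m + + 2 / 1) * S L + ι (deviation L)
S-close m L = subst (λ s → (ι m + + 2 / 1) * s ≤ (ι m + + 2 / 1) * Weighted.partial m L + ι (deviation L)
    × (ι m + + 2 / 1) * Weighted.partial m L ≤ (ι m + + 2 / 1) * s + ι (deviation L))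
  (sym (S-partial L)) (partial-close m L)

archimedean : ∀ {z c} d → 0ℚ ≤ c → (∀ n → (c + ι n) * z ≤ ι d) → z ≤ 0ℚ
archimedean {mkℚ -[1+ a ] e p} d 0≤c h = ℚP.nonPositive⁻¹ (mkℚ -[1+ a ] e p)
archimedean {mkℚ (+ zero) e p} d 0≤c h = ℚP.nonPositive⁻¹ (mkℚ (+ zero) e p)
archimedean {z@(mkℚ (+ suc a) e p)} {c} d 0≤c h = ⊥-elim (from-no (0ℚ ℚP.≤? - 1ℚ)
  (subst (0ℚ ≤_) (solve 1 (λ d → d :- (con 1ℚ :+ d) := :- con 1ℚ) refl (ι d))
    (0≤- (ℚP.≤-trans (≤-by (c * z + ι (suc d) * ι a) (0≤+ (0≤* 0≤c 0≤z) (0≤* (0≤ι (suc d)) (0≤ι a))) value) (h n)))))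
  where
  open ≡.≡-Reasoning
  -- This multiple clears the denominator of z, so that n z = (d + 1)(a + 1) already exceeds d.
  n = suc e ℕ.* suc d
  0≤z : 0ℚ ≤ z
  0≤z = ℚP.nonNegative⁻¹ z
  z-value : ι (suc e) * z ≡ ι (suc a)
  z-value = trans (ℚP.*-comm (ι (suc e)) z) (trans (cong (_* ι (suc e)) (sym (ℚP.↥p/↧p≡p z)))
    (trans (fraction-* (+ suc a) (suc e)) (sym (ι-/1 (suc a)))))
  value : (c + ι n) * z ≡ (1ℚ + ι d) + (c * z + ι (suc d) * ι a)
  value = begin
    (c + ι n) * z                               ≡⟨ cong (λ y → (c + y) * z) (ι-* (suc e) (suc d)) ⟩
    (c + ι (suc e) * ι (suc d)) * z             ≡⟨ regroup c (ι (suc e)) (ι (suc d)) z ⟩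
    c * z + ι (suc d) * (ι (suc e) * z)         ≡⟨ cong (λ y → c * z + ι (suc d) * y) (trans z-value (ι-suc a)) ⟩
    c * z + ι (suc d) * (1ℚ + ι a)              ≡⟨ shift (c * z) (ι (suc d)) (ι a) ⟩
    ι (suc d) + (c * z + ι (suc d) * ι a)       ≡⟨ cong (_+ (c * z + ι (suc d) * ι a)) (ι-suc d) ⟩
    (1ℚ + ι d) + (c * z + ι (suc d) * ι a)      ∎
    where
    regroup : ∀ c i j z → (c + i * j) * z ≡ c * z + j * (i * z)
    regroup = solve 4 (λ c i j z → (c :+ i :* j) :* z := c :* z :+ j :* (i :* z)) refl
    shift : ∀ y j a → y + j * (1ℚ + a) ≡ j + (y + j * a)
    shift = solve 3 (λ y j a → y :+ j :* (con 1ℚ :+ a) := j :+ (y :+ j :* a)) refl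

T-antitone-+ : ∀ m n → T (m ℕ.+ n) ≤ T m
T-antitone-+ m zero    = ℚP.≤-reflexive (cong T (ℕP.+-identityʳ m))
T-antitone-+ m (suc n) = ℚP.≤-trans (ℚP.≤-reflexive (cong T (ℕP.+-suc m n))) (ℚP.≤-trans (T-antitone (m ℕ.+ n)) (T-antitone-+ m n))

W-monotone-+ : ∀ m n → W m ≤ W (m ℕ.+ n)
W-monotone-+ m zero    = ℚP.≤-reflexive (cong W (sym (ℕP.+-identityʳ m)))
W-monotone-+ m (suc n) = ℚP.≤-trans (W-monotone-+ m n) (ℚP.≤-trans (W-monotone (m ℕ.+ n)) (ℚP.≤-reflexive (cong W (sym (ℕP.+-suc m n)))))

private
  limit : ∀ {s t d} m → (∀ n → (ι (m ℕ.+ n) + + 2 / 1) * s ≤ (ι (m ℕ.+ n) + + 2 / 1) * t + ι d) → s ≤ t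
  limit {s} {t} {d} m h = ≤-by (0ℚ - (s - t))
    (0≤- (archimedean {s - t} {ι m + + 2 / 1} d (0≤+ (0≤ι m) (0≤constant {+ 2 / 1})) λ n →
      ≤-by (((ι (m ℕ.+ n) + + 2 / 1) * t + ι d) - (ι (m ℕ.+ n) + + 2 / 1) * s) (0≤- (h n))
        (trans (cancel (ι (m ℕ.+ n)) s t (ι d))
          (cong (λ y → y * (s - t) + (((ι (m ℕ.+ n) + + 2 / 1) * t + ι d) - (ι (m ℕ.+ n) + + 2 / 1) * s))
            (trans (cong (_+ + 2 / 1) (ι-+ m n)) (swap (ι m) (ι n)))))))
    (solve 2 (λ s t → t := s :+ (con 0ℚ :- (s :- t))) refl s t)
    where
    cancel : ∀ y s t d → d ≡ (y + + 2 / 1) * (s - t) + (((y + + 2 / 1) * t + d) - (y + + 2 / 1) * s)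
    cancel = solve 4 (λ y s t d → d := (y :+ con (+ 2 / 1)) :* (s :- t) :+ (((y :+ con (+ 2 / 1)) :* t :+ d) :- (y :+ con (+ 2 / 1)) :* s)) refl
    swap : ∀ x y → x + y + + 2 / 1 ≡ x + + 2 / 1 + y
    swap = solve 2 (λ x y → x :+ y :+ con (+ 2 / 1) := x :+ con (+ 2 / 1) :+ y) refl

  0≤m+2 : ∀ m → 0ℚ ≤ ι m + + 2 / 1
  0≤m+2 m = 0≤+ (0≤ι m) (0≤constant {+ 2 / 1})

-- For even L, the partial sum with weights of index m + n is at most T (m + n), hence at most T m.
-- As n grows these weights tend to 1, and `limit` removes the error.
S≤T : ∀ m L → sgn L ≡ 1ℚ → S L ≤ T m
S≤T m L e = limit m λ n → ℚP.≤-trans (proj₁ (S-close (m ℕ.+ n) L))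
  (ℚP.+-monoˡ-≤ (ι (deviation L)) (*-monoˡ (0≤m+2 (m ℕ.+ n)) (ℚP.≤-trans (partial≤T (m ℕ.+ n) L e) (T-antitone-+ m n))))

W≤S : ∀ m L → sgn L ≡ - 1ℚ → + 8 / 1 * W m ≤ S L
W≤S m L e = limit m λ n → ℚP.≤-trans
  (*-monoˡ (0≤m+2 (m ℕ.+ n)) (ℚP.≤-trans (*-monoˡ {+ 8 / 1} 0≤constant (W-monotone-+ m n))
    (ℚP.≤-trans (W-T (m ℕ.+ n)) (T≤partial (m ℕ.+ n) L e))))
  (proj₂ (S-close (m ℕ.+ n) L))

S-suc : ∀ k → S (suc k) ≡ S k + sgn k * err k
S-suc k = trans (sum-upTo-suc leibnizTerm k) (cong (_+_ (S k)) (leibniz-sgn k))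

-- The error bound is the absolute value of the next Leibniz term, so for odd k the left side is the
-- even partial sum S (k + 1); for even k it lies below S k.
S-err≤T : ∀ m k → S k - err k ≤ T m
S-err≤T m k with sgn-cases k
... | inj₁ e = ℚP.≤-trans (≤-by (err k) (0≤err k) (solve 2 (λ s e → s := s :- e :+ e) refl (S k) (err k))) (S≤T m k e)
... | inj₂ e = subst (_≤ T m)
  (trans (S-suc k) (trans (cong (λ s → S k + s * err k) e) (solve 2 (λ s e → s :+ (:- con 1ℚ) :* e := s :- e) refl (S k) (err k))))
  (S≤T m (suc k) (cong -_ e))

W≤S+err : ∀ m k → + 8 / 1 * W m ≤ S k + err k
W≤S+err m k with sgn-cases k
... | inj₁ e = subst (+ 8 / 1 * W m ≤_)
  (trans (S-suc k) (cong (_+_ (S k)) (trans (cong (_* err k) e) (ℚP.*-identityˡ (err k)))))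
  (W≤S m (suc k) (cong -_ e))
... | inj₂ e = ℚP.≤-trans (W≤S m k e) (≤-by (err k) (0≤err k) refl)

S+err≤8 : ∀ k → S k + err k ≤ + 8 / 1
S+err≤8 k = ℚP.+-mono-≤ (subst (_≤ + 4 / 1) (sym (S-partial k)) (Plain.partial-≤-first k)) (err≤4 k)

-- Comparison with Ramanujan's Q-function

-- quotient n n is the sum Q of the header: Ramanujan's Q-function at n + 1.
quotient : ℕ → ℕ → ℚ
quotient n zero    = 1ℚ
quotient n (suc k) = 1ℚ + ι (suc k) * recip n * quotient n k

quotient-* : ∀ n k → quotient n k * ι (suc n ℕ.^ k) ≡ ι (expSum (suc n) k)
quotient-* n zero    = ℚP.*-identityˡ (ι 1)
quotient-* n (suc k) = begin
  (1ℚ + i * r * q) * ι (suc n ℕ.* suc n ℕ.^ k)  ≡⟨ cong ((1ℚ + i * r * q) *_) (ι-* (suc n) (suc n ℕ.^ k)) ⟩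
  (1ℚ + i * r * q) * (N * p)                    ≡⟨ combine₂ (i * q * p) i (expand i r q N p s) (recip-* n) (quotient-* n k) ⟩
  N * p + i * s                                 ≡⟨ cong₂ _+_ (sym (ι-* (suc n) (suc n ℕ.^ k))) (sym (ι-* (suc k) (expSum (suc n) k))) ⟩
  ι (suc n ℕ.^ suc k) + ι (suc k ℕ.* expSum (suc n) k) ≡⟨ ι-+ (suc n ℕ.^ suc k) _ ⟨
  ι (expSum (suc n) (suc k))                    ∎
  where
  open ≡.≡-Reasoning
  i r q N p s : ℚ
  i = ι (suc k)
  r = recip n
  q = quotient n k
  N = ι (suc n)
  p = ι (suc n ℕ.^ k)
  s = ι (expSum (suc n) k)
  expand : ∀ i r q N p s → (1ℚ + i * r * q) * (N * p) ≡ N * p + i * s + i * q * p * (r * N - 1ℚ) + i * (q * p - s)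
  expand = solve 6 (λ i r q N p s → (con 1ℚ :+ i :* r :* q) :* (N :* p)
    := N :* p :+ i :* s :+ i :* q :* p :* (r :* N :- con 1ℚ) :+ i :* (q :* p :- s)) refl

E-cancel : ∀ n {x y} → x * E n ≡ y * E n → x ≡ y
E-cancel n {x} {y} e = trans (sym (unit x)) (trans (cong (_* i) e) (unit y))
  where
  i = inv (length (ParkingFunctions n))
  unit : ∀ z → z * E n * i ≡ z
  unit z = trans (ℚP.*-assoc z (E n) i) (trans (cong (z *_) (E-inverse n)) (ℚP.*-identityʳ z))

E1-quotient : ∀ n → E1 n ≡ + 1 / 2 * (1ℚ + ι n) * quotient n n - (+ 1 / 2 + ι n)
E1-quotient n = E-cancel n (trans (E1-* n) (trans (P₁-closed n) (trans
  (cong (λ s → + 1 / 2 * s - (+ 1 / 2 + ι n) * E n)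
    (trans (sym (quotient-* n n)) (cong (quotient n n *_) (trans (sym (E-value n)) (cong (_* E n) (ι-suc n))))))
  (factor (ι n) (quotient n n) (E n)))))
  where
  factor : ∀ x q e → + 1 / 2 * (q * ((1ℚ + x) * e)) - (+ 1 / 2 + x) * e ≡ (+ 1 / 2 * (1ℚ + x) * q - (+ 1 / 2 + x)) * e
  factor = solve 3 (λ x q e → con (+ 1 / 2) :* (q :* ((con 1ℚ :+ x) :* e)) :- (con (+ 1 / 2) :+ x) :* e
    := (con (+ 1 / 2) :* (con 1ℚ :+ x) :* q :- (con (+ 1 / 2) :+ x)) :* e) refl

β : ℕ → ℕ → ℚ
β m j = (ι m - ι j) * recip (suc (m ℕ.+ j))

β-* : ∀ m j → β m j * (ι m + + 2 / 1 + ι j) ≡ ι m - ι j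
β-* m j = trans (cong (β m j *_) (sym (ι-m+k+2 m j))) (trans (ℚP.*-assoc (ι m - ι j) _ _)
  (trans (cong ((ι m - ι j) *_) (recip-* (suc (m ℕ.+ j)))) (ℚP.*-identityʳ (ι m - ι j))))

b-suc : ∀ m j → b m (suc j) ≡ b m j * β m j
b-suc m j = ι-cancel (suc (m ℕ.+ j)) (subst (λ z → z * b m (suc j) ≡ z * (b m j * β m j)) (sym (ι-m+k+2 m j))
  (combine₂ 1ℚ (- b m j)
    (solve 5 (λ x y b b′ r → (x :+ con (+ 2 / 1) :+ y) :* b′ := (x :+ con (+ 2 / 1) :+ y) :* (b :* r)
      :+ con 1ℚ :* ((x :+ con (+ 2 / 1) :+ y) :* b′ :- (x :- y) :* b)
      :+ (:- b) :* (r :* (x :+ con (+ 2 / 1) :+ y) :- (x :- y))) refl (ι m) (ι j) (b m j) (b m (suc j)) (β m j))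
    (b-ratio m j) (β-* m j)))

-- The tail b_j + b_{j+1} + ... of i terms, divided by b_j. This nested form has the same shape as
-- `quotient`, so the two are compared one ratio at a time, from the innermost outwards.
horner : ℕ → ℕ → ℕ → ℚ
horner m zero    j = 0ℚ
horner m (suc i) j = 1ℚ + β m j * horner m i (suc j)

sumTo-suc : ∀ f i → sumTo f (suc i) ≡ f 0 + sumTo (f ∘ suc) i
sumTo-suc f zero    = ℚP.+-comm 0ℚ (f 0)
sumTo-suc f (suc i) = trans (cong (_+ f (suc i)) (sumTo-suc f i)) (ℚP.+-assoc (f 0) _ (f (suc i)))

horner-sum : ∀ m i j → sumTo (λ t → b m (j ℕ.+ t)) i ≡ b m j * horner m i j
horner-sum m zero    j = sym (ℚP.*-zeroʳ (b m j))
horner-sum m (suc i) j = begin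
  sumTo (λ t → b m (j ℕ.+ t)) (suc i)                       ≡⟨ sumTo-suc (λ t → b m (j ℕ.+ t)) i ⟩
  b m (j ℕ.+ 0) + sumTo (λ t → b m (j ℕ.+ suc t)) i         ≡⟨ cong₂ _+_ (cong (b m) (ℕP.+-identityʳ j))
                                                                 (trans (sumTo-cong i λ t → cong (b m) (ℕP.+-suc j t)) (horner-sum m i (suc j))) ⟩
  b m j + b m (suc j) * horner m i (suc j)                  ≡⟨ cong (λ y → b m j + y * horner m i (suc j)) (b-suc m j) ⟩
  b m j + b m j * β m j * horner m i (suc j)                ≡⟨ factor (b m j) (β m j) (horner m i (suc j)) ⟩
  b m j * horner m (suc i) j                                ∎
  where
  open ≡.≡-Reasoning
  factor : ∀ b r h → b + b * r * h ≡ b * (1ℚ + r * h)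
  factor = solve 3 (λ b r h → b :+ b :* r :* h := b :* (con 1ℚ :+ r :* h)) refl

σ-horner : ∀ m → σ m ≡ horner m (suc m) 0
σ-horner m = trans (horner-sum m (suc m) 0) (trans (cong (_* horner m (suc m) 0) (b-zero m)) (ℚP.*-identityˡ (horner m (suc m) 0)))

0≤β : ∀ m j i → j ℕ.+ i ≡ m → 0ℚ ≤ β m j
0≤β m j i refl = 0≤* (subst (0ℚ ≤_) (trans (solve 2 (λ x y → y := (x :+ y) :- x) refl (ι j) (ι i)) (cong (_- ι j) (sym (ι-+ j i)))) (0≤ι i))
  (0≤recip (suc (j ℕ.+ i ℕ.+ j)))

0≤horner : ∀ m i j → j ℕ.+ i ≡ suc m → 0ℚ ≤ horner m i j
0≤horner m zero    j e = ℚP.≤-refl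
0≤horner m (suc i) j e = 0≤+ {1ℚ} 0≤constant (0≤* (0≤β m j i (ℕP.suc-injective (trans (sym (ℕP.+-suc j i)) e)))
  (0≤horner m i (suc j) (trans (sym (ℕP.+-suc j i)) e)))

-- Backward induction on j. Replacing m - j by β (m + 2 + j) makes the slack a multiple of β, with a
-- factor that is nonnegative by the hypothesis for j + 1.
horner-bound : ∀ m i j → j ℕ.+ i ≡ suc m → (+ 2 / 1 + ι j) * horner m i j ≤ ι m + + 2 / 1
horner-bound m zero    j e = subst (_≤ ι m + + 2 / 1) (sym (ℚP.*-zeroʳ (+ 2 / 1 + ι j))) (0≤+ (0≤ι m) (0≤constant {+ 2 / 1}))
horner-bound m (suc i) j e = ≤-by (r * ((x + + 2 / 1 - (+ 2 / 1 + (1ℚ + y)) * h) + y + h))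
  (0≤* (0≤β m j i (ℕP.suc-injective e′)) (0≤+ (0≤+ (0≤- ih) (0≤ι j)) (0≤horner m i (suc j) e′)))
  (combine₁ (- 1ℚ)
    (solve 4 (λ x y r h → x :+ con (+ 2 / 1)
      := (con (+ 2 / 1) :+ y) :* (con 1ℚ :+ r :* h) :+ r :* ((x :+ con (+ 2 / 1) :- (con (+ 2 / 1) :+ (con 1ℚ :+ y)) :* h) :+ y :+ h)
        :+ (:- con 1ℚ) :* (r :* (x :+ con (+ 2 / 1) :+ y) :- (x :- y))) refl x y r h)
    (β-* m j))
  where
  x y r h : ℚ
  x = ι m
  y = ι j
  r = β m j
  h = horner m i (suc j)
  e′ : suc j ℕ.+ i ≡ suc m
  e′ = trans (sym (ℕP.+-suc j i)) e
  ih : (+ 2 / 1 + (1ℚ + y)) * h ≤ x + + 2 / 1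
  ih = subst (λ z → (+ 2 / 1 + z) * h ≤ x + + 2 / 1) (ι-suc j) (horner-bound m i (suc j) e′)

-- One step of the comparison between quotient and horner, where α = (X - y) / (1 + X) and
-- r = (m - y) / (m + 2 + y) with m = 2 + 2 X are the two ratios.
module Comparison (X y α r q h : ℚ)
  (α-* : (1ℚ + X) * α ≡ X - y) (r-* : (+ 4 / 1 + + 2 / 1 * X + y) * r ≡ + 2 / 1 + + 2 / 1 * X - y)
  (cancel : ∀ {s t} → (1ℚ + X) * ((+ 4 / 1 + + 2 / 1 * X + y) * s) ≤ (1ℚ + X) * ((+ 4 / 1 + + 2 / 1 * X + y) * t) → s ≤ t)
  (0≤X : 0ℚ ≤ X) (0≤y : 0ℚ ≤ y) (0≤α : 0ℚ ≤ α) (0≤h : 0ℚ ≤ h)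
  (h-bound : (+ 3 / 1 + y) * h ≤ + 4 / 1 + + 2 / 1 * X) where

  private
    -- The gap is (1 + y)(2 + y) / ((1 + X)(4 + 2X + y)).
    ratio-gap : 0ℚ ≤ r - α
    ratio-gap = cancel (≤-by ((1ℚ + y) * (+ 2 / 1 + y)) (0≤* (0≤+ {1ℚ} 0≤constant 0≤y) (0≤+ {+ 2 / 1} 0≤constant 0≤y))
      (combine₂ (1ℚ + X) (- (+ 4 / 1 + + 2 / 1 * X + y))
        (solve 4 (λ X y α r → let M = con (+ 4 / 1) :+ con (+ 2 / 1) :* X :+ y in
          (con 1ℚ :+ X) :* (M :* (r :- α)) := (con 1ℚ :+ X) :* (M :* con 0ℚ) :+ (con 1ℚ :+ y) :* (con (+ 2 / 1) :+ y)
            :+ (con 1ℚ :+ X) :* (M :* r :- (con (+ 2 / 1) :+ con (+ 2 / 1) :* X :- y))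
            :+ (:- M) :* ((con 1ℚ :+ X) :* α :- (X :- y))) refl X y α r)
        r-* α-*))

    -- The reason why the error stays at 1 and does not accumulate: passing outwards shrinks the old
    -- error to α, and the change of ratio adds at most 1 - α.
    excess : (r - α) * h ≤ 1ℚ - α
    excess = cancel (≤-by ((1ℚ + y) * ((+ 4 / 1 + + 2 / 1 * X - (+ 3 / 1 + y) * h) + y + h))
      (0≤* (0≤+ {1ℚ} 0≤constant 0≤y) (0≤+ (0≤+ (0≤- h-bound) 0≤y) 0≤h))
      (combine₂ (- ((1ℚ + X) * h)) ((+ 4 / 1 + + 2 / 1 * X + y) * (h - 1ℚ))
        (solve 5 (λ X y α r h → let M = con (+ 4 / 1) :+ con (+ 2 / 1) :* X :+ y in
          (con 1ℚ :+ X) :* (M :* (con 1ℚ :- α))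
          := (con 1ℚ :+ X) :* (M :* ((r :- α) :* h)) :+ (con 1ℚ :+ y) :* ((con (+ 4 / 1) :+ con (+ 2 / 1) :* X :- (con (+ 3 / 1) :+ y) :* h) :+ y :+ h)
            :+ (:- ((con 1ℚ :+ X) :* h)) :* (M :* r :- (con (+ 2 / 1) :+ con (+ 2 / 1) :* X :- y))
            :+ M :* (h :- con 1ℚ) :* ((con 1ℚ :+ X) :* α :- (X :- y))) refl X y α r h)
        r-* α-*))

  lower : q ≤ h → 1ℚ + α * q ≤ 1ℚ + r * h
  lower q≤h = ≤-by (α * (h - q) + (r - α) * h) (0≤+ (0≤* 0≤α (0≤- q≤h)) (0≤* ratio-gap 0≤h))
    (solve 4 (λ α r q h → con 1ℚ :+ r :* h := con 1ℚ :+ α :* q :+ (α :* (h :- q) :+ (r :- α) :* h)) refl α r q h)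

  upper : h ≤ q + 1ℚ → 1ℚ + r * h ≤ (1ℚ + α * q) + 1ℚ
  upper h≤q+1 = ≤-by (α * (q + 1ℚ - h) + ((1ℚ - α) - (r - α) * h)) (0≤+ (0≤* 0≤α (0≤- h≤q+1)) (0≤- excess))
    (solve 4 (λ α r q h → con 1ℚ :+ α :* q :+ con 1ℚ := con 1ℚ :+ r :* h :+ (α :* (q :+ con 1ℚ :- h) :+ ((con 1ℚ :- α) :- (r :- α) :* h))) refl α r q h)

double : ℕ → ℕ
double n = suc n ℕ.+ suc n

ι-double : ∀ n → ι (double n) ≡ + 2 / 1 + + 2 / 1 * ι n
ι-double n = trans (ι-+ (suc n) (suc n)) (trans (cong (λ z → z + z) (ι-suc n))
  (solve 1 (λ x → con 1ℚ :+ x :+ (con 1ℚ :+ x) := con (+ 2 / 1) :+ con (+ 2 / 1) :* x) refl (ι n)))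

index : ∀ n k j → j ℕ.+ k ≡ n → j ℕ.+ (k ℕ.+ (3 ℕ.+ n)) ≡ suc (double n)
index n k j e = trans (sym (ℕP.+-assoc j k (3 ℕ.+ n))) (trans (cong (ℕ._+ (3 ℕ.+ n)) e)
  (trans (ℕP.+-suc n (2 ℕ.+ n)) (cong suc (ℕP.+-suc n (suc n)))))

quotient-horner : ∀ n k j → j ℕ.+ k ≡ n →
  quotient n k ≤ horner (double n) (k ℕ.+ (3 ℕ.+ n)) j × horner (double n) (k ℕ.+ (3 ℕ.+ n)) j ≤ quotient n k + 1ℚ
-- At j = n the sum Q has ended, while `horner` still has the terms from n to m. By `horner-bound`
-- their value is at most (m + 2) / (n + 2) = 2.
quotient-horner n zero j e with trans (sym (ℕP.+-identityʳ j)) e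
... | refl = ≤-by (β m n * horner m (2 ℕ.+ n) (suc n))
               (0≤* (0≤β m n (2 ℕ.+ n) (ℕP.+-suc n (suc n))) (0≤horner m (2 ℕ.+ n) (suc n) (cong suc (ℕP.+-suc n (suc n))))) refl
           , ι-suc-cancel-≤ (suc n) (subst₂ _≤_
               (cong (_* horner m (3 ℕ.+ n) n) (sym (ι-linear₂ n)))
               (trans (cong (_+ + 2 / 1) (ι-double n)) (trans
                 (solve 1 (λ x → con (+ 2 / 1) :+ con (+ 2 / 1) :* x :+ con (+ 2 / 1) := (con (+ 2 / 1) :+ x) :* (con 1ℚ :+ con 1ℚ)) refl (ι n))
                 (cong (_* (1ℚ + 1ℚ)) (sym (ι-linear₂ n)))))
               (horner-bound m (3 ℕ.+ n) n (index n 0 n e)))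
  where m = double n
quotient-horner n (suc k) j e = C.lower (proj₁ ih) , C.upper (proj₂ ih)
  where
  m = double n
  i = k ℕ.+ (3 ℕ.+ n)
  e′ : suc j ℕ.+ k ≡ n
  e′ = trans (sym (ℕP.+-suc j k)) e
  ih = quotient-horner n k (suc j) e′
  M : ℚ
  M = + 4 / 1 + + 2 / 1 * ι n + ι j
  M-value : ι m + + 2 / 1 + ι j ≡ M
  M-value = trans (cong (λ z → z + + 2 / 1 + ι j) (ι-double n))
    (solve 2 (λ x y → con (+ 2 / 1) :+ con (+ 2 / 1) :* x :+ con (+ 2 / 1) :+ y := con (+ 4 / 1) :+ con (+ 2 / 1) :* x :+ y) refl (ι n) (ι j))
  α-* : (1ℚ + ι n) * (ι (suc k) * recip n) ≡ ι n - ι j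
  α-* = trans (cong (_* (ι (suc k) * recip n)) (sym (ι-suc n))) (trans
    (solve 3 (λ N i r → N :* (i :* r) := i :* (r :* N)) refl (ι (suc n)) (ι (suc k)) (recip n)) (trans
    (cong (ι (suc k) *_) (recip-* n)) (trans (ℚP.*-identityʳ (ι (suc k))) (trans
    (solve 2 (λ y i → i := (y :+ i) :- y) refl (ι j) (ι (suc k)))
    (cong (_- ι j) (trans (sym (ι-+ j (suc k))) (cong ι e)))))))
  r-* : M * β m j ≡ + 2 / 1 + + 2 / 1 * ι n - ι j
  r-* = trans (cong (_* β m j) (sym M-value)) (trans (ℚP.*-comm _ (β m j)) (trans (β-* m j) (cong (_- ι j) (ι-double n))))
  cancel : ∀ {s t} → (1ℚ + ι n) * (M * s) ≤ (1ℚ + ι n) * (M * t) → s ≤ t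
  cancel {s} {t} h = ι-suc-cancel-≤ (suc (m ℕ.+ j)) (ι-suc-cancel-≤ n
    (subst₂ (λ N M → N * (M * s) ≤ N * (M * t)) (sym (ι-suc n)) (sym (trans (ι-m+k+2 m j) M-value)) h))
  bound : (+ 3 / 1 + ι j) * horner m i (suc j) ≤ + 4 / 1 + + 2 / 1 * ι n
  bound = subst₂ _≤_
    (cong (_* horner m i (suc j)) (trans (cong (_+_ (+ 2 / 1)) (ι-suc j))
      (solve 1 (λ y → con (+ 2 / 1) :+ (con 1ℚ :+ y) := con (+ 3 / 1) :+ y) refl (ι j))))
    (trans (cong (_+ + 2 / 1) (ι-double n))
      (solve 1 (λ x → con (+ 2 / 1) :+ con (+ 2 / 1) :* x :+ con (+ 2 / 1) := con (+ 4 / 1) :+ con (+ 2 / 1) :* x) refl (ι n)))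
    (horner-bound m i (suc j) (index n k (suc j) e′))
  module C = Comparison (ι n) (ι j) (ι (suc k) * recip n) (β m j) (quotient n k) (horner m i (suc j))
    α-* r-* cancel (0≤ι n) (0≤ι j) (0≤* (0≤ι (suc k)) (0≤recip n)) (0≤horner m i (suc j) (index n k (suc j) e′)) bound

quotient-σ : ∀ n → quotient n n ≤ σ (double n) × σ (double n) ≤ quotient n n + 1ℚ
quotient-σ n = subst (λ s → quotient n n ≤ s × s ≤ quotient n n + 1ℚ)
  (trans (cong (λ i → horner (double n) i 0) (index n n 0 refl)) (sym (σ-horner (double n)))) (quotient-horner n n 0 refl)

-- Asymptotics of the third moment

private
  -- closed-g x * (1 + x) / 2 = 15/64 x⁴ + rest x
  rest : ℚ → ℚ
  rest x = + 743 / 192 + + 327 / 32 * x + + 145 / 16 * (x * x) + + 283 / 96 * (x * x * x)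

  main : ℚ → ℚ
  main x = + 15 / 64 * power x 4

  moment : ℚ → ℚ → ℚ
  moment x q = closed-f x + closed-g x * (+ 1 / 2 * (1ℚ + x) * q - (+ 1 / 2 + x))

  0≤power : ∀ {x} k → 0ℚ ≤ x → 0ℚ ≤ power x k
  0≤power zero    p = 0≤constant
  0≤power (suc k) p = 0≤* p (0≤power k p)

  0≤quartic : ∀ {t} c₀ c₁ c₂ c₃ c₄ → 0ℚ ≤ t → 0ℚ ≤ c₀ → 0ℚ ≤ c₁ → 0ℚ ≤ c₂ → 0ℚ ≤ c₃ → 0ℚ ≤ c₄ →
    0ℚ ≤ c₀ + t * (c₁ + t * (c₂ + t * (c₃ + t * c₄)))
  0≤quartic _ _ _ _ _ p p₀ p₁ p₂ p₃ p₄ = 0≤+ p₀ (0≤* p (0≤+ p₁ (0≤* p (0≤+ p₂ (0≤* p (0≤+ p₃ (0≤* p p₄)))))))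

  0≤rest : ∀ {x} → 0ℚ ≤ x → 0ℚ ≤ rest x
  0≤rest p = 0≤+ (0≤+ (0≤+ {+ 743 / 192} 0≤constant (0≤* {+ 327 / 32} 0≤constant p))
    (0≤* {+ 145 / 16} 0≤constant (0≤* p p))) (0≤* {+ 283 / 96} 0≤constant (0≤* (0≤* p p) p))

  -- x = 1 + t with t ≥ 0, so that the remaining polynomials have nonnegative coefficients.
  moment-upper : ∀ t q s → 0ℚ ≤ t → q ≤ s → s ≤ + 3 / 1 + t →
    moment (1ℚ + t) q - + 101 / 1 * power (1ℚ + t) 4 ≤ main (1ℚ + t) * (s - + 3 / 1)
  moment-upper t q s 0≤t q≤s s≤ = ≤-by
    -- Since `rest` has degree 3, the crude linear bound q ≤ s ≤ 3 + t keeps its contribution at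
    -- order x⁴. The constant 101 leaves a remainder whose coefficients in t are all nonnegative.
    (main (1ℚ + t) * (s - q) + rest (1ℚ + t) * (+ 3 / 1 + t - q)
      + (+ 19 / 64 * power (1ℚ + t) 4 + quartic))
    (0≤+ (0≤+ (0≤* (0≤* {+ 15 / 64} 0≤constant (0≤power 4 0≤x)) (0≤- q≤s)) (0≤* (0≤rest 0≤x) (0≤- (ℚP.≤-trans q≤s s≤))))
      (0≤+ (0≤* {+ 19 / 64} 0≤constant (0≤power 4 0≤x))
        (0≤quartic (+ 3917 / 64) (+ 63505 / 192) (+ 17701 / 32) (+ 12349 / 32) (+ 18899 / 192)
          0≤t 0≤constant 0≤constant 0≤constant 0≤constant 0≤constant)))
    (identity t q s)
    where
    0≤x : 0ℚ ≤ 1ℚ + t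
    0≤x = 0≤+ {1ℚ} 0≤constant 0≤t
    quartic = + 3917 / 64 + t * (+ 63505 / 192 + t * (+ 17701 / 32 + t * (+ 12349 / 32 + t * (+ 18899 / 192))))
    identity : ∀ t q s → main (1ℚ + t) * (s - + 3 / 1) ≡ (moment (1ℚ + t) q - + 101 / 1 * power (1ℚ + t) 4)
      + (main (1ℚ + t) * (s - q) + rest (1ℚ + t) * (+ 3 / 1 + t - q)
      + (+ 19 / 64 * power (1ℚ + t) 4 + (+ 3917 / 64 + t * (+ 63505 / 192 + t * (+ 17701 / 32 + t * (+ 12349 / 32 + t * (+ 18899 / 192)))))))
    identity = solve 3 (λ t q s → let
        x = con 1ℚ :+ t
        x⁴ = x :* (x :* (x :* (x :* con 1ℚ)))
        f = con (- (+ 175 / 192)) :* (x :* x :* x :* x) :+ con (- (+ 283 / 192)) :* (x :* x :* x) :+ con (+ 199 / 192) :* (x :* x) :+ con (+ 259 / 192) :* x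
        g = con (+ 15 / 32) :* (x :* x :* x) :+ con (+ 521 / 96) :* (x :* x) :+ con (+ 1219 / 96) :* x :+ con (+ 743 / 96)
        r = con (+ 743 / 192) :+ con (+ 327 / 32) :* x :+ con (+ 145 / 16) :* (x :* x) :+ con (+ 283 / 96) :* (x :* x :* x)
        m = f :+ g :* (con (+ 1 / 2) :* (con 1ℚ :+ x) :* q :- (con (+ 1 / 2) :+ x)) in
      con (+ 15 / 64) :* x⁴ :* (s :- con (+ 3 / 1))
      := (m :- con (+ 101 / 1) :* x⁴)
        :+ (con (+ 15 / 64) :* x⁴ :* (s :- q) :+ r :* (con (+ 3 / 1) :+ t :- q)
        :+ (con (+ 19 / 64) :* x⁴ :+ (con (+ 3917 / 64) :+ t :* (con (+ 63505 / 192) :+ t :* (con (+ 17701 / 32) :+ t :* (con (+ 12349 / 32) :+ t :* con (+ 18899 / 192))))))))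
      refl

  moment-lower : ∀ t q s → 0ℚ ≤ t → 0ℚ ≤ s → s ≤ q + 1ℚ →
    main (1ℚ + t) * s ≤ moment (1ℚ + t) q + + 101 / 1 * power (1ℚ + t) 4
  moment-lower t q s 0≤t 0≤s s≤q+1 = ≤-by
    ((main (1ℚ + t) + rest (1ℚ + t)) * (q + 1ℚ - s) + rest (1ℚ + t) * s + (power (1ℚ + t) 4 + quartic))
    (0≤+ (0≤+ (0≤* (0≤+ (0≤* {+ 15 / 64} 0≤constant (0≤power 4 0≤x)) (0≤rest 0≤x)) (0≤- s≤q+1)) (0≤* (0≤rest 0≤x) 0≤s))
      (0≤+ (0≤power 4 0≤x)
        (0≤quartic (+ 205 / 6) (+ 7043 / 24) (+ 4293 / 8) (+ 9203 / 24) (+ 9445 / 96)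
          0≤t 0≤constant 0≤constant 0≤constant 0≤constant 0≤constant)))
    (identity t q s)
    where
    0≤x : 0ℚ ≤ 1ℚ + t
    0≤x = 0≤+ {1ℚ} 0≤constant 0≤t
    quartic = + 205 / 6 + t * (+ 7043 / 24 + t * (+ 4293 / 8 + t * (+ 9203 / 24 + t * (+ 9445 / 96))))
    identity : ∀ t q s → moment (1ℚ + t) q + + 101 / 1 * power (1ℚ + t) 4 ≡ main (1ℚ + t) * s
      + ((main (1ℚ + t) + rest (1ℚ + t)) * (q + 1ℚ - s) + rest (1ℚ + t) * s
        + (power (1ℚ + t) 4 + (+ 205 / 6 + t * (+ 7043 / 24 + t * (+ 4293 / 8 + t * (+ 9203 / 24 + t * (+ 9445 / 96)))))))
    identity = solve 3 (λ t q s → let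
        x = con 1ℚ :+ t
        x⁴ = x :* (x :* (x :* (x :* con 1ℚ)))
        f = con (- (+ 175 / 192)) :* (x :* x :* x :* x) :+ con (- (+ 283 / 192)) :* (x :* x :* x) :+ con (+ 199 / 192) :* (x :* x) :+ con (+ 259 / 192) :* x
        g = con (+ 15 / 32) :* (x :* x :* x) :+ con (+ 521 / 96) :* (x :* x) :+ con (+ 1219 / 96) :* x :+ con (+ 743 / 96)
        r = con (+ 743 / 192) :+ con (+ 327 / 32) :* x :+ con (+ 145 / 16) :* (x :* x) :+ con (+ 283 / 96) :* (x :* x :* x)
        m = f :+ g :* (con (+ 1 / 2) :* (con 1ℚ :+ x) :* q :- (con (+ 1 / 2) :+ x)) in
      m :+ con (+ 101 / 1) :* x⁴
      := con (+ 15 / 64) :* x⁴ :* s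
        :+ ((con (+ 15 / 64) :* x⁴ :+ r) :* (q :+ con 1ℚ :- s) :+ r :* s
        :+ (x⁴ :+ (con (+ 205 / 6) :+ t :* (con (+ 7043 / 24) :+ t :* (con (+ 4293 / 8) :+ t :* (con (+ 9203 / 24) :+ t :* con (+ 9445 / 96))))))))
      refl

  square-mono : ∀ {x y} → 0ℚ ≤ x → x ≤ y → x * x ≤ y * y
  square-mono {x} {y} p q = ≤-by ((y - x) * (y - x) + + 2 / 1 * (x * (y - x)))
    (0≤+ (0≤square (y - x)) (0≤* {+ 2 / 1} 0≤constant (0≤* p (0≤- q))))
    (solve 2 (λ x y → y :* y := x :* x :+ ((y :- x) :* (y :- x) :+ con (+ 2 / 1) :* (x :* (y :- x)))) refl x y)

  -- (s - 3)² ≤ s² - 9 for s ≥ 3, and 9 absorbs the error 7 Z / 8 in 8 s² ≤ (4 x + 7) Z because Z ≤ 8.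
  square-upper : ∀ x s Z → 0ℚ ≤ x → + 3 / 1 ≤ s → + 8 / 1 * (s * s) ≤ (+ 4 / 1 * x + + 7 / 1) * Z → Z ≤ + 8 / 1 →
    (main x * (s - + 3 / 1)) * (main x * (s - + 3 / 1)) ≤ + 2 / 1 * (+ 225 / 16384 * power x 9) * Z
  square-upper x s Z 0≤x 3≤s h Z≤8 = ≤-by
    (+ 225 / 32768 * power x 8 * (((+ 4 / 1 * x + + 7 / 1) * Z - + 8 / 1 * (s * s)) + + 7 / 1 * (+ 8 / 1 - Z) + + 48 / 1 * (s - + 3 / 1) + + 16 / 1))
    (0≤* (0≤* {+ 225 / 32768} 0≤constant (0≤power 8 0≤x))
      (0≤+ (0≤+ (0≤+ (0≤- h) (0≤* {+ 7 / 1} 0≤constant (0≤- Z≤8))) (0≤* {+ 48 / 1} 0≤constant (0≤- 3≤s))) (0≤constant {+ 16 / 1})))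
    (identity x s Z)
    where
    identity : ∀ x s Z → + 2 / 1 * (+ 225 / 16384 * power x 9) * Z ≡ (main x * (s - + 3 / 1)) * (main x * (s - + 3 / 1))
      + + 225 / 32768 * power x 8 * (((+ 4 / 1 * x + + 7 / 1) * Z - + 8 / 1 * (s * s)) + + 7 / 1 * (+ 8 / 1 - Z) + + 48 / 1 * (s - + 3 / 1) + + 16 / 1)
    identity = solve 3 (λ x s Z → let
        x⁴ = x :* (x :* (x :* (x :* con 1ℚ)))
        x⁸ = x :* (x :* (x :* (x :* x⁴)))
        m = con (+ 15 / 64) :* x⁴ :* (s :- con (+ 3 / 1)) in
      con (+ 2 / 1) :* (con (+ 225 / 16384) :* (x :* x⁸)) :* Z
      := m :* m :+ con (+ 225 / 32768) :* x⁸ :* (((con (+ 4 / 1) :* x :+ con (+ 7 / 1)) :* Z :- con (+ 8 / 1) :* (s :* s))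
        :+ con (+ 7 / 1) :* (con (+ 8 / 1) :- Z) :+ con (+ 48 / 1) :* (s :- con (+ 3 / 1)) :+ con (+ 16 / 1))) refl

  -- The hypothesis says s² = x τ / 2 + 3 τ / 4; the first summand alone gives the bound, because
  -- main² is 225/4096 x⁸.
  square-lower : ∀ x s Y τ → 0ℚ ≤ x → 0ℚ ≤ τ → + 4 / 1 * (s * s) ≡ (+ 3 / 1 + + 2 / 1 * x) * τ → Y ≤ τ →
    + 2 / 1 * (+ 225 / 16384 * power x 9) * Y ≤ (main x * s) * (main x * s)
  square-lower x s Y τ 0≤x 0≤τ e Y≤τ = ≤-by
    (+ 225 / 32768 * power x 8 * (+ 4 / 1 * x * (τ - Y) + + 6 / 1 * τ))
    (0≤* (0≤* {+ 225 / 32768} 0≤constant (0≤power 8 0≤x))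
      (0≤+ (0≤* (0≤* {+ 4 / 1} 0≤constant 0≤x) (0≤- Y≤τ)) (0≤* {+ 6 / 1} 0≤constant 0≤τ)))
    (combine₁ (+ 225 / 16384 * power x 8) (identity x s Y τ) e)
    where
    identity : ∀ x s Y τ → (main x * s) * (main x * s) ≡ + 2 / 1 * (+ 225 / 16384 * power x 9) * Y
      + + 225 / 32768 * power x 8 * (+ 4 / 1 * x * (τ - Y) + + 6 / 1 * τ)
      + + 225 / 16384 * power x 8 * (+ 4 / 1 * (s * s) - (+ 3 / 1 + + 2 / 1 * x) * τ)
    identity = solve 4 (λ x s Y τ → let
        x⁴ = x :* (x :* (x :* (x :* con 1ℚ)))
        x⁸ = x :* (x :* (x :* (x :* x⁴)))
        m = con (+ 15 / 64) :* x⁴ :* s in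
      m :* m := con (+ 2 / 1) :* (con (+ 225 / 16384) :* (x :* x⁸)) :* Y
        :+ con (+ 225 / 32768) :* x⁸ :* (con (+ 4 / 1) :* x :* (τ :- Y) :+ con (+ 6 / 1) :* τ)
        :+ con (+ 225 / 16384) :* x⁸ :* (con (+ 4 / 1) :* (s :* s) :- (con (+ 3 / 1) :+ con (+ 2 / 1) :* x) :* τ)) refl

  -- Squaring needs w (s - 3) to be nonnegative. If s ≤ 3, the bound on z makes it nonpositive, and
  -- the first alternative of `_≤√2π·_` holds.
  ≤√-from : ∀ {z w u s} → z ≤ w * (s - + 3 / 1) → 0ℚ ≤ w →
    (+ 3 / 1 ≤ s → ∀ k → (w * (s - + 3 / 1)) * (w * (s - + 3 / 1)) ≤ + 2 / 1 * u * (S k + err k)) → z ≤√2π· u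
  ≤√-from {z} {w} {u} {s} z≤ 0≤w h with ℚP.≤-total z 0ℚ | ℚP.≤-total s (+ 3 / 1)
  ... | inj₁ z≤0 | _        = inj₁ z≤0
  ... | inj₂ _   | inj₁ s≤3 = inj₁ (ℚP.≤-trans z≤ (≤-by (w * (+ 3 / 1 - s)) (0≤* 0≤w (0≤- s≤3))
    (solve 2 (λ w s → con 0ℚ := w :* (s :- con (+ 3 / 1)) :+ w :* (con (+ 3 / 1) :- s)) refl w s)))
  ... | inj₂ 0≤z | inj₂ 3≤s = inj₂ λ k → ℚP.≤-trans (square-mono 0≤z z≤) (h 3≤s k)

module _ (n : ℕ) where
  private
    m = double (suc n)
    t x s : ℚ
    t = ι n
    x = 1ℚ + t
    s = σ m

    x-value : ι (suc n) ≡ x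
    x-value = ι-suc n

    m-value : ι m ≡ + 2 / 1 + + 2 / 1 * x
    m-value = trans (ι-double (suc n)) (cong (λ y → + 2 / 1 + + 2 / 1 * y) x-value)

    0≤t : 0ℚ ≤ t
    0≤t = 0≤ι n

    0≤x : 0ℚ ≤ x
    0≤x = 0≤+ {1ℚ} 0≤constant 0≤t

    M3-value : M3 (suc n) ≡ moment x (quotient (suc n) (suc n))
    M3-value = trans (M3-closed (suc n)) (trans (cong (λ e → closed-f (ι (suc n)) + closed-g (ι (suc n)) * e) (E1-quotient (suc n)))
      (cong (λ y → moment y (quotient (suc n) (suc n))) x-value))

    0≤s : 0ℚ ≤ s
    0≤s = subst (0ℚ ≤_) (sym (σ-horner m)) (0≤horner m (suc m) 0 refl)

    s-bound : s ≤ + 3 / 1 + t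
    s-bound = ι-suc-cancel-≤ 1 (subst₂ _≤_
      (cong₂ _*_ (trans (cong (_+_ (+ 2 / 1)) ι-zero) (sym (ι-/1 2))) (sym (σ-horner m)))
      (trans (cong (_+ + 2 / 1) m-value) (trans
        (solve 1 (λ t → con (+ 2 / 1) :+ con (+ 2 / 1) :* (con 1ℚ :+ t) :+ con (+ 2 / 1) := con (+ 2 / 1) :* (con (+ 3 / 1) :+ t)) refl t)
        (cong (_* (+ 3 / 1 + t)) (sym (ι-/1 2)))))
      (horner-bound m (suc m) 0 refl))

    s²-upper : ∀ k → + 8 / 1 * (s * s) ≤ (+ 4 / 1 * x + + 7 / 1) * (S k + err k)
    s²-upper k = ≤-by ((+ 3 / 1 + + 2 / 1 * ι m) * ((S k + err k) - + 8 / 1 * W m))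
      (0≤* (0≤+ {+ 3 / 1} 0≤constant (0≤* {+ 2 / 1} 0≤constant (0≤ι m))) (0≤- (W≤S+err m k)))
      (combine₂ (+ 8 / 1) (- (+ 2 / 1 * (S k + err k)))
        (expand x s (W m) (S k + err k) (ι m)) (W-* m) m-value)
      where
      expand : ∀ x s w Z i → (+ 4 / 1 * x + + 7 / 1) * Z ≡ + 8 / 1 * (s * s) + (+ 3 / 1 + + 2 / 1 * i) * (Z - + 8 / 1 * w)
        + + 8 / 1 * ((+ 3 / 1 + + 2 / 1 * i) * w - s * s) + (- (+ 2 / 1 * Z)) * (i - (+ 2 / 1 + + 2 / 1 * x))
      expand = solve 5 (λ x s w Z i → (con (+ 4 / 1) :* x :+ con (+ 7 / 1)) :* Z
        := con (+ 8 / 1) :* (s :* s) :+ (con (+ 3 / 1) :+ con (+ 2 / 1) :* i) :* (Z :- con (+ 8 / 1) :* w)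
          :+ con (+ 8 / 1) :* ((con (+ 3 / 1) :+ con (+ 2 / 1) :* i) :* w :- s :* s)
          :+ (:- (con (+ 2 / 1) :* Z)) :* (i :- (con (+ 2 / 1) :+ con (+ 2 / 1) :* x))) refl

    s²-value : + 4 / 1 * (s * s) ≡ (+ 3 / 1 + + 2 / 1 * x) * T m
    s²-value = trans (σ²-T m) (cong (_* T m) (trans (cong (_+_ 1ℚ) m-value)
      (solve 1 (λ x → con 1ℚ :+ (con (+ 2 / 1) :+ con (+ 2 / 1) :* x) := con (+ 3 / 1) :+ con (+ 2 / 1) :* x) refl x)))

    0≤main : 0ℚ ≤ main x
    0≤main = 0≤* {+ 15 / 64} 0≤constant (0≤power 4 0≤x)

    power-x : ∀ k → power x k ≡ (+ (suc n ℕ.^ k)) / 1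
    power-x k = trans (cong (λ y → power y k) (sym x-value)) (sym (power-/1 (suc n) k))

  -- The fraction is (15/128)², so that the square root of 2π times the radicand is 15/128 √(2π)
  -- n^(9/2) with n replaced by `suc n`.
  third-moment-upper : (M3 (suc n) - (+ 101 / 1) * ((+ (suc n ℕ.^ 4)) / 1)) ≤√2π· (((+ 225) / 16384) * ((+ (suc n ℕ.^ 9)) / 1))
  third-moment-upper = subst₂ (λ y z → (M3 (suc n) - (+ 101 / 1) * y) ≤√2π· (((+ 225) / 16384) * z)) (power-x 4) (power-x 9)
    (≤√-from {M3 (suc n) - (+ 101 / 1) * power x 4} {main x} {((+ 225) / 16384) * power x 9} {s}
      (subst (λ y → y - (+ 101 / 1) * power x 4 ≤ main x * (s - + 3 / 1)) (sym M3-value)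
        (moment-upper t (quotient (suc n) (suc n)) s 0≤t (proj₁ (quotient-σ (suc n))) s-bound))
      0≤main
      (λ 3≤s k → square-upper x s (S k + err k) 0≤x 3≤s (s²-upper k) (S+err≤8 k)))

  third-moment-lower : √2π· (((+ 225) / 16384) * ((+ (suc n ℕ.^ 9)) / 1)) ≤ (M3 (suc n) + (+ 101 / 1) * ((+ (suc n ℕ.^ 4)) / 1))
  third-moment-lower = subst₂ (λ y z → √2π· (((+ 225) / 16384) * z) ≤ (M3 (suc n) + (+ 101 / 1) * y)) (power-x 4) (power-x 9)
    ( ℚP.≤-trans (0≤* 0≤main 0≤s) bound
    , λ k → ℚP.≤-trans (square-lower x s (S k - err k) (T m) 0≤x (0≤T m) s²-value (S-err≤T m k))
        (square-mono (0≤* 0≤main 0≤s) bound))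
    where
    bound : main x * s ≤ M3 (suc n) + (+ 101 / 1) * power x 4
    bound = subst (λ y → main x * s ≤ y + (+ 101 / 1) * power x 4) (sym M3-value)
      (moment-lower t (quotient (suc n) (suc n)) s 0≤t 0≤s (proj₂ (quotient-σ (suc n))))

theorem3 : ((n : ℕ) → 1 ℕ.≤ n →
    M3 n ≡
    (-[1+ 174 ] / 192) * ((+ (n ℕ.^ 4)) / 1)
    + (-[1+ 282 ] / 192) * ((+ (n ℕ.^ 3)) / 1)
    + ((+ 199) / 192) * ((+ (n ℕ.^ 2)) / 1)
    + ((+ 259) / 192) * ((+ n) / 1)
    + ( ((+ 15) / 32) * ((+ (n ℕ.^ 3)) / 1)
    + ((+ 521) / 96) * ((+ (n ℕ.^ 2)) / 1)
    + ((+ 1219) / 96) * ((+ n) / 1)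
    + ((+ 743) / 96) ) * E1 n)
    ×
    (∃[ C ] ∃[ N ] ((n : ℕ) → N ℕ.≤ n →
    ((M3 n - C * ((+ (n ℕ.^ 4)) / 1)) ≤√2π· (((+ 225) / 16384) * ((+ (n ℕ.^ 9)) / 1)))
    × (√2π· (((+ 225) / 16384) * ((+ (n ℕ.^ 9)) / 1)) ≤ (M3 n + C * ((+ (n ℕ.^ 4)) / 1)))))
theorem3 = (λ n _ → third-moment n) , + 101 / 1 , 1 , λ { (suc n) _ → third-moment-upper n , third-moment-lower n }
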